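{- Let $A$ and $B$ be strings of lengths $m$ and $n$, respectively, over a constant-size alphabet $\Sigma$, let $L=LCS(A,B)$ and $\Delta=n-L$. There is a data structure using $O(m+n)$ space that encodes the LCS score between $A$ and every substring of $B$ (the matrix $\mathcal{K}$), and between every suffix of $B$ and every prefix of $A$ (the matrix $\mathcal{J}$), and that supports both appending a character to $A$ (replacing $A$ by $A\sigma$, $\sigma\in\Sigma$) in $O(\Delta)$ time and appending a character to $B$ (replacing $B$ by $B\sigma$, $\sigma\in\Sigma$) in $O(L)$ time.
   Context: $LCS(X,Y)$ is the length of a longest common subsequence of the strings $X$ and $Y$. For a string $S=\sigma_1\cdots\sigma_n$, $S[i..j]=\sigma_{i+1}\cdots\sigma_j$. The matrix $\mathcal{K}$ is indexed by $[0:n]\times[0:n]$, with $\mathcal{K}[i,j]=LCS(B[i..j],A)$ if $i\le j$ and $\mathcal{K}[i,j]=j-i$ if $i>j$. The matrix $\mathcal{J}$ is indexed by $[0:n]\times[0:m]$, with $\mathcal{J}[i,j]=LCS(B[i..n],A[0..j])$. For a matrix $\mathcal{D}$ over $[0:n]\times[0:m]$, its density matrix $\mathcal{D}^\square$ is the matrix over $[1:n]\times[1:m]$ with $\mathcal{D}^\square[i,j]=\mathcal{D}[i,j]+\mathcal{D}[i-1,j-1]-\mathcal{D}[i-1,j]-\mathcal{D}[i,j-1]$; its non-zero cells are called pivotal points. The matrices $\mathcal{K}$ and $\mathcal{J}$ are encoded by storing lists of the pivotal points of $\mathcal{K}^\square$ and of $\mathcal{J}^\square$; after each update the data structure must encode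 the matrices of the current strings. $\Delta$ and $L$ in the time bounds refer to the current strings. -}

module Defs where

open import Data.Bool.Base using (Bool; true; false; if_then_else_)
open import Data.Fin.Base using (Fin; toℕ)
import Data.Fin.Properties as Fin
open import Data.Integer.Base as ℤ using (ℤ; +_; 0ℤ)
open import Data.List.Base using (List; []; _∷_; _++_; map; length; take; drop; filter)
open import Data.List.Extrema.Nat using (argmax; f[xs]≤f[argmax]; argmax-all)
open import Data.List.Membership.Propositional using (_∈_)
open import Data.List.Membership.Propositional.Properties
  using (∈-++⁺ˡ; ∈-++⁺ʳ; ∈-++⁻; ∈-map⁺; ∈-map⁻; ∈-filter⁺; ∈-filter⁻)
open import Data.List.Relation.Binary.Sublist.Propositional using (_⊆_; []; _∷_; _∷ʳ_; minimum)
open import Data.List.Relation.Unary.All as All using (All)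
open import Data.List.Relation.Unary.Any using (here; there)
open import Data.List.Relation.Unary.Unique.Propositional using (Unique)
open import Data.Nat.Base using (ℕ; _+_; _*_; _∸_; _^_; _≤_; _<_; _≡ᵇ_; _<ᵇ_)
open import Data.Nat.Properties using (_≤?_)
open import Data.Product.Base using (_×_; _,_; proj₁; proj₂; ∃-syntax)
open import Data.Sum.Base using (inj₁; inj₂)
open import Function.Bundles using (_⇔_)
open import Relation.Binary.PropositionalEquality using (_≡_; _≢_; refl)
open import Relation.Nullary using (does)
open import Relation.Unary using (Decidable)
import Data.List.Relation.Binary.Sublist.DecPropositional as DecSublist

------------------------------------------------------------------------
-- Strings and longest common subsequences

String : ℕ → Set
String k = List (Fin k)

-- slice i j S consists of the characters i+1, …, j of S (counting from 1).
slice : ∀ {k} → ℕ → ℕ → String k → String k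
slice i j S = drop i (take j S)

subsequences : ∀ {k} → String k → List (String k)
subsequences []      = [] ∷ []
subsequences (x ∷ X) = map (x ∷_) (subsequences X) ++ subsequences X

subsequence? : ∀ {k} (Y : String k) → Decidable (_⊆ Y)
subsequence? Y X = DecSublist._⊆?_ Fin._≟_ X Y

commonSubsequences : ∀ {k} → String k → String k → List (String k)
commonSubsequences X Y = filter (subsequence? Y) (subsequences X)

longestCommonSubsequence : ∀ {k} → String k → String k → String k
longestCommonSubsequence X Y = argmax length [] (commonSubsequences X Y)

LCS : ∀ {k} → String k → String k → ℕ
LCS X Y = length (longestCommonSubsequence X Y)

∈-subsequences⁺ : ∀ {k} {X Z : String k} → Z ⊆ X → Z ∈ subsequences X
∈-subsequences⁺ []                      = here refl
∈-subsequences⁺ {X = x ∷ X} (_ ∷ʳ p)    = ∈-++⁺ʳ (map (x ∷_) (subsequences X)) (∈-subsequences⁺ p)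
∈-subsequences⁺ {X = x ∷ X} (refl ∷ p)  = ∈-++⁺ˡ (∈-map⁺ (x ∷_) (∈-subsequences⁺ p))

∈-subsequences⁻ : ∀ {k} (X : String k) {Z : String k} → Z ∈ subsequences X → Z ⊆ X
∈-subsequences⁻ []      (here refl) = []
∈-subsequences⁻ (x ∷ X) p with ∈-++⁻ (map (x ∷_) (subsequences X)) p
... | inj₂ q = x ∷ʳ ∈-subsequences⁻ X q
... | inj₁ q with ∈-map⁻ (x ∷_) q
...   | _ , r , refl = refl ∷ ∈-subsequences⁻ X r

longestCommonSubsequence-common : ∀ {k} (X Y : String k) →
  longestCommonSubsequence X Y ⊆ X × longestCommonSubsequence X Y ⊆ Y
longestCommonSubsequence-common X Y =
  argmax-all length {P = λ Z → Z ⊆ X × Z ⊆ Y} (minimum X , minimum Y)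
    (All.tabulate λ p → let q = ∈-filter⁻ (subsequence? Y) {xs = subsequences X} p
                        in ∈-subsequences⁻ X (proj₁ q) , proj₂ q)

LCS-longest : ∀ {k} {X Y : String k} (Z : String k) → Z ⊆ X → Z ⊆ Y → length Z ≤ LCS X Y
LCS-longest {X = X} {Y} Z p q =
  All.lookup (f[xs]≤f[argmax] [] (commonSubsequences X Y))
    (∈-filter⁺ (subsequence? Y) (∈-subsequences⁺ p) q)

------------------------------------------------------------------------
-- The matrices and their pivotal points

-- A matrix over [0:n]×[0:m] is a function of which only the entries in that
-- range are ever used; the dimensions are supplied to IsPivotal.
Matrix : Set
Matrix = ℕ → ℕ → ℤ

𝒦 : ∀ {k} → String k → String k → Matrix
𝒦 A B i j = if does (i ≤? j) then + LCS (slice i j B) A else j ℤ.⊖ i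

𝒥 : ∀ {k} → String k → String k → Matrix
𝒥 A B i j = + LCS (slice i (length B) B) (slice 0 j A)

density : Matrix → Matrix
density D i j = D i j ℤ.+ D (i ∸ 1) (j ∸ 1) ℤ.- D (i ∸ 1) j ℤ.- D i (j ∸ 1)

IsPivotal : ℕ → ℕ → Matrix → ℕ × ℕ → Set
IsPivotal n m D (i , j) =
  (1 ≤ i × i ≤ n) × (1 ≤ j × j ≤ m) × density D i j ≢ 0ℤ

ListsPivotalPoints : ℕ → ℕ → Matrix → List (ℕ × ℕ) → Set
ListsPivotalPoints n m D ps = Unique ps × (∀ p → p ∈ ps ⇔ IsPivotal n m D p)

------------------------------------------------------------------------
-- A unit-cost word RAM.  There are no registers apart from the memory cells
-- themselves: cells with constant addresses play that role.  A machine has S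
-- cells holding words below W; an access outside the memory or a result that
-- does not fit in a word is a fault, for which Run has no rule.

Memory : Set
Memory = ℕ → ℕ

_[_↦_] : Memory → ℕ → ℕ → Memory
(μ [ a ↦ v ]) x = if x ≡ᵇ a then v else μ x

data Expr : Set where
  lit             : ℕ → Expr
  mem             : Expr → Expr
  add sub mul     : Expr → Expr → Expr

data Test : Set where
  eq lt : Expr → Expr → Test

data Program : Set where
  skip  : Program
  _≔_   : Expr → Expr → Program      -- e ≔ e′ stores e′ in the cell with address e
  _⨾_   : Program → Program → Program
  cond  : Test → Program → Program → Program
  while : Test → Program → Program

infix  5 _≔_
infixr 4 _⨾_

⟦_⟧ : Expr → Memory → ℕ
⟦ lit v ⟧   μ = v
⟦ mem e ⟧   μ = μ (⟦ e ⟧ μ)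
⟦ add e f ⟧ μ = ⟦ e ⟧ μ + ⟦ f ⟧ μ
⟦ sub e f ⟧ μ = ⟦ e ⟧ μ ∸ ⟦ f ⟧ μ
⟦ mul e f ⟧ μ = ⟦ e ⟧ μ * ⟦ f ⟧ μ

⟦_⟧ᵗ : Test → Memory → Bool
⟦ eq e f ⟧ᵗ μ = ⟦ e ⟧ μ ≡ᵇ ⟦ f ⟧ μ
⟦ lt e f ⟧ᵗ μ = ⟦ e ⟧ μ <ᵇ ⟦ f ⟧ μ

cost : Expr → ℕ
cost (lit v)   = 1
cost (mem e)   = 1 + cost e
cost (add e f) = 1 + cost e + cost f
cost (sub e f) = 1 + cost e + cost f
cost (mul e f) = 1 + cost e + cost f

costᵗ : Test → ℕ
costᵗ (eq e f) = 1 + cost e + cost f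
costᵗ (lt e f) = 1 + cost e + cost f

module _ (S W : ℕ) where

  NoFault : Expr → Memory → Set
  NoFault (lit v)   μ = v < W
  NoFault (mem e)   μ = NoFault e μ × ⟦ e ⟧ μ < S
  NoFault (add e f) μ = NoFault e μ × NoFault f μ × ⟦ e ⟧ μ + ⟦ f ⟧ μ < W
  NoFault (sub e f) μ = NoFault e μ × NoFault f μ
  NoFault (mul e f) μ = NoFault e μ × NoFault f μ × ⟦ e ⟧ μ * ⟦ f ⟧ μ < W

  NoFaultᵗ : Test → Memory → Set
  NoFaultᵗ (eq e f) μ = NoFault e μ × NoFault f μ
  NoFaultᵗ (lt e f) μ = NoFault e μ × NoFault f μ

  -- Run P μ t μ′: started in μ, the program P halts in μ′ after t time units.
  data Run : Program → Memory → ℕ → Memory → Set where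
    skip : ∀ {μ} → Run skip μ 1 μ
    assign : ∀ {e f μ} → NoFault e μ → NoFault f μ → ⟦ e ⟧ μ < S →
      Run (e ≔ f) μ (1 + cost e + cost f) (μ [ ⟦ e ⟧ μ ↦ ⟦ f ⟧ μ ])
    seq : ∀ {P Q μ μ′ μ″ t u} → Run P μ t μ′ → Run Q μ′ u μ″ →
      Run (P ⨾ Q) μ (t + u) μ″
    cond-true : ∀ {b P Q μ μ′ t} → NoFaultᵗ b μ → ⟦ b ⟧ᵗ μ ≡ true →
      Run P μ t μ′ → Run (cond b P Q) μ (costᵗ b + t) μ′
    cond-false : ∀ {b P Q μ μ′ t} → NoFaultᵗ b μ → ⟦ b ⟧ᵗ μ ≡ false →
      Run Q μ t μ′ → Run (cond b P Q) μ (costᵗ b + t) μ′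
    while-true : ∀ {b P μ μ′ μ″ t u} → NoFaultᵗ b μ → ⟦ b ⟧ᵗ μ ≡ true →
      Run P μ t μ′ → Run (while b P) μ′ u μ″ →
      Run (while b P) μ (costᵗ b + t + u) μ″
    while-false : ∀ {b P μ} → NoFaultᵗ b μ → ⟦ b ⟧ᵗ μ ≡ false →
      Run (while b P) μ (costᵗ b) μ

  -- Unallocated cells are blank, so no information can be hidden in them and
  -- an update that enlarges the memory obtains blank cells.
  Fits : Memory → Set
  Fits μ = (∀ x → S ≤ x → μ x ≡ 0) × (∀ x → μ x < W)

-- StoredAt μ p ps: a linked list with contents ps starts at address p.  A node
-- at p keeps a point in cells p, p+1 and the address of the next node in cell
-- p+2; any further fields are left unspecified.  Address 0 is the null pointer.
data StoredAt (μ : Memory) : ℕ → List (ℕ × ℕ) → Set where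
  null : StoredAt μ 0 []
  node : ∀ {p ps} → p ≢ 0 → StoredAt μ (μ (2 + p)) ps →
    StoredAt μ p ((μ p , μ (1 + p)) ∷ ps)

-- The matrix D over [0:n]×[0:m] is encoded by a list of its pivotal points
-- whose first node is pointed to by cell h.
Encodes : Memory → (h n m : ℕ) → Matrix → Set
Encodes μ h n m D = ∃[ ps ] (StoredAt μ (μ h) ps × ListsPivotalPoints n m D ps)

------------------------------------------------------------------------
-- Data structures for a pair of strings over an alphabet with k characters

record DataStructure (k : ℕ) : Set₁ where
  field
    Represents      : Memory → String k → String k → Set
    head𝒦 head𝒥     : ℕ
    appendA appendB : Program

-- O(m+n) cells
space : ∀ {k} → ℕ → String k → String k → ℕ
space c A B = c * (1 + length A + length B)

-- Words of O(log(m+n)) bits hold numbers below a fixed power of m+n+2.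
wordBound : ∀ {k} → ℕ → String k → String k → ℕ
wordBound c A B = (2 + length A + length B) ^ c

-- The character to be appended is passed in cell 0.
input : ∀ {k} → Memory → Fin k → Memory
input μ σ = μ [ 0 ↦ toℕ σ ]

Δ : ∀ {k} → String k → String k → ℕ
Δ A B = length B ∸ LCS A B

{-# OPTIONS --safe #-}
module Submission where

-- Draw A along the rows and B along the columns of a grid, and let a seaweed
-- labelled j enter column j from above; everything that enters from the left is
-- labelled 0.  Two seaweeds meeting in a cell cross, unless the characters match
-- or they have crossed before, in which case they bounce.  Induction over the
-- grid shows that LCS(B[i..j], A[0..l]) grows by one from l to l + 1 exactly when
-- the label leaving cell (j, l + 1) to the right exceeds i, and fails to grow
-- from j to j + 1 exactly when the label leaving cell (j + 1, l) downwards does.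
-- Hence the pivots of 𝒦 are the pairs (label, column) at the bottom and those of
-- 𝒥 the pairs (label, row) at the right, over the nonzero labels; there are Δ
-- and L of them.
--
-- Appending to A carries a label through a new row, starting with 0.  While it
-- is 0, columns labelled 0 can be skipped; once it is not, the next column
-- either has a pivot or takes the label over, so the work is O(Δ).  Appending
-- to B carries the label n + 1 down a new column.  There a row labelled 0 takes a
-- nonzero label over only if the characters match, so one jumps to the next pivot
-- or to the next occurrence of the character, whichever is first.

open import Defs
open import Data.Bool.Base using (Bool; true; false; if_then_else_; _∨_; T)
open import Data.Empty using (⊥-elim)
open import Data.Fin.Base using (Fin; toℕ)
import Data.Fin.Properties as Fin
open import Data.Integer.Base as ℤ using (+_; 0ℤ)
import Data.Integer.Properties as ℤ
import Data.Integer.Solver as ℤ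
open import Data.List.Base using ([]; _∷_; _++_; length; take; drop; _∷ʳ_)
open import Data.List.Membership.Propositional using (_∈_)
open import Data.List.Properties using (length-++; length-take; take-all; drop-all;
  ∷ʳ-injective; ∷ʳ-++; ++-identityʳ)
open import Data.List.Relation.Binary.Sublist.Propositional as Sub using (_⊆_; []; _∷_)
import Data.List.Relation.Binary.Sublist.Propositional.Properties as SubP
open import Data.List.Relation.Unary.All as All using (All)
open import Data.List.Relation.Unary.AllPairs using ([]; _∷_)
open import Data.List.Relation.Unary.Any using (here; there)
open import Data.List.Relation.Unary.Unique.Propositional using (Unique)
open import Data.Nat.Base
open import Data.Nat.Properties
open import Data.Nat.Solver using (module +-*-Solver)
open import Data.Product.Base using (Σ; _×_; _,_; proj₁; proj₂; ∃-syntax)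
open import Data.Sum.Base using (_⊎_; inj₁; inj₂)
open import Data.Unit.Base using (tt)
open import Function.Bundles using (_⇔_; mk⇔; Equivalence)
open import Relation.Binary.Definitions using (tri<; tri≈; tri>)
open import Relation.Binary.PropositionalEquality
open import Relation.Nullary using (¬_; Dec; yes; no; contradiction)

-- Skipping alone does not bound the work: besides the pivots, a sweep stops at positions labelled 0
-- that take over a nonzero label. Each such stop leaves 0 as the carried label, and only a pivot
-- can make it nonzero again; so, apart from one due to the label at the start, these stops are no
-- more numerous than the pivots. With p pivots before the update there are at most 2p + 1
-- iterations. The linked list that guides the jumps is rebuilt while it is being traversed, and old
-- and new links share the same fields. This works because the new list never reaches beyond the
-- current position, and an old link is read before its field can be overwritten. Both updates are
-- instances of one sweep, with the roles of above and left exchanged; they differ in the crossing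
-- test and in the way the next position is found. The next occurrence of a character comes from a
-- table of counts and positions for `A`. Appending to `A` extends it by copying one count per
-- character, which is constant work for a fixed alphabet; appending to `B` leaves it alone.

≡ᵇ-refl : ∀ x → (x ≡ᵇ x) ≡ true
≡ᵇ-refl zero    = refl
≡ᵇ-refl (suc x) = ≡ᵇ-refl x

≡ᵇ-sym : ∀ x y → (x ≡ᵇ y) ≡ (y ≡ᵇ x)
≡ᵇ-sym zero    zero    = refl
≡ᵇ-sym zero    (suc y) = refl
≡ᵇ-sym (suc x) zero    = refl
≡ᵇ-sym (suc x) (suc y) = ≡ᵇ-sym x y

≡ᵇ-true⇒≡ : ∀ x y → (x ≡ᵇ y) ≡ true → x ≡ y
≡ᵇ-true⇒≡ x y p = ≡ᵇ⇒≡ x y (subst T (sym p) tt)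

≡ᵇ-false⇒≢ : ∀ x y → (x ≡ᵇ y) ≡ false → x ≢ y
≡ᵇ-false⇒≢ x .x p refl with trans (sym p) (≡ᵇ-refl x)
... | ()

≢⇒≡ᵇ-false : ∀ {x y} → x ≢ y → (x ≡ᵇ y) ≡ false
≢⇒≡ᵇ-false {x} {y} x≢y with x ≡ᵇ y in e
... | false = refl
... | true  = contradiction (≡ᵇ-true⇒≡ x y e) x≢y

<⇒<ᵇ-true : ∀ {x y} → x < y → (x <ᵇ y) ≡ true
<⇒<ᵇ-true {zero}  (s≤s _) = refl
<⇒<ᵇ-true {suc x} (s≤s p) = <⇒<ᵇ-true {x} p

≥⇒<ᵇ-false : ∀ {x y} → y ≤ x → (x <ᵇ y) ≡ false
≥⇒<ᵇ-false z≤n                         = refl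
≥⇒<ᵇ-false {suc x} (s≤s {zero}  p)     = refl
≥⇒<ᵇ-false {suc x} (s≤s {suc y} p)     = ≥⇒<ᵇ-false {x} p

<ᵇ-true⇒< : ∀ {x y} → (x <ᵇ y) ≡ true → x < y
<ᵇ-true⇒< {x} {y} p = <ᵇ⇒< x y (subst T (sym p) tt)

<ᵇ-false⇒≥ : ∀ {x y} → (x <ᵇ y) ≡ false → y ≤ x
<ᵇ-false⇒≥ {x} {y} p = ≮⇒≥ λ q → contradiction (trans (sym p) (<⇒<ᵇ-true q)) λ ()

-- Seaweeds

-- c is the seaweed from above and r the one from the left.  A crossing reverses
-- their order, so c < r means that they have crossed before.
swaps : (x y c r : ℕ) → Bool
swaps x y c r = (x ≡ᵇ y) ∨ (c <ᵇ r)

-- The labels leaving cell (j, l) to the right and downwards; across is junk for l = 0.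
across down : (α β : ℕ → ℕ) → ℕ → ℕ → ℕ
across α β zero    l       = 0
across α β (suc j) zero    = 0
across α β (suc j) (suc l) =
  if swaps (β (suc j)) (α (suc l)) (down α β (suc j) l) (across α β j (suc l))
  then down α β (suc j) l else across α β j (suc l)
down α β j       zero    = j
down α β zero    (suc l) = 0
down α β (suc j) (suc l) =
  if swaps (β (suc j)) (α (suc l)) (down α β (suc j) l) (across α β j (suc l))
  then across α β j (suc l) else down α β (suc j) l

-- Seaweeds only run down and to the right, so column `j` is reached only by labels of the columns
-- up to `j`. This makes any `i` a left border: no label at column `i` exceeds `i`.
across≤ : ∀ α β j l → across α β j l ≤ j
down≤   : ∀ α β j l → down α β j l ≤ j
across≤ α β zero    l       = z≤n
across≤ α β (suc j) zero    = z≤n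
across≤ α β (suc j) (suc l)
  with swaps (β (suc j)) (α (suc l)) (down α β (suc j) l) (across α β j (suc l))
... | true  = down≤ α β (suc j) l
... | false = m≤n⇒m≤1+n (across≤ α β j (suc l))
down≤ α β j       zero    = ≤-refl
down≤ α β zero    (suc l) = z≤n
down≤ α β (suc j) (suc l)
  with swaps (β (suc j)) (α (suc l)) (down α β (suc j) l) (across α β j (suc l))
... | true  = m≤n⇒m≤1+n (across≤ α β j (suc l))
... | false = down≤ α β (suc j) l

AgreeUpTo : ℕ → (ℕ → ℕ) → (ℕ → ℕ) → Set
AgreeUpTo n f g = ∀ z → 1 ≤ z → z ≤ n → f z ≡ g z

module _ {α α′ β β′ : ℕ → ℕ} {n m : ℕ} (α≗ : AgreeUpTo m α α′) (β≗ : AgreeUpTo n β β′) where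

  -- A label depends only on the characters above and to the left of its cell. Appending replaces
  -- the character function by one that agrees with it just up to the old length; this carries the
  -- old labels over.
  across-cong : ∀ j l → j ≤ n → l ≤ m → across α β j l ≡ across α′ β′ j l
  down-cong   : ∀ j l → j ≤ n → l ≤ m → down α β j l ≡ down α′ β′ j l
  across-cong zero    l       j≤n l≤m = refl
  across-cong (suc j) zero    j≤n l≤m = refl
  across-cong (suc j) (suc l) j≤n l≤m
    rewrite α≗ (suc l) (s≤s z≤n) l≤m | β≗ (suc j) (s≤s z≤n) j≤n
          | down-cong (suc j) l j≤n (<⇒≤ l≤m) | across-cong j (suc l) (<⇒≤ j≤n) l≤m = refl
  down-cong j       zero    j≤n l≤m = refl
  down-cong zero    (suc l) j≤n l≤m = refl
  down-cong (suc j) (suc l) j≤n l≤m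
    rewrite α≗ (suc l) (s≤s z≤n) l≤m | β≗ (suc j) (s≤s z≤n) j≤n
          | down-cong (suc j) l j≤n (<⇒≤ l≤m) | across-cong j (suc l) (<⇒≤ j≤n) l≤m = refl

-- For inequalities that evaluate to true: the implicit argument becomes the unit type and is filled
-- in automatically.
evident : ∀ {x y} {x≤y : T (x ≤ᵇ y)} → x ≤ y
evident {x} {y} {x≤y} = ≤ᵇ⇒≤ x y x≤y

-- Labels above a threshold and the increments of the score

above : ℕ → ℕ → ℕ
above i x = if i <ᵇ x then 1 else 0

countAbove : (ℕ → ℕ) → ℕ → ℕ → ℕ
countAbove t i zero    = 0
countAbove t i (suc z) = countAbove t i z + above i (t (suc z))

above-≤ : ∀ {i x} → x ≤ i → above i x ≡ 0
above-≤ {i} x≤i rewrite ≥⇒<ᵇ-false x≤i = refl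

above-> : ∀ {i x} → i < x → above i x ≡ 1
above-> {i} i<x rewrite <⇒<ᵇ-true i<x = refl

above-01 : ∀ i x → (x ≤ i × above i x ≡ 0) ⊎ (i < x × above i x ≡ 1)
above-01 i x with i <ᵇ x in e
... | true  = inj₂ (<ᵇ-true⇒< {i} e , refl)
... | false = inj₁ (<ᵇ-false⇒≥ {i} e , refl)

above≤1 : ∀ i x → above i x ≤ 1
above≤1 i x with i <ᵇ x
... | true  = ≤-refl
... | false = z≤n

private
  cell-00 : ∀ {a b d e} → b + 0 ≡ suc a → d ≡ a + 0 → e ≡ b ⊔ d → e ≡ b + 0 × e + 0 ≡ suc d
  cell-00 {a} {b} {d} {e} p q s rewrite +-identityʳ b | +-identityʳ a | +-identityʳ e | p | q =
    let e≡ = trans s (m≥n⇒m⊔n≡m (n≤1+n a)) in e≡ , e≡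

  cell-01 : ∀ {a b d e} → b + 0 ≡ suc a → d ≡ a + 1 → e ≡ b ⊔ d → e ≡ b + 0 × e + 1 ≡ suc d
  cell-01 {a} {b} {d} {e} p q s rewrite +-identityʳ b | +-comm a 1 | +-comm e 1 | p | q =
    let e≡ = trans s (⊔-idem (suc a)) in e≡ , cong suc e≡

  cell-10 : ∀ {a b d e} → b + 1 ≡ suc a → d ≡ a + 0 → e ≡ b ⊔ d → e ≡ b + 0 × e + 1 ≡ suc d
  cell-10 {a} {b} {d} {e} p q s
    rewrite +-identityʳ b | +-identityʳ a | +-comm e 1 | +-comm b 1 | suc-injective p | q =
    let e≡ = trans s (⊔-idem a) in e≡ , cong suc e≡

  cell-11 : ∀ {a b d e} → b + 1 ≡ suc a → d ≡ a + 1 → e ≡ b ⊔ d → e ≡ b + 1 × e + 1 ≡ suc d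
  cell-11 {a} {b} {d} {e} p q s
    rewrite +-comm a 1 | +-comm e 1 | +-comm b 1 | suc-injective p | q =
    let e≡ = trans s (m≤n⇒m⊔n≡n (n≤1+n a)) in e≡ , cong suc e≡

-- `a`, `b`, `d`, `e` are the scores at the corners (j, l), (j + 1, l), (j, l + 1), (j + 1, l + 1)
-- of a cell. A mismatched cell sends the smaller of its two labels to the right and the larger one
-- downwards, so `above i` turns the outputs into the conjunction and the disjunction of the inputs.
-- That is what the maximum of `b` and `d` does to the increments of the score.
cell-mismatch : ∀ i (a b d e c r : ℕ) →
  b + above i c ≡ suc a → d ≡ a + above i r → e ≡ b ⊔ d →
  e ≡ b + above i (if c <ᵇ r then c else r) ×
  e + above i (if c <ᵇ r then r else c) ≡ suc d
cell-mismatch i a b d e c r p q s with above-01 i c | above-01 i r | c <ᵇ r in c<r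
... | inj₁ (c≤i , x) | inj₂ (i<r , y) | false =
      ⊥-elim (<⇒≱ i<r (≤-trans (<ᵇ-false⇒≥ {c} c<r) c≤i))
... | inj₂ (i<c , x) | inj₁ (r≤i , y) | true =
      ⊥-elim (<⇒≱ i<c (≤-trans (<⇒≤ (<ᵇ-true⇒< {c} c<r)) r≤i))
... | inj₁ (_ , x) | inj₁ (_ , y) | true  rewrite x | y = cell-00 p q s
... | inj₁ (_ , x) | inj₁ (_ , y) | false rewrite x | y = cell-00 p q s
... | inj₁ (_ , x) | inj₂ (_ , y) | true  rewrite x | y = cell-01 p q s
... | inj₂ (_ , x) | inj₁ (_ , y) | false rewrite x | y = cell-10 p q s
... | inj₂ (_ , x) | inj₂ (_ , y) | true  rewrite x | y = cell-11 p q s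
... | inj₂ (_ , x) | inj₂ (_ , y) | false rewrite x | y = cell-11 p q s

-- L j l stands for LCS(B[i..j], A[0..l]).
module _ (α β : ℕ → ℕ) (i n m : ℕ) (L : ℕ → ℕ → ℕ)
  (L-top  : ∀ j → L j 0 ≡ 0)
  (L-left : ∀ l → L i l ≡ 0)
  (L-match : ∀ {j l} → i ≤ j → j < n → l < m → β (suc j) ≡ α (suc l) →
     L (suc j) (suc l) ≡ suc (L j l))
  (L-mismatch : ∀ {j l} → i ≤ j → j < n → l < m → β (suc j) ≢ α (suc l) →
     L (suc j) (suc l) ≡ L (suc j) l ⊔ L j (suc l))
  where

  -- The labels do not mention `i`, which is how one grid serves all starting points: `i` enters
  -- only at the borders. At `j = i` the score is 0 and no label exceeds `i`; at the top the score
  -- is 0 and the label `suc j` exceeds `i`.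
  L-across : ∀ j l → i ≤ j → j ≤ n → l < m →
    L j (suc l) ≡ L j l + above i (across α β j (suc l))
  L-down : ∀ j l → i ≤ j → j < n → l ≤ m →
    L (suc j) l + above i (down α β (suc j) l) ≡ suc (L j l)

  private
    L-cell : ∀ j l → i ≤ j → j < n → l < m →
      L (suc j) (suc l) ≡ L (suc j) l + above i (across α β (suc j) (suc l)) ×
      L (suc j) (suc l) + above i (down α β (suc j) (suc l)) ≡ suc (L j (suc l))
    L-cell j l i≤j j<n l<m with β (suc j) ≡ᵇ α (suc l) in e
    -- The score grows by 1 along the diagonal, so the equation for the label leaving to the right
    -- is the one for the label from above read backwards, and the equation for the label leaving
    -- downwards is the one for the label from the left.
    ... | true  = trans m≡ (sym (L-down j l i≤j j<n (<⇒≤ l<m)))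
                , trans (cong (_+ _) m≡) (cong suc (sym (L-across j l i≤j (<⇒≤ j<n) l<m)))
      where m≡ = L-match i≤j j<n l<m (≡ᵇ-true⇒≡ (β (suc j)) (α (suc l)) e)
    ... | false = cell-mismatch i (L j l) _ _ _ (down α β (suc j) l) (across α β j (suc l))
                    (L-down j l i≤j j<n (<⇒≤ l<m))
                    (L-across j l i≤j (<⇒≤ j<n) l<m)
                    (L-mismatch i≤j j<n l<m (≡ᵇ-false⇒≢ (β (suc j)) (α (suc l)) e))

  L-across j l i≤j j≤n l<m with m≤n⇒m<n∨m≡n i≤j
  ... | inj₂ refl rewrite above-≤ (across≤ α β i (suc l)) =
        trans (L-left (suc l)) (sym (trans (+-identityʳ _) (L-left l)))
  L-across (suc j) l i≤j j≤n l<m | inj₁ (s≤s i≤j′) = proj₁ (L-cell j l i≤j′ j≤n l<m)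
  L-down j zero    i≤j j<n l≤m rewrite L-top j | L-top (suc j) = above-> (s≤s i≤j)
  L-down j (suc l) i≤j j<n l≤m = proj₂ (L-cell j l i≤j j<n l≤m)

-- Longest common subsequences

module _ {k : ℕ} where

  LCS-least : ∀ (X Y : String k) {b} → (∀ Z → Z ⊆ X → Z ⊆ Y → length Z ≤ b) → LCS X Y ≤ b
  LCS-least X Y f = let p , q = longestCommonSubsequence-common X Y in f _ p q

  LCS-greatest : ∀ (X Y Z : String k) → Z ⊆ X → Z ⊆ Y → length Z ≤ LCS X Y
  LCS-greatest X Y Z = LCS-longest {X = X} {Y} Z

  LCS-mono : ∀ (X Y X′ Y′ : String k) → X ⊆ X′ → Y ⊆ Y′ → LCS X Y ≤ LCS X′ Y′
  LCS-mono X Y X′ Y′ p q = LCS-least X Y λ Z r s →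
    LCS-greatest X′ Y′ Z (Sub.⊆-trans r p) (Sub.⊆-trans s q)

  LCS-comm : ∀ (X Y : String k) → LCS X Y ≡ LCS Y X
  LCS-comm X Y = ≤-antisym (LCS-least X Y λ Z p q → LCS-greatest Y X Z q p)
                           (LCS-least Y X λ Z p q → LCS-greatest X Y Z q p)

  LCS-[]ˡ : ∀ (Y : String k) → LCS [] Y ≡ 0
  LCS-[]ˡ Y = n≤0⇒n≡0 (LCS-least [] Y λ Z p _ → SubP.length-mono-≤ p)

  LCS-[]ʳ : ∀ (X : String k) → LCS X [] ≡ 0
  LCS-[]ʳ X = n≤0⇒n≡0 (LCS-least X [] λ Z _ q → SubP.length-mono-≤ q)

  -- The sublist relation peels off first characters, whereas strings grow at the end and the LCS
  -- recurrence concerns last characters.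
  ⊆-∷ʳ⁻ : ∀ (X : String k) {Z x} → Z ⊆ X ∷ʳ x → Z ⊆ X ⊎ ∃[ Z′ ] (Z ≡ Z′ ∷ʳ x × Z′ ⊆ X)
  ⊆-∷ʳ⁻ []      (_ Sub.∷ʳ [])    = inj₁ []
  ⊆-∷ʳ⁻ []      (refl ∷ [])  = inj₂ ([] , refl , [])
  ⊆-∷ʳ⁻ (y ∷ X) (_ Sub.∷ʳ p) with ⊆-∷ʳ⁻ X p
  ... | inj₁ q              = inj₁ (y Sub.∷ʳ q)
  ... | inj₂ (Z , refl , q) = inj₂ (Z , refl , y Sub.∷ʳ q)
  ⊆-∷ʳ⁻ (y ∷ X) (refl ∷ p) with ⊆-∷ʳ⁻ X p
  ... | inj₁ q              = inj₁ (refl ∷ q)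
  ... | inj₂ (Z , refl , q) = inj₂ (y ∷ Z , refl , refl ∷ q)

  ⊆-∷ʳ⁺ : ∀ (X : String k) x → X ⊆ X ∷ʳ x
  ⊆-∷ʳ⁺ X x = SubP.++⁺ʳ (x ∷ []) Sub.⊆-refl

  length-∷ʳ : ∀ (X : String k) x → length (X ∷ʳ x) ≡ suc (length X)
  length-∷ʳ X x = trans (length-++ X) (+-comm (length X) 1)

  LCS-match : ∀ (X Y : String k) x → LCS (X ∷ʳ x) (Y ∷ʳ x) ≡ suc (LCS X Y)
  LCS-match X Y x = ≤-antisym (LCS-least _ _ upper) lower
    where
    shorter : ∀ {Z′} → Z′ ⊆ X → Z′ ⊆ Y → length (Z′ ∷ʳ x) ≤ suc (LCS X Y)
    shorter {Z′} p q rewrite length-∷ʳ Z′ x = s≤s (LCS-greatest X Y Z′ p q)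
    upper : ∀ Z → Z ⊆ X ∷ʳ x → Z ⊆ Y ∷ʳ x → length Z ≤ suc (LCS X Y)
    upper Z p q with ⊆-∷ʳ⁻ X p | ⊆-∷ʳ⁻ Y q
    ... | inj₁ p′ | inj₁ q′ = m≤n⇒m≤1+n (LCS-greatest X Y Z p′ q′)
    ... | inj₁ p′ | inj₂ (Z′ , refl , q′) = shorter (Sub.⊆-trans (⊆-∷ʳ⁺ Z′ x) p′) q′
    ... | inj₂ (Z′ , refl , p′) | inj₁ q′ = shorter p′ (Sub.⊆-trans (⊆-∷ʳ⁺ Z′ x) q′)
    ... | inj₂ (Z′ , refl , p′) | inj₂ (Z″ , e , q′) =
          shorter p′ (subst (_⊆ Y) (sym (proj₁ (∷ʳ-injective Z′ Z″ e))) q′)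
    lower : suc (LCS X Y) ≤ LCS (X ∷ʳ x) (Y ∷ʳ x)
    lower = let p , q = longestCommonSubsequence-common X Y
                M     = longestCommonSubsequence X Y
            in subst (_≤ LCS (X ∷ʳ x) (Y ∷ʳ x)) (length-∷ʳ M x)
                 (LCS-greatest (X ∷ʳ x) (Y ∷ʳ x) (M ∷ʳ x) (SubP.++⁺ p Sub.⊆-refl) (SubP.++⁺ q Sub.⊆-refl))

  LCS-mismatch : ∀ (X Y : String k) {x y} → x ≢ y →
    LCS (X ∷ʳ x) (Y ∷ʳ y) ≡ LCS (X ∷ʳ x) Y ⊔ LCS X (Y ∷ʳ y)
  LCS-mismatch X Y {x} {y} x≢y = ≤-antisym (LCS-least _ _ upper)
    (⊔-lub (LCS-mono (X ∷ʳ x) Y _ _ Sub.⊆-refl (⊆-∷ʳ⁺ Y y))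
        (LCS-mono X (Y ∷ʳ y) (X ∷ʳ x) _ (⊆-∷ʳ⁺ X x) Sub.⊆-refl))
    where
    upper : ∀ Z → Z ⊆ X ∷ʳ x → Z ⊆ Y ∷ʳ y → length Z ≤ LCS (X ∷ʳ x) Y ⊔ LCS X (Y ∷ʳ y)
    upper Z p q with ⊆-∷ʳ⁻ X p | ⊆-∷ʳ⁻ Y q
    ... | inj₁ p′ | _       = m≤n⇒m≤o⊔n (LCS (X ∷ʳ x) Y) (LCS-greatest X (Y ∷ʳ y) Z p′ q)
    ... | inj₂ _  | inj₁ q′ = m≤n⇒m≤n⊔o (LCS X (Y ∷ʳ y)) (LCS-greatest (X ∷ʳ x) Y Z p q′)
    ... | inj₂ (Z′ , refl , _) | inj₂ (Z″ , e , _) = contradiction (proj₂ (∷ʳ-injective Z′ Z″ e)) x≢y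

  -- Characters are numbered from 1; the value 0 outside the string is junk.
  at : String k → ℕ → ℕ
  at []      _             = 0
  at (x ∷ S) zero          = 0
  at (x ∷ S) (suc zero)    = toℕ x
  at (x ∷ S) (suc (suc z)) = at S (suc z)

  take-suc-at : ∀ (S : String k) z → z < length S →
    ∃[ x ] (take (suc z) S ≡ take z S ∷ʳ x × at S (suc z) ≡ toℕ x)
  take-suc-at (x ∷ S) zero    _       = x , refl , refl
  take-suc-at (x ∷ S) (suc z) (s≤s p) =
    let y , e , f = take-suc-at S z p in y , cong (x ∷_) e , f

  at-∷ʳ : ∀ (S : String k) x → AgreeUpTo (length S) (at S) (at (S ∷ʳ x))
  at-∷ʳ (y ∷ S) x (suc zero)    _ _       = refl
  at-∷ʳ (y ∷ S) x (suc (suc z)) _ (s≤s p) = at-∷ʳ S x (suc z) (s≤s z≤n) p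

  at-last : ∀ (S : String k) x → at (S ∷ʳ x) (suc (length S)) ≡ toℕ x
  at-last []          x = refl
  at-last (y ∷ S)     x = at-last S x

  drop-∷ʳ : ∀ i (S : String k) x → i ≤ length S → drop i (S ∷ʳ x) ≡ drop i S ∷ʳ x
  drop-∷ʳ zero    S       x _       = refl
  drop-∷ʳ (suc i) (y ∷ S) x (s≤s p) = drop-∷ʳ i S x p

  length-take-≤ : ∀ z (S : String k) → z ≤ length S → length (take z S) ≡ z
  length-take-≤ z S p = trans (length-take z S) (m≤n⇒m⊓n≡m p)

  slice-∷ʳ : ∀ {i z} (S : String k) → i ≤ z → z < length S →
    ∃[ x ] (slice i (suc z) S ≡ slice i z S ∷ʳ x × at S (suc z) ≡ toℕ x)
  slice-∷ʳ {i} {z} S i≤z z<n with take-suc-at S z z<n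
  ... | x , e , f = x , trans (cong (drop i) e) (drop-∷ʳ i (take z S) x
                          (subst (i ≤_) (sym (length-take-≤ z S (<⇒≤ z<n))) i≤z)) , f

  slice-empty : ∀ i (S : String k) → slice i i S ≡ []
  slice-empty i S = drop-all i (take i S)
    (subst (_≤ i) (sym (length-take i S)) (m⊓n≤m i (length S)))

  -- The seaweed labels of two strings

  module Tables (A B : String k) where

    right bottom : ℕ → ℕ → ℕ
    right  = across (at A) (at B)
    bottom = down (at A) (at B)

    private
      L : ℕ → ℕ → ℕ → ℕ
      L i j l = LCS (slice i j B) (slice 0 l A)

      L-top : ∀ i j → L i j 0 ≡ 0
      L-top i j = LCS-[]ʳ (slice i j B)

      L-left : ∀ i l → L i i l ≡ 0
      L-left i l rewrite slice-empty i B = LCS-[]ˡ (slice 0 l A)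

      L-match : ∀ i j l → i ≤ j → j < length B → l < length A → at B (suc j) ≡ at A (suc l) →
        L i (suc j) (suc l) ≡ suc (L i j l)
      L-match i j l i≤j j<n l<m e with slice-∷ʳ B i≤j j<n | slice-∷ʳ A z≤n l<m
      ... | x , p , p′ | y , q , q′ rewrite p | q
        with refl ← Fin.toℕ-injective (trans (sym p′) (trans e q′)) = LCS-match (slice i j B) (slice 0 l A) x

      L-mismatch : ∀ i j l → i ≤ j → j < length B → l < length A → at B (suc j) ≢ at A (suc l) →
        L i (suc j) (suc l) ≡ L i (suc j) l ⊔ L i j (suc l)
      L-mismatch i j l i≤j j<n l<m e with slice-∷ʳ B i≤j j<n | slice-∷ʳ A z≤n l<m
      ... | x , p , p′ | y , q , q′ rewrite p | q =
        LCS-mismatch (slice i j B) (slice 0 l A) λ { refl → e (trans p′ (sym q′)) }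

    LCS-across : ∀ i j l → i ≤ j → j ≤ length B → l < length A →
      L i j (suc l) ≡ L i j l + above i (right j (suc l))
    LCS-across i j l = L-across (at A) (at B) i _ _ (L i) (L-top i) (L-left i) (L-match i _ _)
        (L-mismatch i _ _) j l

    LCS-down : ∀ i j l → i ≤ j → j < length B → l ≤ length A →
      L i (suc j) l + above i (bottom (suc j) l) ≡ suc (L i j l)
    LCS-down i j l = L-down (at A) (at B) i _ _ (L i) (L-top i) (L-left i) (L-match i _ _)
        (L-mismatch i _ _) j l

    LCS≡countAbove : ∀ i l → i ≤ length B → l ≤ length A →
      LCS (slice i (length B) B) (slice 0 l A) ≡ countAbove (right (length B)) i l
    LCS≡countAbove i zero    i≤n l≤m = L-top i (length B)
    LCS≡countAbove i (suc l) i≤n l≤m = trans (LCS-across i _ l i≤n ≤-refl l≤m)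
      (cong (_+ above i (right (length B) (suc l))) (LCS≡countAbove i l i≤n (<⇒≤ l≤m)))

    countAbove-left : ∀ i l j → j ≤ i → countAbove (λ z → bottom z l) i j ≡ 0
    countAbove-left i l zero    p = refl
    countAbove-left i l (suc j) p rewrite countAbove-left i l j (<⇒≤ p) =
      above-≤ (≤-trans (down≤ (at A) (at B) (suc j) l) p)

    -- Sums `LCS-down` over the columns after `i`: each of them either adds 1 to the score or has a
    -- label above `i`. Columns up to `i` have no such label, so the count may start at column 1.
    -- The additive form avoids truncated subtraction.
    LCS+countAbove : ∀ i l j → i ≤ j → j ≤ length B → l ≤ length A →
      LCS (slice i j B) (slice 0 l A) + countAbove (λ z → bottom z l) i j + i ≡ j
    LCS+countAbove i l j i≤j j≤n l≤m with m≤n⇒m<n∨m≡n i≤j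
    ... | inj₂ refl rewrite L-left i l | countAbove-left i l i ≤-refl = refl
    LCS+countAbove i l (suc j) i≤j j≤n l≤m | inj₁ (s≤s i≤j′) = begin
      L i (suc j) l + (c + a) + i ≡⟨ cong (_+ i) (cong (λ e → L i (suc j) l + e) (+-comm c a)) ⟩
      L i (suc j) l + (a + c) + i ≡⟨ cong (_+ i) (sym (+-assoc (L i (suc j) l) a c)) ⟩
      L i (suc j) l + a + c + i   ≡⟨ cong (λ e → e + c + i) (LCS-down i j l i≤j′ j≤n l≤m) ⟩
      suc (L i j l + c + i)       ≡⟨ cong suc (LCS+countAbove i l j i≤j′ (<⇒≤ j≤n) l≤m) ⟩
      suc j                       ∎
      where
      open ≡-Reasoning
      a = above i (bottom (suc j) l)
      c = countAbove (λ z → bottom z l) i j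

-- Pivotal points

above-suc-≡ : ∀ {i x} → x ≢ suc i → above i x ≡ above (suc i) x
above-suc-≡ {i} {x} x≢ with <-cmp x (suc i)
... | tri< (s≤s x≤i) _ _ = trans (above-≤ x≤i) (sym (above-≤ (m≤n⇒m≤1+n x≤i)))
... | tri≈ _ x≡ _ = contradiction x≡ x≢
... | tri> _ _ i<x       = trans (above-> (<⇒≤ i<x)) (sym (above-> i<x))

-- The terms j - i cancel in the density; what remains compares the increments of the count `N` in
-- two neighbouring rows. For `countAbove` these are the indicators of `t (suc j)` exceeding `i` and
-- `suc i`, which differ only if `t (suc j) ≡ suc i`.
density-𝒦-form : (D : Matrix) (N : ℕ → ℕ → ℕ) (i j a a′ : ℕ) →
  (∀ i′ j′ → i′ ≤ suc i → j′ ≤ suc j → D i′ j′ ≡ + j′ ℤ.- + i′ ℤ.- + N i′ j′) →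
  N i (suc j) ≡ N i j + a → N (suc i) (suc j) ≡ N (suc i) j + a′ →
  density D (suc i) (suc j) ≡ + a ℤ.- + a′
density-𝒦-form D N i j a a′ D≡ p p′
  rewrite D≡ (suc i) (suc j) ≤-refl ≤-refl | D≡ i j (n≤1+n i) (n≤1+n j)
        | D≡ i (suc j) (n≤1+n i) ≤-refl | D≡ (suc i) j ≤-refl (n≤1+n j) | p | p′ =
  solve 6 (λ I J M M′ A A′ →
      (con (+ 1) :+ J) :- (con (+ 1) :+ I) :- (M′ :+ A′) :+ (J :- I :- M)
        :- ((con (+ 1) :+ J) :- I :- (M :+ A)) :- (J :- (con (+ 1) :+ I) :- M′)
      := A :- A′) refl (+ i) (+ j) (+ N i j) (+ N (suc i) j) (+ a) (+ a′)
  where open ℤ.+-*-Solver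

density-𝒥-form : (D : Matrix) (N : ℕ → ℕ → ℕ) (i j a a′ : ℕ) →
  (∀ i′ j′ → i′ ≤ suc i → j′ ≤ suc j → D i′ j′ ≡ + N i′ j′) →
  N i (suc j) ≡ N i j + a → N (suc i) (suc j) ≡ N (suc i) j + a′ →
  density D (suc i) (suc j) ≡ + a′ ℤ.- + a
density-𝒥-form D N i j a a′ D≡ p p′
  rewrite D≡ (suc i) (suc j) ≤-refl ≤-refl | D≡ i j (n≤1+n i) (n≤1+n j)
        | D≡ i (suc j) (n≤1+n i) ≤-refl | D≡ (suc i) j ≤-refl (n≤1+n j) | p | p′ =
  solve 4 (λ M M′ A A′ →
      (M′ :+ A′) :+ M :- (M :+ A) :- M′
      := A′ :- A) refl (+ N i j) (+ N (suc i) j) (+ a) (+ a′)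
  where open ℤ.+-*-Solver

Labelled : ℕ → (ℕ → ℕ) → ℕ × ℕ → Set
Labelled N t (i , j) = 1 ≤ j × j ≤ N × t j ≢ 0 × i ≡ t j

module _ {n m : ℕ} (D : Matrix) (t : ℕ → ℕ) (t≤n : ∀ {j} → j ≤ m → t j ≤ n) where

  private
    jump-≢0 : ∀ i x → x ≡ suc i →
      + above i x ℤ.- + above (suc i) x ≢ 0ℤ × + above (suc i) x ℤ.- + above i x ≢ 0ℤ
    jump-≢0 i .(suc i) refl rewrite above-> {i} {suc i} ≤-refl | above-≤ {suc i} {suc i} ≤-refl = (λ ()) , λ ()

  -- The pivot of column `j` lies in row `t j`, and a label 0 falls outside the matrix. The two
  -- alternatives are the two signs: the count is subtracted in `𝒦` and added in `𝒥`.
  labelled-pivotal :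
    (∀ i j → i < n → j < m → ∃[ a ] ∃[ b ] (density D (suc i) (suc j) ≡ + a ℤ.- + b ×
        ((a ≡ above i (t (suc j)) × b ≡ above (suc i) (t (suc j)))
          ⊎ (a ≡ above (suc i) (t (suc j)) × b ≡ above i (t (suc j)))))) →
    ∀ p → Labelled m t p ⇔ IsPivotal n m D p
  labelled-pivotal d (i , j) = mk⇔ (to i j) (from i j)
    where
    to : ∀ i j → Labelled m t (i , j) → IsPivotal n m D (i , j)
    to i (suc j) (1≤j , j≤m , t≢0 , refl) with t (suc j) in e | t≤n j≤m
    ... | zero  | _   = contradiction refl t≢0
    ... | suc i | i<n = (s≤s z≤n , i<n) , (1≤j , j≤m) , λ d≡0 → go d≡0
      where
      go : density D (suc i) (suc j) ≢ 0ℤ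
      go d≡0 with d i j i<n j≤m
      ... | _ , _ , δ≡ , inj₁ (refl , refl) = proj₁ (jump-≢0 i (t (suc j)) e) (trans (sym δ≡) d≡0)
      ... | _ , _ , δ≡ , inj₂ (refl , refl) = proj₂ (jump-≢0 i (t (suc j)) e) (trans (sym δ≡) d≡0)
    from : ∀ i j → IsPivotal n m D (i , j) → Labelled m t (i , j)
    from (suc i) (suc j) ((_ , i<n) , (1≤j , j≤m) , d≢0) with t (suc j) ≟ suc i
    ... | yes e = 1≤j , j≤m , (λ z → contradiction (trans (sym z) e) λ ()) , sym e
    ... | no ¬e = contradiction d≡0 d≢0
      where
      d≡0 : density D (suc i) (suc j) ≡ 0ℤ
      d≡0 with d i j i<n j≤m
      ... | _ , _ , δ≡ , inj₁ (refl , refl) = trans δ≡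
            (ℤ.i≡j⇒i-j≡0 (cong +_ (above-suc-≡ ¬e)))
      ... | _ , _ , δ≡ , inj₂ (refl , refl) = trans δ≡
            (ℤ.i≡j⇒i-j≡0 (cong +_ (sym (above-suc-≡ ¬e))))

module _ {k : ℕ} (A B : String k) where

  open Tables A B

  private
    n m : ℕ
    n = length B
    m = length A

  bottoms rights : ℕ → ℕ
  bottoms j = bottom j m
  rights  = right n

  -- The value j - i below the diagonal is what continues the formula: for `j < i` no label up to
  -- column `j` exceeds `i` and the count vanishes, so one formula covers the whole matrix.
  𝒦-formula : ∀ i j → j ≤ n → 𝒦 A B i j ≡ + j ℤ.- + i ℤ.- + countAbove bottoms i j
  𝒦-formula i j j≤n with i ≤ᵇ j in i≤ᵇj
  ... | true = begin
    + LCS (slice i j B) A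
      ≡⟨ solve 3 (λ l c i → l := (l :+ c :+ i) :- i :- c) refl (+ LCS (slice i j B) A) (+ c) (+ i) ⟩
    + (LCS (slice i j B) A + c + i) ℤ.- + i ℤ.- + c
      ≡⟨ cong (λ S → + (LCS (slice i j B) S + c + i) ℤ.- + i ℤ.- + c) (sym (take-all m A ≤-refl)) ⟩
    + (LCS (slice i j B) (slice 0 m A) + c + i) ℤ.- + i ℤ.- + c
      ≡⟨ cong (λ x → + x ℤ.- + i ℤ.- + c) (LCS+countAbove i m j i≤j j≤n ≤-refl) ⟩
    + j ℤ.- + i ℤ.- + c         ∎
    where
    open ≡-Reasoning
    open ℤ.+-*-Solver
    c = countAbove bottoms i j
    i≤j = ≤ᵇ⇒≤ i j (subst T (sym i≤ᵇj) tt)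
  ... | false rewrite countAbove-left i m j (<⇒≤ (≰⇒> λ i≤j → subst T i≤ᵇj (≤⇒≤ᵇ i≤j))) =
    trans (sym (ℤ.[+m]-[+n]≡m⊖n j i)) (sym (ℤ.+-identityʳ _))

  pivotal-𝒦 : ∀ p → Labelled n bottoms p ⇔ IsPivotal n n (𝒦 A B) p
  pivotal-𝒦 = labelled-pivotal (𝒦 A B) bottoms
      (λ {j} j≤n → ≤-trans (down≤ (at A) (at B) j m) j≤n) λ i j i<n j<n →
    _ , _ , density-𝒦-form (𝒦 A B) (countAbove bottoms) i j _ _
              (λ i′ j′ _ j′≤ → 𝒦-formula i′ j′ (≤-trans j′≤ j<n)) refl refl , inj₁ (refl , refl)

  pivotal-𝒥 : ∀ p → Labelled m rights p ⇔ IsPivotal n m (𝒥 A B) p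
  pivotal-𝒥 = labelled-pivotal (𝒥 A B) rights (λ {j} _ → across≤ (at A) (at B) n j) λ i j i<n j<m →
    _ , _ , density-𝒥-form (𝒥 A B) (countAbove rights) i j _ _
              (λ i′ j′ i′≤ j′≤ → cong +_ (LCS≡countAbove i′ j′ (≤-trans i′≤ i<n) (≤-trans j′≤ j<m)))
              refl refl , inj₂ (refl , refl)

  count-rights : countAbove rights 0 m ≡ LCS A B
  count-rights = trans (sym (LCS≡countAbove 0 m z≤n ≤-refl))
    (trans (cong₂ LCS (take-all n B ≤-refl) (take-all m A ≤-refl)) (LCS-comm B A))

  count-bottoms : countAbove bottoms 0 n ≡ Δ A B
  count-bottoms = begin
    c                      ≡⟨ m+n∸m≡n l c ⟨
    l + c ∸ l              ≡⟨ cong (_∸ l)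
        (trans (sym (+-identityʳ _)) (LCS+countAbove 0 m n z≤n ≤-refl ≤-refl)) ⟩
    n ∸ l                  ≡⟨ cong (n ∸_)
        (trans (cong₂ LCS (take-all n B ≤-refl) (take-all m A ≤-refl)) (LCS-comm B A)) ⟩
    n ∸ LCS A B            ∎
    where
    open ≡-Reasoning
    c = countAbove bottoms 0 n
    l = LCS (slice 0 n B) (slice 0 m A)

-- Memory

get-same : ∀ μ a v → (μ [ a ↦ v ]) a ≡ v
get-same μ a v rewrite ≡ᵇ-refl a = refl

get-other : ∀ μ {a v x} → x ≢ a → (μ [ a ↦ v ]) x ≡ μ x
get-other μ x≢a rewrite ≢⇒≡ᵇ-false x≢a = refl

-- Stored numbers are kept below the number `S` of cells and not only below the word bound, so that
-- the content of any cell can serve as an address.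
Good : ℕ → Memory → Set
Good S = Fits S S

Good-↦ : ∀ {S μ a v} → Good S μ → a < S → v < S → Good S (μ [ a ↦ v ])
Good-↦ {S} {μ} {a} {v} (blank , bound) a<S v<S =
  (λ x S≤x → trans (get-other μ λ { refl → <⇒≱ a<S S≤x }) (blank x S≤x)) , bound′
  where
  bound′ : ∀ x → (μ [ a ↦ v ]) x < S
  bound′ x with x ≡ᵇ a
  ... | true  = v<S
  ... | false = bound x

-- Records and linked lists

Zeros : (ℕ → ℕ) → ℕ → ℕ → Set
Zeros t x y = ∀ z → x < z → z < y → t z ≡ 0

-- Position 0 counts as live because record 0 holds the head pointer, so links leave it as they
-- leave a pivot.
Live : (ℕ → ℕ) → ℕ → Set
Live t x = x ≡ 0 ⊎ t x ≢ 0

-- Record z has the fields g < 8 + 2k.  Of these, 0–3 (label, index, link,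
-- character) are the node of column z in the list for 𝒦, and 4–7 are the node of
-- row z in the list for 𝒥; record 0 only supplies the head pointers.  Labels are
-- kept for all columns and rows, but only the nonzero ones are linked.
module Layout (k : ℕ) where

  stride : ℕ
  stride = 8 + (k + k)

  -- The 16 leaves room for the working cells. It stands outermost so that a cell address differs
  -- from every smaller numeral by computation, and `2 + cell f z` is definitionally
  -- `cell (2 + f) z`, as the shape of a list node demands.
  cell : ℕ → ℕ → ℕ
  cell g z = 16 + g + z * stride

  cell-injective : ∀ {g g′ z z′} → g < stride → g′ < stride →
    cell g z ≡ cell g′ z′ → g ≡ g′ × z ≡ z′
  cell-injective {g} {g′} {z} {z′} g< g′< e = go z z′ (+-cancelˡ-≡ 16 _ _ e)
    where
    go : ∀ z z′ → g + z * stride ≡ g′ + z′ * stride → g ≡ g′ × z ≡ z′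
    go zero zero e = trans (sym (+-identityʳ g)) (trans e (+-identityʳ g′)) , refl
    go zero (suc z′) e = contradiction g< (≤⇒≯ (subst (stride ≤_) (trans (sym e) (+-identityʳ g))
      (m≤n⇒m≤o+n g′ (m≤m+n stride (z′ * stride)))))
    go (suc z) zero e = contradiction g′< (≤⇒≯ (subst (stride ≤_) (trans e (+-identityʳ g′))
      (m≤n⇒m≤o+n g (m≤m+n stride (z * stride)))))
    go (suc z) (suc z′) e =
      let p , q = go z z′ (+-cancelˡ-≡ stride _ _
            (trans (move g (z * stride)) (trans e (sym (move g′ (z′ * stride))))))
      in p , cong suc q
      where
      move : ∀ h y → stride + (h + y) ≡ h + (stride + y)
      move h y = trans (sym (+-assoc stride h y)) (trans (cong (_+ y) (+-comm stride h)) (+-assoc h stride y))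

  Next : ℕ → (ℕ → ℕ) → ℕ → ℕ → ℕ → Set
  Next f t N x p = (p ≡ 0 × Zeros t x (suc N)) ⊎
    ∃[ y ] (x < y × y ≤ N × t y ≢ 0 × Zeros t x y × p ≡ cell f y)

  Next-skip : ∀ {f t N x x′ p} → x ≤ x′ → Zeros t x (suc x′) → Next f t N x p → Next f t N x′ p
  Next-skip x≤x′ zs (inj₁ (p≡0 , z)) = inj₁ (p≡0 , λ z′ x′<z → z z′ (≤-<-trans x≤x′ x′<z))
  Next-skip {x′ = x′} x≤x′ zs (inj₂ (y , x<y , y≤N , ty≢0 , z , p≡)) =
    inj₂ (y , ≰⇒> (λ y≤x′ → ty≢0 (zs y x<y (s≤s y≤x′))) , y≤N , ty≢0
         , (λ z′ x′<z → z z′ (≤-<-trans x≤x′ x′<z)) , p≡)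

  -- The half with f = 0 belongs to 𝒦, the one with f = 4 to 𝒥.
  record Half (f : ℕ) (μ : Memory) (N : ℕ) (t β : ℕ → ℕ) : Set where
    field
      len  : μ (9 + f) ≡ N
      val  : ∀ z → 1 ≤ z → z ≤ N → μ (cell f z) ≡ t z
      idx  : ∀ z → 1 ≤ z → z ≤ N → μ (cell (1 + f) z) ≡ z
      chr  : ∀ z → 1 ≤ z → z ≤ N → μ (cell (3 + f) z) ≡ β z
      -- Only live positions are constrained; the link field of a position labelled 0 may hold a
      -- stale pointer.
      lnk  : ∀ z → z ≤ N → Live t z → Next f t N z (μ (cell (2 + f) z))
      -- The last live position is remembered so that a new last node can be hung on in constant
      -- time.
      tail : ∃[ s ] (s ≤ N × Live t s × Zeros t s (suc N) × μ (10 + f) ≡ cell (2 + f) s)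

  module _ {f μ N t β} (half : Half f μ N t β) where
    open Half half

    private
      -- `d` bounds what is left to the right of `x`; it can decrease because links lead strictly to
      -- the right.
      listFrom : ∀ d x p → N ≤ x + d → Next f t N x p →
        ∃[ ps ] (StoredAt μ p ps × Unique ps × ∀ q → q ∈ ps ⇔ (x < proj₂ q × Labelled N t q))
      listFrom d x .0 N≤ (inj₁ (refl , zs)) = [] , null , [] , λ q → mk⇔ (λ ())
        λ (x<j , 1≤j , j≤N , tj≢0 , _) → contradiction (zs _ x<j (s≤s j≤N)) tj≢0
      listFrom zero x p N≤ (inj₂ (y , x<y , y≤N , _)) =
        contradiction (≤-trans y≤N (subst (N ≤_) (+-identityʳ x) N≤)) (<⇒≱ x<y)
      listFrom (suc d) x .(cell f y) N≤ (inj₂ (y , x<y , y≤N , ty≢0 , zs , refl)) =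
        let ps , st , un , iff = listFrom d y (μ (cell (2 + f) y))
              (≤-trans (subst (N ≤_) (+-suc x d) N≤) (+-monoˡ-≤ d x<y)) (lnk y y≤N (inj₂ ty≢0))
        in (t y , y) ∷ ps
         , subst₂ (λ v w → StoredAt μ (cell f y) ((v , w) ∷ ps)) (val y 1≤y y≤N) (idx y 1≤y y≤N)
             (node (λ ()) st)
         , All.tabulate (λ q∈ e → <-irrefl (cong proj₂ e) (proj₁ (Equivalence.to (iff _) q∈))) ∷ un
         , λ q → mk⇔ (to iff q) (from iff q)
        where
        1≤y = ≤-<-trans z≤n x<y
        to : ∀ {ps} → (∀ q → q ∈ ps ⇔ (y < proj₂ q × Labelled N t q)) →
          ∀ q → q ∈ (t y , y) ∷ ps → x < proj₂ q × Labelled N t q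
        to iff q (here refl) = x<y , 1≤y , y≤N , ty≢0 , refl
        to iff q (there q∈)  = let y<j , l = Equivalence.to (iff q) q∈ in <-trans x<y y<j , l
        from : ∀ {ps} → (∀ q → q ∈ ps ⇔ (y < proj₂ q × Labelled N t q)) →
          ∀ q → x < proj₂ q × Labelled N t q → q ∈ (t y , y) ∷ ps
        from iff (i , j) (x<j , l@(_ , _ , tj≢0 , i≡)) with <-cmp j y
        ... | tri< j<y _ _  = contradiction (zs j x<j j<y) tj≢0
        ... | tri≈ _ refl _ = here (cong (_, y) i≡)
        ... | tri> _ _ y<j  = there (Equivalence.from (iff _) (y<j , l))

    Half-list : ∃[ ps ] (StoredAt μ (μ (cell (2 + f) 0)) ps × Unique ps × ∀ q → q ∈ ps ⇔ Labelled N t q)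
    Half-list =
      let ps , st , un , iff = listFrom N 0 _ ≤-refl (lnk 0 z≤n (inj₁ refl))
      in ps , st , un , λ q → mk⇔ (λ q∈ → proj₂ (Equivalence.to (iff q) q∈))
                                  (λ l → Equivalence.from (iff q) (proj₁ l , l))

  InHalf : ℕ → ℕ → Set
  InHalf f x = x ≡ 9 + f ⊎ x ≡ 10 + f ⊎ ∃[ g ] ∃[ z ] (g < 4 × x ≡ cell (g + f) z)

  Half-cong : ∀ {f μ μ′ N t β} → Half f μ N t β → (∀ x → InHalf f x → μ′ x ≡ μ x) → Half f μ′ N t β
  Half-cong {f} {μ} {μ′} {N} {t} {β} h same = record
    { len  = trans (same _ (inj₁ refl)) len
    ; val  = λ z p q → trans (same _ (inField 0 z (s≤s z≤n))) (val z p q)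
    ; idx  = λ z p q → trans (same _ (inField 1 z (s≤s (s≤s z≤n)))) (idx z p q)
    ; chr  = λ z p q → trans (same _ (inField 3 z ≤-refl)) (chr z p q)
    ; lnk  = λ z p q → subst (Next f t N z) (sym (same _ (inField 2 z (s≤s (s≤s (s≤s z≤n)))))) (lnk z p q)
    ; tail = let s , p , q , r , e = tail in s , p , q , r , trans (same _ (inj₂ (inj₁ refl))) e
    }
    where
    open Half h
    inField : ∀ g z → g < 4 → InHalf f (cell (g + f) z)
    inField g z g<4 = inj₂ (inj₂ (g , z , g<4 , refl))

-- Programs

-- The cells below 16:
--   0  the new character
--   1  N + 1; being the index field of the null pointer, it acts as a sentinel
--   2  the current position
--   3  the next node of the old list
--   4  the link field that the next node of the new list is to be hung on
--   5  the carried label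
--   6  the old label at the current position
--   7  temporary
--   9 + f, 10 + f  length and last link field of the half f
var : ℕ → Expr
var v = mem (lit v)

countAbove-zeros : ∀ t x {x′} → x ≤ x′ → (∀ z → x < z → z ≤ x′ → t z ≡ 0) →
  countAbove t 0 x′ ≡ countAbove t 0 x
countAbove-zeros t x x≤x′ zs with m≤n⇒m<n∨m≡n x≤x′
... | inj₂ refl = refl
countAbove-zeros t x {suc x′} x≤x′ zs | inj₁ (s≤s x≤) rewrite zs (suc x′) (s≤s x≤) ≤-refl =
  trans (+-identityʳ _) (countAbove-zeros t x x≤ (λ z p q → zs z p (m≤n⇒m≤1+n q)))

countAbove-mono : ∀ t {x x′} → x ≤ x′ → countAbove t 0 x ≤ countAbove t 0 x′
countAbove-mono t x≤x′ with m≤n⇒m<n∨m≡n x≤x′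
... | inj₂ refl = ≤-refl
countAbove-mono t {x} {suc x′} x≤x′ | inj₁ (s≤s x≤) = m≤n⇒m≤n+o _ (countAbove-mono t x≤)

iteration-time : ∀ n d r {v u} → v ≤ d → u ≤ n + r → n + v + u ≤ n + (n + d + r)
iteration-time n d r {v} {u} v≤ u≤ = begin
  n + v + u         ≤⟨ +-mono-≤ (+-monoʳ-≤ n v≤) u≤ ⟩
  n + d + (n + r)   ≡⟨ +-assoc (n + d) n r ⟨
  n + d + n + r     ≡⟨ cong (_+ r) (+-comm (n + d) n) ⟩
  n + (n + d) + r   ≡⟨ +-assoc n (n + d) r ⟩
  n + (n + d + r)   ∎
  where open ≤-Reasoning

module Code (k : ℕ) where
  open Layout k

  field′ : ℕ → Expr → Expr
  field′ g e = add (lit (16 + g)) (mul e (lit stride))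

  swapCode linkCode : ℕ → Program
  swapCode f = field′ f (var 2) ≔ var 5 ⨾ lit 5 ≔ var 6
  linkCode f = cond (eq (mem (field′ f (var 2))) (lit 0)) skip
    (mem (lit 4) ≔ field′ f (var 2) ⨾ lit 4 ≔ field′ (2 + f) (var 2))

  -- The order matters: the old link of the current position is saved in cell 3 before `linkCode`
  -- can make this position the tail of the new list, whose link field is the next to be
  -- overwritten. The nested conditionals compute the disjunction in `swaps`.
  stepCode : ℕ → Test → Program
  stepCode f cmp =
      lit 6 ≔ mem (field′ f (var 2))
    ⨾ cond (eq (var 6) (lit 0)) skip (lit 3 ≔ mem (field′ (2 + f) (var 2)))
    ⨾ cond (eq (mem (field′ (3 + f) (var 2))) (var 0)) (swapCode f) (cond cmp (swapCode f) skip)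
    ⨾ linkCode f

  loopTest : Test
  loopTest = lt (var 2) (var 1)

  setupCode : ℕ → Expr → Program
  setupCode f start =
      lit 5 ≔ start
    ⨾ lit 1 ≔ add (lit 1) (var (9 + f))
    ⨾ lit 2 ≔ lit 0
    ⨾ lit 3 ≔ var (cell (2 + f) 0)
    ⨾ lit 4 ≔ lit (cell (2 + f) 0)

  finishCode : ℕ → Program
  finishCode f = mem (lit 4) ≔ lit 0 ⨾ lit (10 + f) ≔ var 4

  sweepCode : ℕ → Test → Program → Expr → Program
  sweepCode f cmp advance start =
      setupCode f start
    ⨾ advance
    ⨾ while loopTest (stepCode f cmp ⨾ advance)
    ⨾ finishCode f

-- Fault-free runs with time bounds

record Sizes (k S W N̂ : ℕ) : Set where
  open Layout k
  field
    S<W   : S < W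
    cell< : ∀ g z → g < stride → z ≤ N̂ → cell g z < S
    1≤N̂   : 1 ≤ N̂

module Machine (k S W N̂ : ℕ) (sizes : Sizes k S W N̂) where

  open Layout k
  open Sizes sizes
  open Code k

  -- The time is only bounded from above, since branches of different cost have to share one bound.
  Reach : Program → ℕ → Memory → Memory → Set
  Reach P c μ μ′ = ∃[ t ] (Run S W P μ t μ′ × t ≤ c)

  weaken : ∀ {P c c′ μ μ′} → c ≤ c′ → Reach P c μ μ′ → Reach P c′ μ μ′
  weaken p (t , r , q) = t , r , ≤-trans q p

  infixr 4 _then_
  _then_ : ∀ {P Q c d μ μ′ μ″} → Reach P c μ μ′ → Reach Q d μ′ μ″ → Reach (P ⨾ Q) (c + d) μ μ″
  (t , r , p) then (u , s , q) = t + u , seq r s , +-mono-≤ p q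

  assigning : ∀ {e e′ μ} → NoFault S W e μ → NoFault S W e′ μ → ⟦ e ⟧ μ < S →
    Reach (e ≔ e′) (1 + cost e + cost e′) μ (μ [ ⟦ e ⟧ μ ↦ ⟦ e′ ⟧ μ ])
  assigning p q r = _ , assign p q r , ≤-refl

  skipping : ∀ {μ} → Reach skip 1 μ μ
  skipping = 1 , skip , ≤-refl

  branch-true : ∀ {b P Q c μ μ′} → NoFaultᵗ S W b μ → ⟦ b ⟧ᵗ μ ≡ true →
    Reach P c μ μ′ → Reach (cond b P Q) (costᵗ b + c) μ μ′
  branch-true {b} p q (t , r , s) = costᵗ b + t , cond-true p q r , +-monoʳ-≤ (costᵗ b) s

  branch-false : ∀ {b P Q c μ μ′} → NoFaultᵗ S W b μ → ⟦ b ⟧ᵗ μ ≡ false →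
    Reach Q c μ μ′ → Reach (cond b P Q) (costᵗ b + c) μ μ′
  branch-false {b} p q (t , r , s) = costᵗ b + t , cond-false p q r , +-monoʳ-≤ (costᵗ b) s

  word : ∀ {v} → v < S → v < W
  word v<S = <-trans v<S S<W

  16<S : 16 < S
  16<S = ≤-<-trans (m≤m+n 16 _) (≤-<-trans (m≤m+n 16 _) (cell< 1 0 (s≤s (s≤s z≤n)) z≤n))

  lit<S : ∀ {v} → v < 16 → v < S
  lit<S v< = <-trans v< 16<S

  0<W : 0 < W
  0<W = ≤-<-trans z≤n (word 16<S)

  field<S : ∀ {g} → g < stride → 16 + g < S
  field<S {g} g< = ≤-<-trans (m≤m+n (16 + g) 0) (cell< g 0 g< z≤n)

  stride<S : stride < S
  stride<S = ≤-<-trans (m≤n⇒m≤o+n 16 (m≤m+n stride 0)) (cell< 0 1 (s≤s z≤n) 1≤N̂)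

  index<S : ∀ {z} → z ≤ N̂ → z < S
  index<S {z} z≤ = ≤-<-trans (m≤n⇒m≤o+n 16 (m≤m*n z stride)) (cell< 0 z (s≤s z≤n) z≤)

  nf-var : ∀ {v} → v < 16 → v < W × v < S
  nf-var v< = let p = <-trans v< 16<S in word p , p

  nf-field : ∀ {g e μ} → NoFault S W e μ → g < stride → ⟦ e ⟧ μ ≤ N̂ → NoFault S W (field′ g e) μ
  nf-field {g} {e} {μ} nf g< e≤ =
    word (field<S g<) , (nf , word stride<S , word (≤-<-trans (m≤n+m _ (16 + g)) (cell< g _ g< e≤)))
    , word (cell< g _ g< e≤)

-- A single sweep and its invariant

-- One sweep carries the label w₀ along the N positions of a half, whose old
-- labels are t and whose characters are β.
record Task (S W N̂ : ℕ) : Set where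
  field
    f N σ w₀  : ℕ
    t β       : ℕ → ℕ
    f≤4       : f ≤ 4
    N<N̂       : N < N̂
    -- In a new row the old label is the one from above, in a new column the one from the left; the
    -- test for an earlier crossing therefore compares in opposite directions and is a parameter.
    cmp       : Test
    cmpF      : ℕ → ℕ → Bool
    cmp-value : ∀ μ → ⟦ cmp ⟧ᵗ μ ≡ cmpF (μ 6) (μ 5)
    cmp-cost  : costᵗ cmp ≤ 5
    cmp-nf    : ∀ μ → NoFaultᵗ S W cmp μ
    μ₀        : Memory

module Sweeping (k S W N̂ : ℕ) (sizes : Sizes k S W N̂) (task : Task S W N̂) where

  open Task task
  open Layout k
  open Code k
  open Sizes sizes
  open Machine k S W N̂ sizes

  swapAt : ℕ → ℕ → ℕ → Bool
  swapAt z c w = (β z ≡ᵇ σ) ∨ cmpF c w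

  -- The cell rule of `across` and `down` along a single line, without fixing which of the two
  -- labels is vertical; this lets both updates share one verification.
  carry new : ℕ → ℕ
  carry zero    = w₀
  carry (suc z) = if swapAt (suc z) (t (suc z)) (carry z) then t (suc z) else carry z
  new zero    = 0
  new (suc z) = if swapAt (suc z) (t (suc z)) (carry z) then carry z else t (suc z)

  data Touched (a : ℕ) : Set where
    scratch : 1 ≤ a → a ≤ 7 → Touched a
    value   : ∀ z → a ≡ cell f z → Touched a
    link    : ∀ z → a ≡ cell (2 + f) z → Touched a

  -- positions 1, …, x have been processed
  record Core (μ : Memory) (x : ℕ) : Set where
    field
      x≤N      : x ≤ N
      good     : Good S μ
      sentinel : μ 1 ≡ suc N
      input≡   : μ 0 ≡ σ
      carry≡   : μ 5 ≡ carry x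
      done     : ∀ z → 1 ≤ z → z ≤ x → μ (cell f z) ≡ new z
      todo     : ∀ z → x < z → z ≤ N → μ (cell f z) ≡ t z
      idx      : ∀ z → 1 ≤ z → z ≤ N → μ (cell (1 + f) z) ≡ z
      chr      : ∀ z → 1 ≤ z → z ≤ N → μ (cell (3 + f) z) ≡ β z
      next     : Next f t N x (μ 3)
      -- Old and new links use the same fields without conflict: those right of `x` are old, those
      -- before the tail `s` are new, and `s` never lies beyond `x`. In between nothing is claimed.
      oldLinks : ∀ z → x < z → z ≤ N → t z ≢ 0 → Next f t N z (μ (cell (2 + f) z))
      s        : ℕ
      s≤x      : s ≤ x
      s-live   : Live new s
      s-last   : Zeros new s (suc x)
      tail≡    : μ 4 ≡ cell (2 + f) s
      newLinks : ∀ z → z < s → Live new z →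
                 ∃[ y ] (z < y × y ≤ s × new y ≢ 0 × Zeros new z y × μ (cell (2 + f) z) ≡ cell f y)
      frame    : ∀ a → ¬ Touched a → μ a ≡ μ₀ a

  -- Processing such positions would only write back what is stored already, so they can be passed
  -- without being visited.
  Idle : ℕ → ℕ → Set
  Idle x x′ = ∀ z → x < z → z ≤ x′ → t z ≡ 0 × new z ≡ 0 × carry z ≡ carry x

  f<stride : ∀ g → g < 4 → g + f < stride
  f<stride g g<4 = ≤-trans (+-mono-≤ g<4 f≤4) (m≤m+n 8 (k + k))

  private
    f₀ = f<stride 0 (s≤s z≤n)
    f₁ = f<stride 1 (s≤s (s≤s z≤n))
    f₂ = f<stride 2 (s≤s (s≤s (s≤s z≤n)))
    f₃ = f<stride 3 (s≤s (s≤s (s≤s (s≤s z≤n))))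

  val≢lnk : ∀ {z z′} → cell f z ≢ cell (2 + f) z′
  val≢lnk {z} {z′} e with cell-injective {f} {2 + f} {z} {z′} f₀ f₂ e
  ... | p , _ = contradiction p (<⇒≢ (m≤n⇒m≤1+n ≤-refl))

  same-index : ∀ g {z z′} → g + f < stride → cell (g + f) z ≡ cell (g + f) z′ → z ≡ z′
  same-index g g< e = proj₂ (cell-injective g< g< e)

  core-skip : ∀ {μ x x′} → Core μ x → x ≤ x′ → x′ ≤ N → Idle x x′ → Core μ x′
  core-skip {μ} {x} {x′} c x≤x′ x′≤N idle = record
    { x≤N = x′≤N ; good = good ; sentinel = sentinel ; input≡ = input≡
    ; carry≡ = trans carry≡ carries
    ; done = done′
    ; todo = λ z x′<z → todo z (≤-<-trans x≤x′ x′<z)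
    ; idx = idx ; chr = chr
    ; next = Next-skip x≤x′ (λ z x<z z≤x′ → proj₁ (idle z x<z (s≤s⁻¹ z≤x′))) next
    ; oldLinks = λ z x′<z → oldLinks z (≤-<-trans x≤x′ x′<z)
    ; s = s ; s≤x = ≤-trans s≤x x≤x′ ; s-live = s-live
    ; s-last = last′
    ; tail≡ = tail≡ ; newLinks = newLinks ; frame = frame }
    where
    open Core c
    carries : carry x ≡ carry x′
    carries with m≤n⇒m<n∨m≡n x≤x′
    ... | inj₁ x<x′ = sym (proj₂ (proj₂ (idle x′ x<x′ ≤-refl)))
    ... | inj₂ refl = refl
    done′ : ∀ z → 1 ≤ z → z ≤ x′ → μ (cell f z) ≡ new z
    done′ z 1≤z z≤x′ with z ≤? x
    ... | yes z≤x = done z 1≤z z≤x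
    ... | no  z≰x = let a , b , _ = idle z (≰⇒> z≰x) z≤x′ in
      trans (todo z (≰⇒> z≰x) (≤-trans z≤x′ x′≤N)) (trans a (sym b))
    last′ : Zeros new s (suc x′)
    last′ z s<z z≤x′ with z ≤? x
    ... | yes z≤x = s-last z s<z (s≤s z≤x)
    ... | no  z≰x = proj₁ (proj₂ (idle z (≰⇒> z≰x) (s≤s⁻¹ z≤x′)))

  core-cong : ∀ {μ μ′ x} → Core μ x → Good S μ′ → (∀ a → a ≢ 2 → a ≢ 6 → a ≢ 7 → μ′ a ≡ μ a) → Core μ′ x
  core-cong {μ} {μ′} c good′ same = record
    { x≤N = x≤N ; good = good′
    ; sentinel = trans (same 1 (λ ()) (λ ()) (λ ())) sentinel
    ; input≡ = trans (same 0 (λ ()) (λ ()) (λ ())) input≡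
    ; carry≡ = trans (same 5 (λ ()) (λ ()) (λ ())) carry≡
    ; done = λ z p q → trans (same-cell f z) (done z p q)
    ; todo = λ z p q → trans (same-cell f z) (todo z p q)
    ; idx = λ z p q → trans (same-cell (1 + f) z) (idx z p q)
    ; chr = λ z p q → trans (same-cell (3 + f) z) (chr z p q)
    ; next = subst (Next f t N _) (sym (same 3 (λ ()) (λ ()) (λ ()))) next
    ; oldLinks = λ z p q r → subst (Next f t N z) (sym (same-cell (2 + f) z)) (oldLinks z p q r)
    ; s = s ; s≤x = s≤x ; s-live = s-live ; s-last = s-last
    ; tail≡ = trans (same 4 (λ ()) (λ ()) (λ ())) tail≡
    ; newLinks = λ z p q → let y , a , b , d , e , g = newLinks z p q in
                 y , a , b , d , e , trans (same-cell (2 + f) z) g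
    ; frame = λ a ¬t → trans (same a (λ { refl → ¬t (scratch (s≤s z≤n) (s≤s (s≤s z≤n))) })
                (λ { refl → ¬t (scratch (s≤s z≤n) (n≤1+n 6)) })
                (λ { refl → ¬t (scratch (s≤s z≤n) ≤-refl) })) (frame a ¬t)
    }
    where
    open Core c
    same-cell : ∀ g z → μ′ (cell g z) ≡ μ (cell g z)
    same-cell g z = same (cell g z) (λ ()) (λ ()) (λ ())

  private
    nf-field-at : ∀ μ {y} g → g + f < stride → μ 2 ≡ y → y ≤ N → NoFault S W (field′ (g + f) (var 2)) μ
    nf-field-at μ g g< refl y≤N = nf-field {e = var 2} {μ} (nf-var 2<16) g< (≤-trans y≤N (<⇒≤ N<N̂))
      where 2<16 = s≤s (s≤s (s≤s z≤n))

    addr<S : ∀ {y} g → g + f < stride → y ≤ N → cell (g + f) y < S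
    addr<S {y} g g< y≤N = cell< (g + f) y g< (≤-trans y≤N (<⇒≤ N<N̂))

    fetch : ∀ {μ x} → Core μ x → μ 2 ≡ suc x → suc x ≤ N → ∃[ μ′ ]
      ( Reach (lit 6 ≔ mem (field′ f (var 2))) 9 μ μ′ × Good S μ′ × μ′ 6 ≡ t (suc x)
      × (∀ a → a ≢ 6 → μ′ a ≡ μ a))
    fetch {μ} {x} c e y≤N = _
      , assigning (word (lit<S 6<16)) (nf-field-at μ 0 f₀ e y≤N , subst (λ y → cell f y < S) (sym e)
          (addr<S 0 f₀ y≤N)) (lit<S 6<16)
      , Good-↦ {μ = μ} good (lit<S 6<16) (proj₂ good _)
      , trans (cong (λ y → μ (cell f y)) e) (todo (suc x) ≤-refl y≤N)
      , λ a a≢6 → get-other μ a≢6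
      where
      open Core c
      6<16 : 6 < 16
      6<16 = evident

    consume : ∀ {μ x} → Core μ x → μ 2 ≡ suc x → μ 6 ≡ t (suc x) → suc x ≤ N → ∃[ μ′ ]
      ( Reach (cond (eq (var 6) (lit 0)) skip (lit 3 ≔ mem (field′ (2 + f) (var 2)))) 13 μ μ′
      × Good S μ′ × Next f t N (suc x) (μ′ 3) × (∀ a → a ≢ 3 → μ′ a ≡ μ a))
    consume {μ} {x} c e e₆ y≤N with t (suc x) in ty≡
    ... | zero = μ , weaken evident (branch-true nf (cong (_≡ᵇ 0) e₆) skipping) , good
      , Next-skip (n≤1+n x) zeros next , λ _ _ → refl
      where
      open Core c
      nf = nf-var evident , 0<W
      zeros : Zeros t x (suc (suc x))
      zeros z x<z z≤ = subst (λ z → t z ≡ 0) (≤-antisym x<z (s≤s⁻¹ z≤)) ty≡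
    ... | suc _ = _
      , branch-false nf (cong (_≡ᵇ 0) e₆) (assigning (word (lit<S 3<16))
          (nf-field-at μ 2 f₂ e y≤N , subst (λ y → cell (2 + f) y < S) (sym e) (addr<S 2 f₂ y≤N)) (lit<S 3<16))
      , Good-↦ {μ = μ} good (lit<S 3<16) (proj₂ good _)
      , subst (λ y → Next f t N (suc x) (μ (cell (2 + f) y))) (sym e)
          (oldLinks (suc x) ≤-refl y≤N λ t≡0 → contradiction (trans (sym t≡0) ty≡) λ ())
      , λ a a≢3 → get-other μ a≢3
      where
      open Core c
      nf = nf-var evident , 0<W
      3<16 : 3 < 16
      3<16 = evident

    exchange : ∀ {μ y} → Good S μ → μ 2 ≡ y → y ≤ N → ∃[ μ′ ]
      ( Reach (swapCode f) 13 μ μ′ × Good S μ′ × μ′ (cell f y) ≡ μ 5 × μ′ 5 ≡ μ 6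
      × (∀ a → a ≢ cell f y → a ≢ 5 → μ′ a ≡ μ a))
    exchange {μ} {y} good e y≤N = _
      , (assigning (nf-field-at μ 0 f₀ e y≤N) (nf-var 5<16) a<S
         then assigning {e = lit 5} {var 6} (word (lit<S 5<16)) (nf-var evident) (lit<S 5<16))
      , Good-↦ {μ = μ [ cell f (μ 2) ↦ μ 5 ]} (Good-↦ {μ = μ} good a<S (proj₂ good 5)) (lit<S 5<16)
          (proj₂ (Good-↦ {μ = μ} good a<S (proj₂ good 5)) 6)
      , trans (cong (λ y′ → (μ [ cell f y′ ↦ μ 5 ]) (cell f y)) e) (get-same μ (cell f y) (μ 5))
      , refl
      , λ a a≢c a≢5 → trans (get-other (μ [ cell f (μ 2) ↦ μ 5 ]) a≢5)
          (get-other μ λ a≡ → a≢c (trans a≡ (cong (cell f) e)))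
      where
      5<16 : 5 < 16
      5<16 = evident
      a<S : cell f (μ 2) < S
      a<S = subst (λ y → cell f y < S) (sym e) (addr<S 0 f₀ y≤N)

    mix : ∀ {μ x} → Good S μ → μ 0 ≡ σ → μ 2 ≡ suc x → suc x ≤ N →
      μ 6 ≡ t (suc x) → μ 5 ≡ carry x → μ (cell f (suc x)) ≡ t (suc x) → μ (cell (3 + f) (suc x)) ≡ β (suc x) →
      ∃[ μ′ ]
      ( Reach (cond (eq (mem (field′ (3 + f) (var 2))) (var 0)) (swapCode f) (cond cmp (swapCode f) skip))
          28 μ μ′
      × Good S μ′ × μ′ (cell f (suc x)) ≡ new (suc x) × μ′ 5 ≡ carry (suc x)
      × (∀ a → a ≢ cell f (suc x) → a ≢ 5 → μ′ a ≡ μ a))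
    mix {μ} {x} good e₀ e₂ y≤N e₆ e₅ ev eβ = go
      where
      nf = (nf-field-at μ 3 f₃ e₂ y≤N , subst (λ y → cell (3 + f) y < S) (sym e₂) (addr<S 3 f₃ y≤N))
         , nf-var (s≤s z≤n)
      test : (μ (cell (3 + f) (μ 2)) ≡ᵇ μ 0) ≡ (β (suc x) ≡ᵇ σ)
      test = cong₂ _≡ᵇ_ (trans (cong (λ y → μ (cell (3 + f) y)) e₂) eβ) e₀
      cmp≡ : ⟦ cmp ⟧ᵗ μ ≡ cmpF (t (suc x)) (carry x)
      cmp≡ = trans (cmp-value μ) (cong₂ cmpF e₆ e₅)
      go : ∃[ μ′ ]
        ( Reach (cond (eq (mem (field′ (3 + f) (var 2))) (var 0)) (swapCode f)
            (cond cmp (swapCode f) skip)) 28 μ μ′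
        × Good S μ′ × μ′ (cell f (suc x)) ≡ new (suc x) × μ′ 5 ≡ carry (suc x)
        × (∀ a → a ≢ cell f (suc x) → a ≢ 5 → μ′ a ≡ μ a))
      go with β (suc x) ≡ᵇ σ in m?
      ... | true =
        let μ′ , r , g , a , b , same = exchange good e₂ y≤N in
        μ′ , weaken evident (branch-true nf (trans test m?) r) , g , trans a e₅ , trans b e₆ , same
      ... | false with cmpF (t (suc x)) (carry x) in c?
      ...   | true =
        let μ′ , r , g , a , b , same = exchange good e₂ y≤N in
        μ′ , weaken (+-monoʳ-≤ 10 (+-monoˡ-≤ 13 cmp-cost))
            (branch-false nf (trans test m?) (branch-true (cmp-nf μ) (trans cmp≡ c?) r))
        , g , trans a e₅ , trans b e₆ , same
      ...   | false =
        μ , weaken (≤-trans (+-monoʳ-≤ 10 (+-monoˡ-≤ 1 cmp-cost)) evident)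
              (branch-false nf (trans test m?) (branch-false (cmp-nf μ) (trans cmp≡ c?) skipping))
        , good , ev , e₅ , λ _ _ _ → refl

    relink : ∀ {μ y s v} → Good S μ → μ 2 ≡ y → y ≤ N → s ≤ N → μ 4 ≡ cell (2 + f) s → μ (cell f y) ≡ v →
        s < y →
      ∃[ μ′ ]
      ( Reach (linkCode f) 26 μ μ′ × Good S μ′
      × ((v ≡ 0 × ∀ a → μ′ a ≡ μ a)
        ⊎ (v ≢ 0 × μ′ (cell (2 + f) s) ≡ cell f y × μ′ 4 ≡ cell (2 + f) y
          × (∀ a → a ≢ 4 → a ≢ cell (2 + f) s → μ′ a ≡ μ a))))
    relink {μ} {y} {s} {v} good e₂ y≤N s≤N e₄ ev s<y = go v ev
      where
      nf = (nf-field-at μ 0 f₀ e₂ y≤N , subst (λ y → cell f y < S) (sym e₂) (addr<S 0 f₀ y≤N)) , 0<W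
      test : ∀ {v} → μ (cell f y) ≡ v → (μ (cell f (μ 2)) ≡ᵇ 0) ≡ (v ≡ᵇ 0)
      test ev = cong (_≡ᵇ 0) (trans (cong (λ y → μ (cell f y)) e₂) ev)
      go : ∀ v → μ (cell f y) ≡ v → ∃[ μ′ ]
        ( Reach (linkCode f) 26 μ μ′ × Good S μ′
        × ((v ≡ 0 × ∀ a → μ′ a ≡ μ a)
          ⊎ (v ≢ 0 × μ′ (cell (2 + f) s) ≡ cell f y × μ′ 4 ≡ cell (2 + f) y
            × (∀ a → a ≢ 4 → a ≢ cell (2 + f) s → μ′ a ≡ μ a))))
      go zero ev = μ , weaken evident (branch-true nf (test ev) skipping) , good , inj₁ (refl , λ _ → refl)
      go (suc v) ev = _
        , branch-false nf (test ev)
            (assigning {e = var 4} {field′ f (var 2)} (nf-var evident) (nf-field-at μ 0 f₀ e₂ y≤N) q<S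
             then assigning {e = lit 4} {field′ (2 + f) (var 2)} (word (lit<S 4<16))
               (nf-field-at μ₁ 2 f₂ 2′ y≤N) (lit<S 4<16))
        , Good-↦ {μ = μ₁} (Good-↦ {μ = μ} good q<S p<S) (lit<S 4<16)
            (subst (λ y → cell (2 + f) y < S) (sym 2′) (addr<S 2 f₂ y≤N))
        , inj₂ ((λ ()) , trans (cong (λ q → (μ [ q ↦ cell f (μ 2) ]) (cell (2 + f) s)) e₄)
                    (trans (get-same μ (cell (2 + f) s) (cell f (μ 2))) (cong (cell f) e₂))
               , cong (cell (2 + f)) 2′
               , λ a a≢4 a≢q → trans (get-other μ₁ a≢4) (get-other μ λ a≡ → a≢q (trans a≡ e₄)))
        where
        μ₁ = μ [ μ 4 ↦ cell f (μ 2) ]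
        4<16 : 4 < 16
        4<16 = evident
        q<S : μ 4 < S
        q<S = proj₂ good 4
        p<S : cell f (μ 2) < S
        p<S = subst (λ y → cell f y < S) (sym e₂) (addr<S 0 f₀ y≤N)
        2′ : μ₁ 2 ≡ y
        2′ = trans (get-other μ λ 2≡ → contradiction (trans 2≡ e₄) λ ()) e₂

  -- Within a step the invariant is suspended: once cell 3 has moved past `suc x` and the label
  -- there is replaced, in general `Core` holds neither at `x` nor at `suc x`. Each piece therefore
  -- reports its own effect and the cells it leaves alone, and `Core` is rebuilt once at the end.
  step : ∀ {μ x} → Core μ x → μ 2 ≡ suc x → suc x ≤ N → ∃[ μ′ ]
    (Reach (stepCode f cmp) 76 μ μ′ × μ′ 2 ≡ suc x × Core μ′ (suc x))
  step {μ} {x} c e₂ y≤N with fetch c e₂ y≤N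
  ... | μ₁ , r₁ , g₁ , e₆ , same₁
    with consume {μ₁} (core-cong c g₁ (λ a _ a≢6 _ → same₁ a a≢6)) (trans (same₁ 2 λ ()) e₂) e₆ y≤N
  ... | μ₂ , r₂ , g₂ , next₂ , same₂
    with mix {μ₂} g₂ (trans (same₂ 0 λ ()) (trans (same₁ 0 λ ()) (Core.input≡ c)))
           (trans (same₂ 2 λ ()) (trans (same₁ 2 λ ()) e₂)) y≤N
           (trans (same₂ 6 λ ()) e₆)
           (trans (same₂ 5 λ ()) (trans (same₁ 5 λ ()) (Core.carry≡ c)))
           (trans (same₂ (cell f (suc x)) λ ())
               (trans (same₁ (cell f (suc x)) λ ()) (Core.todo c (suc x) ≤-refl y≤N)))
           (trans (same₂ (cell (3 + f) (suc x)) λ ())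
             (trans (same₁ (cell (3 + f) (suc x)) λ ()) (Core.chr c (suc x) (s≤s z≤n) y≤N)))
  ... | μ₃ , r₃ , g₃ , ev , e₅ , same₃
    with relink {μ₃} g₃ (trans (same₃ 2 (λ ()) λ ()) (trans (same₂ 2 λ ()) (trans (same₁ 2 λ ()) e₂))) y≤N
           (≤-trans (Core.s≤x c) (Core.x≤N c))
           (trans (same₃ 4 (λ ()) λ ()) (trans (same₂ 4 λ ()) (trans (same₁ 4 λ ()) (Core.tail≡ c))))
           ev (s≤s (Core.s≤x c))
  ... | μ₄ , r₄ , g₄ , linked = μ₄ , (r₁ then r₂ then r₃ then r₄) , e₂′ linked , core linked
    where
    open Core c
    y = suc x

    Linked : Set
    Linked = (new y ≡ 0 × ∀ a → μ₄ a ≡ μ₃ a)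
      ⊎ (new y ≢ 0 × μ₄ (cell (2 + f) s) ≡ cell f y × μ₄ 4 ≡ cell (2 + f) y
          × (∀ a → a ≢ 4 → a ≢ cell (2 + f) s → μ₄ a ≡ μ₃ a))

    last-same : Linked → ∀ a → a ≢ 4 → a ≢ cell (2 + f) s → μ₄ a ≡ μ₃ a
    last-same (inj₁ (_ , same)) a _ _ = same a
    last-same (inj₂ (_ , _ , _ , same)) = same

    e₂′ : Linked → μ₄ 2 ≡ suc x
    e₂′ l = trans (last-same l 2 (λ ()) λ ())
        (trans (same₃ 2 (λ ()) λ ()) (trans (same₂ 2 λ ()) (trans (same₁ 2 λ ()) e₂)))

    same : Linked → ∀ a → a ≢ 3 → a ≢ 4 → a ≢ 5 → a ≢ 6 → a ≢ cell f y → a ≢ cell (2 + f) s → μ₄ a ≡ μ a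
    same l a p q r u v w = trans (last-same l a q w) (trans (same₃ a v r) (trans (same₂ a p) (same₁ a u)))

    same-cell : Linked → ∀ g z → cell g z ≢ cell f y → cell g z ≢ cell (2 + f) s → μ₄ (cell g z) ≡ μ (cell g z)
    same-cell l g z = same l (cell g z) (λ ()) (λ ()) (λ ()) (λ ())

    same-field : Linked → ∀ g z → g < 4 → g ≢ 0 → g ≢ 2 → μ₄ (cell (g + f) z) ≡ μ (cell (g + f) z)
    same-field l g z g<4 g≢0 g≢2 = same-cell l (g + f) z
      (λ e → g≢0 (+-cancelʳ-≡ f g 0 (proj₁ (cell-injective {z = z} {y} (f<stride g g<4) f₀ e))))
      (λ e → g≢2 (+-cancelʳ-≡ f g 2 (proj₁ (cell-injective {z = z} {s} (f<stride g g<4) f₂ e))))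

    same-value : Linked → ∀ z → z ≢ y → μ₄ (cell f z) ≡ μ (cell f z)
    same-value l z z≢y = same-cell l f z (λ e → z≢y (same-index 0 f₀ e)) (val≢lnk {z} {s})

    same-link : Linked → ∀ z → z ≢ s → μ₄ (cell (2 + f) z) ≡ μ (cell (2 + f) z)
    same-link l z z≢s = same-cell l (2 + f) z (λ e → val≢lnk {y} {z} (sym e)) (λ e → z≢s (same-index 2 f₂ e))

    done′ : Linked → ∀ z → 1 ≤ z → z ≤ y → μ₄ (cell f z) ≡ new z
    done′ l z 1≤z z≤y with m≤n⇒m<n∨m≡n z≤y
    ... | inj₁ z<y  = trans (same-value l z (<⇒≢ z<y)) (done z 1≤z (s≤s⁻¹ z<y))
    ... | inj₂ refl = trans (last-same l (cell f y) (λ ()) (val≢lnk {y} {s})) ev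

    untouched : Linked → ∀ a → ¬ Touched a → μ₄ a ≡ μ₀ a
    untouched l a ¬t = trans (same l a (low evident evident) (low evident evident)
      (low evident evident) (low evident evident)
      (λ e → ¬t (value y e)) (λ e → ¬t (link s e))) (frame a ¬t)
      where
      low : ∀ {v} → 1 ≤ v → v ≤ 7 → a ≢ v
      low p q refl = ¬t (scratch p q)

    core-with : (l : Linked) → ∀ s′ → s′ ≤ y → Live new s′ → Zeros new s′ (suc y) → μ₄ 4 ≡ cell (2 + f) s′ →
      (∀ z → z < s′ → Live new z →
        ∃[ j ] (z < j × j ≤ s′ × new j ≢ 0 × Zeros new z j × μ₄ (cell (2 + f) z) ≡ cell f j)) →
      Core μ₄ y
    core-with l s′ s′≤y live last tl links = record
      { x≤N = y≤N ; good = g₄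
      ; sentinel = trans (same l 1 (λ ()) (λ ()) (λ ()) (λ ()) (λ ()) (λ ())) sentinel
      ; input≡ = trans (same l 0 (λ ()) (λ ()) (λ ()) (λ ()) (λ ()) (λ ())) input≡
      ; carry≡ = trans (last-same l 5 (λ ()) λ ()) e₅
      ; done = done′ l
      ; todo = λ z y<z z≤N → trans (same-value l z (≢-sym (<⇒≢ y<z))) (todo z (<⇒≤ y<z) z≤N)
      ; idx = λ z p q → trans (same-field l 1 z evident (λ ()) λ ()) (idx z p q)
      ; chr = λ z p q → trans (same-field l 3 z evident (λ ()) λ ()) (chr z p q)
      ; next = subst (Next f t N y) (sym (trans (last-same l 3 (λ ()) λ ()) (same₃ 3 (λ ()) λ ()))) next₂
      ; oldLinks = λ z y<z z≤N tz≢0 → subst (Next f t N z)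
          (sym (same-link l z λ { refl → <⇒≱ y<z (m≤n⇒m≤1+n s≤x) })) (oldLinks z (<⇒≤ y<z) z≤N tz≢0)
      ; s = s′ ; s≤x = s′≤y ; s-live = live ; s-last = last ; tail≡ = tl ; newLinks = links
      ; frame = untouched l }

    earlier-link : Linked → ∀ z → z < s → Live new z →
      ∃[ j ] (z < j × j ≤ s × new j ≢ 0 × Zeros new z j × μ₄ (cell (2 + f) z) ≡ cell f j)
    earlier-link l z z<tl live = let j , a , b , d , e , g = newLinks z z<tl live in
      j , a , b , d , e , trans (same-link l z (<⇒≢ z<tl)) g

    core : Linked → Core μ₄ y
    core l@(inj₁ (ny≡0 , eq₄)) = core-with l s (m≤n⇒m≤1+n s≤x) s-live last′
      (trans (eq₄ 4) (trans (same₃ 4 (λ ()) λ ()) (trans (same₂ 4 λ ()) (trans (same₁ 4 λ ()) tail≡))))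
      (earlier-link l)
      where
      last′ : Zeros new s (suc y)
      last′ z s<z z≤y with m≤n⇒m<n∨m≡n (s≤s⁻¹ z≤y)
      ... | inj₁ z<y  = s-last z s<z z<y
      ... | inj₂ refl = ny≡0
    core l@(inj₂ (ny≢0 , lk , tl , _)) = core-with l y ≤-refl (inj₂ ny≢0)
      (λ z y<z z≤y → contradiction y<z (≤⇒≯ (s≤s⁻¹ z≤y))) tl links
      where
      links : ∀ z → z < y → Live new z →
        ∃[ j ] (z < j × j ≤ y × new j ≢ 0 × Zeros new z j × μ₄ (cell (2 + f) z) ≡ cell f j)
      links z z<y live with <-cmp z s
      ... | tri< z<tl _ _ = let j , a , b , d , e , g = earlier-link l z z<tl live in
                           j , a , ≤-trans b (m≤n⇒m≤1+n s≤x) , d , e , g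
      ... | tri≈ _ refl _ = y , z<y , ≤-refl , ny≢0 , (λ z′ s<z′ z′<y → s-last z′ s<z′ z′<y) , lk
      links z z<y (inj₁ refl) | tri> _ _ ()
      links z z<y (inj₂ nz≢0) | tri> _ _ s<z = contradiction (s-last z s<z z<y) nz≢0

-- The number of iterations

module Looping (k S W N̂ : ℕ) (sizes : Sizes k S W N̂) (task : Task S W N̂) where

  open Task task
  open Layout k
  open Code k
  open Sizes sizes
  open Machine k S W N̂ sizes
  open Sweeping k S W N̂ sizes task

  Active : ℕ → Set
  Active x = t (suc x) ≢ 0 ⊎ (carry x ≢ 0 × carry (suc x) ≡ 0)

  Advances : Program → ℕ → Set
  Advances advance c = ∀ μ x → Core μ x → μ 2 ≡ x → ∃[ μ′ ] ∃[ x′ ]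
    ( Reach advance c μ μ′ × Good S μ′ × (∀ a → a ≢ 2 → a ≢ 7 → μ′ a ≡ μ a)
    × x ≤ x′ × x′ ≤ N × Idle x x′ × μ′ 2 ≡ suc x′ × (x′ < N → Active x′))

  -- An iteration deletes a pivot of the old list or turns the carried label
  -- into 0, so twice the number of pivots left plus [carry ≠ 0] decreases.
  potential-decreases : ∀ φ x → x < N → Active x →
    2 * countAbove t 0 N + above 0 (carry x) ≤ φ + 2 * countAbove t 0 x →
    ∃[ φ′ ] (φ ≡ suc φ′ ×
      2 * countAbove t 0 N + above 0 (carry (suc x)) ≤ φ′ + 2 * countAbove t 0 (suc x))
  potential-decreases φ x x<N active bound = finish φ (decreased active)
    where
    open ≤-Reasoning
    cN = countAbove t 0 N
    cx = countAbove t 0 x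
    u  = above 0 (t (suc x))
    decreased : Active x → suc (2 * cN + above 0 (carry (suc x))) ≤ φ + 2 * (cx + u)
    decreased (inj₁ t≢0) = begin
      suc (2 * cN + above 0 (carry (suc x)))  ≤⟨ s≤s (+-monoʳ-≤ (2 * cN) (above≤1 0 (carry (suc x)))) ⟩
      suc (2 * cN + 1)                        ≡⟨ cong suc (+-comm (2 * cN) 1) ⟩
      2 + 2 * cN                              ≤⟨ +-monoʳ-≤ 2 (m≤m+n _ _) ⟩
      2 + (2 * cN + above 0 (carry x))        ≤⟨ +-monoʳ-≤ 2 bound ⟩
      2 + (φ + 2 * cx)                        ≡⟨ +-comm 2 _ ⟩
      φ + 2 * cx + 2                          ≡⟨ +-assoc φ (2 * cx) 2 ⟩
      φ + (2 * cx + 2 * 1)                    ≡⟨ cong (λ z → φ + z) (*-distribˡ-+ 2 cx 1) ⟨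
      φ + 2 * (cx + 1)                        ≡⟨ cong (λ v → φ + 2 * (cx + v)) (above-> (n≢0⇒n>0 t≢0)) ⟨
      φ + 2 * (cx + u)                        ∎
    decreased (inj₂ (c≢0 , c′≡0)) = begin
      suc (2 * cN + above 0 (carry (suc x)))  ≡⟨ cong (λ v → suc (2 * cN + above 0 v)) c′≡0 ⟩
      suc (2 * cN + 0)                        ≡⟨ cong suc (+-identityʳ (2 * cN)) ⟩
      1 + 2 * cN                              ≡⟨ +-comm 1 (2 * cN) ⟩
      2 * cN + 1                              ≡⟨ cong (λ v → 2 * cN + v) (above-> (n≢0⇒n>0 c≢0)) ⟨
      2 * cN + above 0 (carry x)              ≤⟨ bound ⟩
      φ + 2 * cx                              ≤⟨ +-monoʳ-≤ φ (*-monoʳ-≤ 2 (m≤m+n cx u)) ⟩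
      φ + 2 * (cx + u)                        ∎
    finish : ∀ φ → suc (2 * cN + above 0 (carry (suc x))) ≤ φ + 2 * (cx + u) →
      ∃[ φ′ ] (φ ≡ suc φ′ × 2 * cN + above 0 (carry (suc x)) ≤ φ′ + 2 * (cx + u))
    -- Potential 0 is excluded: the pivots up to `suc x` would outnumber all pivots.
    finish zero p = contradiction (≤-trans (s≤s (m≤m+n (2 * cN) _))
        (≤-trans p (*-monoʳ-≤ 2 (countAbove-mono t x<N)))) (<-irrefl refl)
    finish (suc φ′) (s≤s p) = φ′ , refl , p

  Swept : Memory → Set
  Swept μ = Good S μ × Half f μ N new β × μ 5 ≡ carry N
    × (∀ a → ¬ Touched a → a ≢ 10 + f → μ a ≡ μ₀ a)

  module Sweep (advance : Program) (c : ℕ) (advances : Advances advance c) where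

    -- A loop test costs 5, so an iteration costs 81 = 5 + 76 besides the advance; the 5 in front
    -- pays for the test that fails.
    Looped : ℕ → Memory → Set
    Looped φ μ = ∃[ μ′ ] (Reach (while loopTest (stepCode f cmp ⨾ advance)) (5 + φ * (81 + c)) μ μ′ × Core μ′ N)

    private
      iterate : ∀ {φ μ μ₁ μ₂ x} → Core μ x → μ 2 ≡ suc x → x < N →
        Reach (stepCode f cmp) 76 μ μ₁ → Reach advance c μ₁ μ₂ → Looped φ μ₂ → Looped (suc φ) μ
      iterate {φ} {μ} {x = x} core e₂ x<N r₁ r₂ (μ′ , (u , run , u≤) , core′) =
        let v , run′ , v≤ = r₁ then r₂ in
        μ′ , (5 + v + u , while-true nf test run′ run , iteration-time 5 (76 + c) (φ * (81 + c)) v≤ u≤) , core′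
        where
        nf = nf-var evident , nf-var evident
        test : (μ 2 <ᵇ μ 1) ≡ true
        test = trans (cong₂ _<ᵇ_ e₂ (Core.sentinel core)) (<⇒<ᵇ-true (s≤s x<N))

      exit : ∀ {φ μ x} → Core μ x → μ 2 ≡ suc x → x ≡ N → Looped φ μ
      exit {φ} {μ} core e₂ refl = μ , (5 , while-false nf test , m≤m+n 5 (φ * (81 + c))) , core
        where
        nf = nf-var evident , nf-var evident
        test : (μ 2 <ᵇ μ 1) ≡ false
        test = trans (cong₂ _<ᵇ_ e₂ (Core.sentinel core)) (≥⇒<ᵇ-false (≤-refl {suc N}))

      bound-skip : ∀ {φ x x′} → x ≤ x′ → Idle x x′ →
        2 * countAbove t 0 N + above 0 (carry x) ≤ φ + 2 * countAbove t 0 x →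
        2 * countAbove t 0 N + above 0 (carry x′) ≤ φ + 2 * countAbove t 0 x′
      bound-skip {φ} {x} {x′} x≤x′ idle = subst₂ (λ v n → 2 * countAbove t 0 N + above 0 v ≤ φ + 2 * n)
        (sym (carries (m≤n⇒m<n∨m≡n x≤x′))) (sym (countAbove-zeros t x x≤x′ (λ z p q → proj₁ (idle z p q))))
        where
        carries : x < x′ ⊎ x ≡ x′ → carry x′ ≡ carry x
        carries (inj₁ p)    = proj₂ (proj₂ (idle x′ p ≤-refl))
        carries (inj₂ refl) = refl

    loop : ∀ φ μ x → Core μ x → μ 2 ≡ suc x → (x < N → Active x) →
      2 * countAbove t 0 N + above 0 (carry x) ≤ φ + 2 * countAbove t 0 x → Looped φ μ
    loop φ μ x core e₂ active bound with m≤n⇒m<n∨m≡n (Core.x≤N core)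
    ... | inj₂ x≡N = exit {φ} core e₂ x≡N
    ... | inj₁ x<N with potential-decreases φ x x<N (active x<N) bound
    ... | φ′ , refl , bound′ =
      let μ₁ , r₁ , e₂′ , core₁ = step core e₂ x<N
          μ₂ , x′ , r₂ , good₂ , same , x<x′ , x′≤N , idle , e₂″ , active′ = advances μ₁ (suc x) core₁ e₂′
      in iterate {φ = φ′} core e₂ x<N r₁ r₂ (loop φ′ μ₂ x′
           (core-skip (core-cong core₁ good₂ (λ a p _ q → same a p q)) x<x′ x′≤N idle)
           e₂″ active′ (bound-skip {φ′} x<x′ idle bound′))

    module _ (half : Half f μ₀ N t β) (good₀ : Good S μ₀) (input₀ : μ₀ 0 ≡ σ)
      (start : Expr) (start-nf : NoFault S W start μ₀) (start≡ : ⟦ start ⟧ μ₀ ≡ w₀)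
      (start-cost : cost start ≤ 4) (w₀<S : w₀ < S)
      where

      private
        f₂ = f<stride 2 evident
        f+ : ∀ {g} → g < 12 → g + f < 16
        f+ g< = ≤-<-trans (+-monoʳ-≤ _ f≤4) (+-monoˡ-< 4 g<)

        m₁ m₂ m₃ m₄ m₅ : Memory
        m₁ = μ₀ [ 5 ↦ ⟦ start ⟧ μ₀ ]
        m₂ = m₁ [ 1 ↦ suc (m₁ (9 + f)) ]
        m₃ = m₂ [ 2 ↦ 0 ]
        m₄ = m₃ [ 3 ↦ m₃ (cell (2 + f) 0) ]
        m₅ = m₄ [ 4 ↦ cell (2 + f) 0 ]

        g₁ : Good S m₁
        g₁ = Good-↦ {μ = μ₀} good₀ (lit<S evident) (subst (_< S) (sym start≡) w₀<S)
        sN<S : suc (m₁ (9 + f)) < S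
        sN<S = subst (λ n → suc n < S) (sym (Half.len half)) (index<S N<N̂)
        g₂ : Good S m₂
        g₂ = Good-↦ {μ = m₁} g₁ (lit<S evident) sN<S
        g₃ : Good S m₃
        g₃ = Good-↦ {μ = m₂} g₂ (lit<S evident) (lit<S evident)
        g₄ : Good S m₄
        g₄ = Good-↦ {μ = m₃} g₃ (lit<S evident) (proj₂ g₃ (cell (2 + f) 0))
        g₅ : Good S m₅
        g₅ = Good-↦ {μ = m₄} g₄ (lit<S evident) (cell< (2 + f) 0 f₂ z≤n)

        setup : Reach (setupCode f start) 22 μ₀ m₅
        setup =
          weaken (+-monoˡ-≤ 16 (+-monoʳ-≤ 2 start-cost))
          ( assigning {lit 5} {start} {μ₀} (word (lit<S evident)) start-nf (lit<S evident)
          then assigning {lit 1} {add (lit 1) (var (9 + f))} {m₁} (word (lit<S evident))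
                 (word (lit<S evident) , nf-var (f+ evident) , word sN<S) (lit<S evident)
          then assigning {lit 2} {lit 0} {m₂} (word (lit<S evident)) 0<W (lit<S evident)
          then assigning {lit 3} {var (cell (2 + f) 0)} {m₃} (word (lit<S evident))
                 (word (cell< (2 + f) 0 f₂ z≤n) , cell< (2 + f) 0 f₂ z≤n) (lit<S evident)
          then assigning {lit 4} {lit (cell (2 + f) 0)} {m₄} (word (lit<S evident))
                 (word (cell< (2 + f) 0 f₂ z≤n)) (lit<S evident))

        core₀ : Core m₅ 0
        core₀ = record
          { x≤N = z≤n ; good = g₅ ; sentinel = cong suc (Half.len half) ; input≡ = input₀ ; carry≡ = start≡
          ; done = λ z 1≤z z≤0 → contradiction z≤0 (<⇒≱ 1≤z)
          ; todo = Half.val half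
          ; idx = Half.idx half ; chr = Half.chr half
          ; next = Half.lnk half 0 z≤n (inj₁ refl)
          ; oldLinks = λ z _ z≤N tz≢0 → Half.lnk half z z≤N (inj₂ tz≢0)
          ; s = 0 ; s≤x = z≤n ; s-live = inj₁ refl
          ; s-last = λ z 0<z z<1 → contradiction (s≤s⁻¹ z<1) (<⇒≱ 0<z)
          ; tail≡ = refl
          ; newLinks = λ z ()
          ; frame = λ a ¬t →
              trans (get-other m₄ {4} {x = a} λ { refl → ¬t (scratch evident evident) })
              (trans (get-other m₃ {3} {x = a} λ { refl → ¬t (scratch evident evident) })
              (trans (get-other m₂ {2} {x = a} λ { refl → ¬t (scratch evident evident) })
              (trans (get-other m₁ {1} {x = a} λ { refl → ¬t (scratch evident evident) })
                     (get-other μ₀ {5} {x = a} λ { refl → ¬t (scratch evident evident) })))) }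

        finish : ∀ {μ} → Core μ N → ∃[ μ′ ] (Reach (finishCode f) 8 μ μ′ × Swept μ′)
        finish {μ} core = μ₂
          , (assigning {var 4} {lit 0} {μ} (nf-var evident) 0<W (proj₂ good 4)
             then assigning {lit (10 + f)} {var 4} {μ₁} (word 10+f<S) (nf-var evident) 10+f<S)
          , Good-↦ {μ = μ₁} gd₁ 10+f<S (proj₂ gd₁ 4)
          , record
            { len  = trans (trans (get-other μ₁ (<⇒≢ ≤-refl))
                (same (9 + f) (λ e → cell≢low (2 + f) s evident (sym e))))
                       (trans (frame (9 + f) 9+f-untouched) (Half.len half))
            ; val  = λ z p q → trans (same₂ f z (val≢lnk {z} {s})) (done z p q)
            ; idx  = λ z p q → trans (same₂ (1 + f) z
                (λ e → contradiction (proj₁ (cell-injective {z = z} {s} (f<stride 1 evident) f₂ e))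
                    (<⇒≢ ≤-refl))) (idx z p q)
            ; chr  = λ z p q → trans (same₂ (3 + f) z
                (λ e → contradiction (proj₁ (cell-injective {z = z} {s} (f<stride 3 evident) f₂ e))
                    (≢-sym (<⇒≢ ≤-refl)))) (chr z p q)
            ; lnk  = links
            ; tail = s , s≤x , s-live , s-last , trans (get-same μ₁ (10 + f) (μ₁ 4)) tail₁ }
          , trans (same 5 λ ()) carry≡
          , λ a ¬t a≢ → trans (get-other μ₁ a≢) (trans (same a (λ e → ¬t (link s e))) (frame a ¬t))
          where
          open Core core
          10+f<S = lit<S (f+ {10} evident)
          μ₁ = μ [ μ 4 ↦ 0 ]
          μ₂ = μ₁ [ 10 + f ↦ μ₁ 4 ]
          gd₁ = Good-↦ {μ = μ} good (proj₂ good 4) (lit<S evident)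
          same : ∀ a → a ≢ cell (2 + f) s → μ₁ a ≡ μ a
          same a a≢ = get-other μ λ e → a≢ (trans e tail≡)
          cell≢low : ∀ g z {v} → v < 12 → cell g z ≢ v + f
          cell≢low g z v< e = <⇒≱ (f+ v<) (subst (16 ≤_) e (m≤m+n 16 _))
          high≢10+f : ∀ g z → cell g z ≢ 10 + f
          high≢10+f g z = cell≢low g z evident
          9+f-untouched : ¬ Touched (9 + f)
          9+f-untouched (scratch _ p) = contradiction p (<⇒≱ (m≤m+n 8 _))
          9+f-untouched (value z e) = cell≢low f z evident (sym e)
          9+f-untouched (link z e) = cell≢low (2 + f) z evident (sym e)
          same₂ : ∀ g z → cell g z ≢ cell (2 + f) s → μ₂ (cell g z) ≡ μ (cell g z)
          same₂ g z ≢s = trans (get-other μ₁ (high≢10+f g z)) (same (cell g z) ≢s)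
          tail₁ : μ₁ 4 ≡ cell (2 + f) s
          tail₁ = trans (same 4 λ ()) tail≡
          links : ∀ z → z ≤ N → Live new z → Next f new N z (μ₂ (cell (2 + f) z))
          links z z≤N live with <-cmp z s
          ... | tri< z<tl _ _ = let j , a , b , d , e , g = newLinks z z<tl live in
                inj₂ (j , a , ≤-trans b s≤x , d , e , trans
                    (same₂ (2 + f) z (λ e′ → <⇒≢ z<tl (same-index 2 {z} {s} f₂ e′))) g)
          ... | tri≈ _ refl _ = inj₁ (trans (get-other μ₁ (high≢10+f (2 + f) s))
                (trans (cong (λ a → (μ [ a ↦ 0 ]) (cell (2 + f) s)) tail≡)
                    (get-same μ (cell (2 + f) s) 0)) , s-last)
          links z z≤N (inj₁ refl) | tri> _ _ ()
          links z z≤N (inj₂ nz≢0) | tri> _ _ s<z = contradiction (s-last z s<z (s≤s z≤N)) nz≢0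

      sweep : ∃[ μ′ ] ( Reach (sweepCode f cmp advance start)
                          (22 + (c + (5 + (2 * countAbove t 0 N + 1) * (81 + c) + 8))) μ₀ μ′
                      × Swept μ′ )
      sweep =
        -- The additional 1 covers a start label other than 0, as when appending to `B`.
        let φ = 2 * countAbove t 0 N + 1
            μ₁ , x , r₁ , good₁ , same , 0≤x , x≤N , idle , e₂ , active = advances m₅ 0 core₀ refl
            μ₂ , r₂ , core₂ = loop φ μ₁ x (core-skip
                (core-cong core₀ good₁ (λ a p _ q → same a p q)) 0≤x x≤N idle)
                                e₂ active (bound-skip {φ} 0≤x idle bound₀)
            μ₃ , r₃ , swept = finish core₂
        in μ₃ , (setup then r₁ then r₂ then r₃) , swept
        where
        bound₀ : 2 * countAbove t 0 N + above 0 w₀ ≤ 2 * countAbove t 0 N + 1 + 2 * 0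
        bound₀ = ≤-trans (+-monoʳ-≤ (2 * countAbove t 0 N) (above≤1 0 w₀)) (m≤m+n _ _)

-- Occurrences of a character

occurrences : (ℕ → ℕ) → ℕ → ℕ → ℕ
occurrences α c zero    = 0
occurrences α c (suc r) = if α (suc r) ≡ᵇ c then suc (occurrences α c r) else occurrences α c r

occurrences-hit : ∀ α {c} r → α (suc r) ≡ c → occurrences α c (suc r) ≡ suc (occurrences α c r)
occurrences-hit α r refl rewrite ≡ᵇ-refl (α (suc r)) = refl

occurrences-miss : ∀ α {c} r → α (suc r) ≢ c → occurrences α c (suc r) ≡ occurrences α c r
occurrences-miss α r ≢c rewrite ≢⇒≡ᵇ-false ≢c = refl

occurrences≤ : ∀ α c r → occurrences α c r ≤ r
occurrences≤ α c zero = z≤n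
occurrences≤ α c (suc r) with α (suc r) ≡ᵇ c
... | true  = s≤s (occurrences≤ α c r)
... | false = m≤n⇒m≤1+n (occurrences≤ α c r)

occurrences-mono : ∀ α c {r r′} → r ≤ r′ → occurrences α c r ≤ occurrences α c r′
occurrences-mono α c r≤r′ with m≤n⇒m<n∨m≡n r≤r′
... | inj₂ refl = ≤-refl
occurrences-mono α c {r} {suc r′} r≤r′ | inj₁ (s≤s r≤) with α (suc r′) ≡ᵇ c
... | true  = m≤n⇒m≤1+n (occurrences-mono α c r≤)
... | false = occurrences-mono α c r≤

Misses : (ℕ → ℕ) → ℕ → ℕ → ℕ → Set
Misses α c x y = ∀ z → x < z → z ≤ y → α z ≢ c

-- The counts belong to the result because the table of positions is addressed by them: the next
-- occurrence after `x` has number `suc (occurrences α c x)`, and there is none if that exceeds the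
-- total.
nextOccurrence : ∀ α c {x} M → x ≤ M →
  (Misses α c x M × occurrences α c M ≡ occurrences α c x) ⊎
  ∃[ q ] (x ≤ q × q < M × α (suc q) ≡ c × Misses α c x q × occurrences α c (suc q) ≡ suc (occurrences α c x))
nextOccurrence α c M x≤M with m≤n⇒m<n∨m≡n x≤M
... | inj₂ refl = inj₁ ((λ z x<z z≤x → contradiction z≤x (<⇒≱ x<z)) , refl)
nextOccurrence α c (suc M) x≤M | inj₁ (s≤s x≤) with nextOccurrence α c M x≤
... | inj₂ (q , a , b , d) = inj₂ (q , a , m≤n⇒m≤1+n b , d)
... | inj₁ (misses , e) with α (suc M) ≟ c
...   | yes hit = inj₂ (M , x≤ , ≤-refl , hit , misses , trans (occurrences-hit α M hit) (cong suc e))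
...   | no miss = inj₁ (misses′ , trans (occurrences-miss α M miss) e)
  where
  misses′ : Misses α c _ (suc M)
  misses′ z x<z z≤ with m≤n⇒m<n∨m≡n z≤
  ... | inj₁ z<  = misses z x<z (s≤s⁻¹ z<)
  ... | inj₂ refl = miss

-- Fields 8 + c count the occurrences of c up to each position; fields 8 + k + c
-- list the positions of these occurrences, so the next occurrence of c after
-- position x is found in constant time.
record Index (k : ℕ) (μ : Memory) (M : ℕ) (α : ℕ → ℕ) : Set where
  open Layout k
  field
    cnt  : ∀ c → c < k → ∀ r → r ≤ M → μ (cell (8 + c) r) ≡ occurrences α c r
    pos  : ∀ c → c < k → ∀ q → 1 ≤ q → q ≤ M → α q ≡ c → μ (cell (8 + k + c) (occurrences α c q)) ≡ q
    -- Positions start at 1, so the value 0 read beyond the last occurrence tells that there is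
    -- none.
    free : ∀ c → c < k → ∀ i → occurrences α c M < i → μ (cell (8 + k + c) i) ≡ 0

posOf : Expr
posOf = mem (add (lit 1) (var 3))

jumpCode advanceA : Program
jumpCode = lit 2 ≔ posOf
advanceA = cond (eq (var 5) (lit 0)) jumpCode (lit 2 ≔ add (lit 1) (var 2))

module IndexCode (k : ℕ) where
  open Layout k

  charField : ℕ → Expr → Expr
  charField g e = add (add (lit (16 + g)) (var 0)) (mul e (lit stride))

  chooseCode advanceB : Program
  chooseCode = cond (eq (var 7) (lit 0)) jumpCode (cond (lt (var 7) posOf) (lit 2 ≔ var 7) jumpCode)
  advanceB = cond (eq (var 5) (lit 0)) jumpCode
    (lit 7 ≔ mem (charField (8 + k) (add (lit 1) (mem (charField 8 (var 2))))) ⨾ chooseCode)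

  8+<stride : ∀ {c} → c < k → 8 + c < stride
  8+<stride c<k = +-monoʳ-< 8 (≤-trans c<k (m≤m+n k k))

  8+k+<stride : ∀ {c} → c < k → 8 + k + c < stride
  8+k+<stride c<k = +-monoʳ-< (8 + k) c<k

-- Finding the next active position

module Advancing (k S W N̂ : ℕ) (sizes : Sizes k S W N̂) (task : Task S W N̂) where

  open Task task
  open Layout k
  open Code k
  open IndexCode k
  open Sizes sizes
  open Machine k S W N̂ sizes
  open Sweeping k S W N̂ sizes task
  open Looping k S W N̂ sizes task

  -- Exchanging two zeros changes nothing, so while 0 is carried the characters do not matter; a
  -- nonzero label must meet no exchange at all.
  idle : ∀ {x y} → (∀ z → x < z → z ≤ y → t z ≡ 0) →
    carry x ≡ 0 ⊎ (∀ z → x < z → z ≤ y → swapAt z 0 (carry x) ≡ false) → Idle x y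
  idle {x} {y} zs quiet (suc z) (s≤s x≤z) z<y = zs (suc z) (s≤s x≤z) z<y , go quiet
    where
    before : carry z ≡ carry x
    before with m≤n⇒m<n∨m≡n x≤z
    ... | inj₁ x<z  = proj₂ (proj₂ (idle zs quiet z x<z (<⇒≤ z<y)))
    ... | inj₂ refl = refl
    go : carry x ≡ 0 ⊎ (∀ z → x < z → z ≤ y → swapAt z 0 (carry x) ≡ false) →
      new (suc z) ≡ 0 × carry (suc z) ≡ carry x
    go (inj₂ noSwap) rewrite before | zs (suc z) (s≤s x≤z) z<y | noSwap (suc z) (s≤s x≤z) z<y = refl , refl
    go (inj₁ c≡0) rewrite before | zs (suc z) (s≤s x≤z) z<y | c≡0 with swapAt (suc z) 0 0
    ... | true  = refl , refl
    ... | false = refl , refl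

  record Jump (μ : Memory) (x : ℕ) : Set where
    field
      y      : ℕ
      posOf≡ : ⟦ posOf ⟧ μ ≡ suc y
      nf     : NoFault S W posOf μ
      x≤y    : x ≤ y
      y≤N    : y ≤ N
      zeros  : ∀ z → x < z → z ≤ y → t z ≡ 0
      nonzero : y < N → t (suc y) ≢ 0

  jump : ∀ {μ x} → Core μ x → Jump μ x
  jump {μ} {x} core = go (Core.next core)
    where
    open Core core
    nf-at : ∀ {p} → μ 3 ≡ p → suc p < S → NoFault S W posOf μ
    nf-at refl p<S = (word (lit<S evident) , nf-var evident , word p<S) , p<S
    go : Next f t N x (μ 3) → Jump μ x
    go (inj₁ (e , zs)) = record
      { y = N ; posOf≡ = trans (cong (λ p → μ (suc p)) e) sentinel
      ; nf = nf-at e (lit<S evident) ; x≤y = x≤N ; y≤N = ≤-refl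
      ; zeros = λ z x<z z≤N → zs z x<z (s≤s z≤N) ; nonzero = λ N<N → contradiction N<N (<-irrefl refl) }
    go (inj₂ (suc y , s≤s x≤y , y<N , ty≢0 , zs , e)) = record
      { y = y ; posOf≡ = trans (cong (λ p → μ (suc p)) e) (idx (suc y) (s≤s z≤n) y<N)
      ; nf = nf-at e (cell< (1 + f) (suc y) (f<stride 1 evident) (≤-trans y<N (<⇒≤ N<N̂)))
      ; x≤y = x≤y ; y≤N = <⇒≤ y<N
      ; zeros = λ z x<z z≤y → zs z x<z (s≤s z≤y) ; nonzero = λ _ → ty≢0 }

  jumping : ∀ {μ x} → Core μ x → (j : Jump μ x) →
    Reach jumpCode 7 μ (μ [ 2 ↦ ⟦ posOf ⟧ μ ]) × Good S (μ [ 2 ↦ ⟦ posOf ⟧ μ ])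
  jumping {μ} core j =
      assigning {lit 2} {posOf} {μ} (word (lit<S 2<16)) (Jump.nf j) (lit<S 2<16)
    , Good-↦ {μ = μ} (Core.good core) (lit<S 2<16) (proj₂ (Core.good core) _)
    where
    2<16 : 2 < 16
    2<16 = evident

  private
    test-5 : ∀ {μ x} → Core μ x → ∀ {b} → (carry x ≡ᵇ 0) ≡ b → ⟦ eq (var 5) (lit 0) ⟧ᵗ μ ≡ b
    test-5 core e = trans (cong (_≡ᵇ 0) (Core.carry≡ core)) e

    nf-5 : ∀ {μ} → NoFaultᵗ S W (eq (var 5) (lit 0)) μ
    nf-5 = nf-var evident , 0<W

    same-2 : ∀ μ v → ∀ a → a ≢ 2 → a ≢ 7 → (μ [ 2 ↦ v ]) a ≡ μ a
    same-2 μ v a a≢2 _ = get-other μ a≢2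

  advancesA : (∀ c w → cmpF c w ≡ (c <ᵇ w)) → Advances advanceA 11
  advancesA cmp≡ μ x core e₂ with carry x ≡ᵇ 0 in c?
  ... | true = _ , y , weaken evident (branch-true {Q = lit 2 ≔ add (lit 1) (var 2)} (nf-5 {μ})
      (test-5 core c?) (proj₁ (jumping core j)))
      , proj₂ (jumping core j) , same-2 μ _
      , x≤y , y≤N , idle zeros (inj₁ (≡ᵇ-true⇒≡ (carry x) 0 c?)) , posOf≡ , λ y<N → inj₁ (nonzero y<N)
    where
    j = jump core
    open Jump j
  ... | false = _ , x , weaken evident (branch-false {P = jumpCode} (nf-5 {μ}) (test-5 core c?)
          (assigning {lit 2} {add (lit 1) (var 2)} {μ} (word (lit<S 2<16))
            (word (lit<S evident) , nf-var 2<16 , word sx<S) (lit<S 2<16)))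
      , Good-↦ {μ = μ} good (lit<S 2<16) sx<S , same-2 μ _
      , ≤-refl , x≤N , (λ z x<z z≤x → contradiction z≤x (<⇒≱ x<z)) , cong suc e₂ , active
    where
    open Core core
    2<16 : 2 < 16
    2<16 = evident
    sx<S : suc (μ 2) < S
    sx<S = subst (λ x → suc x < S) (sym e₂) (index<S (≤-trans (s≤s x≤N) N<N̂))
    w≢0 : carry x ≢ 0
    w≢0 = ≡ᵇ-false⇒≢ (carry x) 0 c?
    active : x < N → Active x
    active x<N with t (suc x) ≟ 0
    ... | no ≢0 = inj₁ ≢0
    ... | yes ≡0 = inj₂ (w≢0 , carry′)
      where
      -- The old label 0 is below the carried one, so they are exchanged whether or not the
      -- characters match.
      carry′ : carry (suc x) ≡ 0
      carry′ rewrite ≡0 | cmp≡ 0 (carry x) | <⇒<ᵇ-true (n≢0⇒n>0 w≢0) with β (suc x) ≡ᵇ σ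
      ... | true  = refl
      ... | false = refl

  module _ (index : Index k μ₀ N β) (σ<k : σ < k) (cmp≡ : ∀ c w → cmpF c w ≡ (w <ᵇ c)) where

    private
      quiet : ∀ {x y w} → Misses β σ x y → ∀ z → x < z → z ≤ y → swapAt z 0 w ≡ false
      quiet {w = w} misses z x<z z≤y rewrite ≢⇒≡ᵇ-false (misses z x<z z≤y) =
        trans (cmp≡ 0 w) (≥⇒<ᵇ-false {w} z≤n)

      untouched : ∀ {g} z → 8 ≤ g → g < stride → ¬ Touched (cell g z)
      untouched z 8≤g g< (scratch _ p) = contradiction p (<⇒≱ (m≤m+n 8 _))
      untouched z 8≤g g< (value z′ e) =
        contradiction (proj₁ (cell-injective {z = z} {z′} g< (f<stride 0 (s≤s z≤n)) e))
          (≢-sym (<⇒≢ (≤-trans (s≤s f≤4) (≤-trans evident 8≤g))))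
      untouched z 8≤g g< (link z′ e) =
        contradiction (proj₁ (cell-injective {z = z} {z′} g< (f<stride 2 evident) e))
          (≢-sym (<⇒≢ (≤-trans (s≤s (+-monoʳ-≤ 2 f≤4)) (≤-trans evident 8≤g))))

      c₈ = 8+<stride σ<k
      c₈ₖ = 8+k+<stride σ<k

    Chosen : Memory → ℕ → Program → ℕ → Set
    Chosen μ x P c = ∃[ μ′ ] ∃[ x′ ]
      ( Reach P c μ μ′ × Good S μ′ × (∀ a → a ≢ 2 → a ≢ 7 → μ′ a ≡ μ a)
      × x ≤ x′ × x′ ≤ N × Idle x x′ × μ′ 2 ≡ suc x′ × (x′ < N → Active x′))

    private
      choose-jump : ∀ {μ x P c} → (core : Core μ x) (j : Jump μ x) → carry x ≡ 0 ⊎ Misses β σ x (Jump.y j) →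
        (∀ {μ′} → Reach jumpCode 7 μ μ′ → Reach P c μ μ′) → Chosen μ x P c
      choose-jump {μ} {x} core j calm run = _ , y , run (proj₁ (jumping core j)) , proj₂ (jumping core j)
          , same-2 μ _
        , x≤y , y≤N , idle zeros (noSwap calm) , posOf≡ , λ y<N → inj₁ (nonzero y<N)
        where
        open Jump j
        noSwap : carry x ≡ 0 ⊎ Misses β σ x y → carry x ≡ 0 ⊎
            (∀ z → x < z → z ≤ y → swapAt z 0 (carry x) ≡ false)
        noSwap (inj₁ e) = inj₁ e
        noSwap (inj₂ m) = inj₂ (quiet {w = carry x} m)

      nf-7 : ∀ {μ} → NoFaultᵗ S W (eq (var 7) (lit 0)) μ
      nf-7 = nf-var evident , 0<W

    choose : ∀ {μ x} → Core μ x → carry x ≢ 0 →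
      (μ 7 ≡ 0 × Misses β σ x N) ⊎
      (∃[ q ] (μ 7 ≡ suc q × x ≤ q × q < N × β (suc q) ≡ σ × Misses β σ x q)) →
      Chosen μ x chooseCode 19
    choose {μ} {x} core w≢0 (inj₁ (e₇ , misses)) = choose-jump core j
        (inj₂ λ z x<z z≤y → misses z x<z (≤-trans z≤y (Jump.y≤N j)))
      λ r → weaken evident (branch-true (nf-7 {μ}) (cong (_≡ᵇ 0) e₇) r)
      where j = jump core
    choose {μ} {x} core w≢0 (inj₂ (q , e₇ , x≤q , q<N , hit , misses)) = go (<-≤-connex q (Jump.y j))
      where
      j = jump core
      open Jump j
      open Core core using (good)
      nf-lt : NoFaultᵗ S W (lt (var 7) posOf) μ
      nf-lt = nf-var evident , nf
      go : q < y ⊎ y ≤ q → Chosen μ x chooseCode 19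
      -- A pivot at the matching position itself falls under this case too; it makes the position
      -- active just as well.
      go (inj₂ y≤q) = choose-jump core j (inj₂ λ z x<z z≤y → misses z x<z (≤-trans z≤y y≤q)) λ r →
        branch-false (nf-7 {μ}) (cong (_≡ᵇ 0) e₇)
          (branch-false nf-lt (trans (cong₂ _<ᵇ_ e₇ posOf≡) (≥⇒<ᵇ-false (s≤s y≤q))) r)
      go (inj₁ q<y) = _ , q
        , weaken evident (branch-false (nf-7 {μ}) (cong (_≡ᵇ 0) e₇)
            (branch-true nf-lt (trans (cong₂ _<ᵇ_ e₇ posOf≡) (<⇒<ᵇ-true (s≤s q<y)))
              (assigning {lit 2} {var 7} {μ} (word (lit<S 2<16)) (nf-var evident) (lit<S 2<16))))
        , Good-↦ {μ = μ} good (lit<S 2<16) (proj₂ good 7) , same-2 μ _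
        , x≤q , <⇒≤ q<N , idle′ , e₇ , λ _ → inj₂ (w′≢0 , carry′)
        where
        2<16 : 2 < 16
        2<16 = evident
        idle′ : Idle x q
        idle′ = idle (λ z x<z z≤q → zeros z x<z (≤-trans z≤q (<⇒≤ q<y))) (inj₂ (quiet misses))
        carries : carry q ≡ carry x
        carries with m≤n⇒m<n∨m≡n x≤q
        ... | inj₁ x<q  = proj₂ (proj₂ (idle′ q x<q ≤-refl))
        ... | inj₂ refl = refl
        w′≢0 : carry q ≢ 0
        w′≢0 e = w≢0 (trans (sym carries) e)
        -- `suc q` still comes before the next pivot, so its old label is 0, and the match forces
        -- the exchange.
        carry′ : carry (suc q) ≡ 0
        carry′ rewrite hit | ≡ᵇ-refl σ = zeros (suc q) (s≤s x≤q) q<y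

    advancesB : Advances advanceB 45
    advancesB μ x core e₂ with carry x ≡ᵇ 0 in c?
    ... | true  = choose-jump core (jump core) (inj₁ (≡ᵇ-true⇒≡ (carry x) 0 c?))
      λ r → weaken evident (branch-true (nf-5 {μ}) (test-5 core c?) r)
    ... | false = finish (choose core₁ (≡ᵇ-false⇒≢ (carry x) 0 c?) found)
      where
      open Core core
      open Index index
      7<16 : 7 < 16
      7<16 = evident
      i = occurrences β σ x
      lookup : Expr
      lookup = mem (charField (8 + k) (add (lit 1) (mem (charField 8 (var 2)))))
      μ₁ = μ [ 7 ↦ ⟦ lookup ⟧ μ ]
      good₁ : Good S μ₁
      good₁ = Good-↦ {μ = μ} good (lit<S 7<16) (proj₂ good _)
      core₁ : Core μ₁ x
      core₁ = core-cong core good₁ λ a _ _ a≢7 → get-other μ a≢7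
      x≤N̂ = ≤-trans x≤N (<⇒≤ N<N̂)
      si≤N̂ : suc i ≤ N̂
      si≤N̂ = ≤-trans (s≤s (≤-trans (occurrences≤ β σ x) x≤N)) N<N̂
      -- The table is described for the memory `μ₀` before the sweep; `frame` carries it over, since
      -- a sweep never writes to the fields from 8 on.
      inner : μ (cell (8 + μ 0) (μ 2)) ≡ i
      inner = trans (cong₂ (λ c r → μ (cell (8 + c) r)) input≡ e₂)
        (trans (frame (cell (8 + σ) x) (untouched x (m≤m+n 8 σ) c₈)) (cnt σ σ<k x x≤N))
      outer : ⟦ lookup ⟧ μ ≡ μ₀ (cell (8 + k + σ) (suc i))
      outer = trans (cong₂ (λ c r → μ (cell (8 + k + c) (suc r))) input≡ inner)
        (frame (cell (8 + k + σ) (suc i)) (untouched (suc i) (≤-trans (m≤m+n 8 k) (m≤m+n (8 + k) σ)) c₈ₖ))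
      nf-char : ∀ g e z → NoFault S W e μ → ⟦ e ⟧ μ ≡ z → g + σ < stride → z ≤ N̂ →
        NoFault S W (mem (charField g e)) μ
      nf-char g e z nf refl g< z≤ rewrite input≡ =
        ( (word (field<S (≤-<-trans (m≤m+n g σ) g<)) , nf-var (s≤s z≤n) , word (field<S g<))
        , (nf , word stride<S , word (≤-<-trans (m≤n+m _ (16 + (g + σ))) (cell< (g + σ) z g< z≤)))
        , word (cell< (g + σ) z g< z≤)) , cell< (g + σ) z g< z≤
      nf-inner : NoFault S W (mem (charField 8 (var 2))) μ
      nf-inner = nf-char 8 (var 2) x (nf-var evident) e₂ c₈ x≤N̂
      nf-lookup : NoFault S W lookup μ
      nf-lookup = nf-char (8 + k) (add (lit 1) (mem (charField 8 (var 2)))) (suc i)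
        (word (lit<S evident) , nf-inner , word (subst (λ i → suc i < S) (sym inner) (index<S si≤N̂)))
        (cong suc inner) c₈ₖ si≤N̂
      found : (μ₁ 7 ≡ 0 × Misses β σ x N) ⊎
        (∃[ q ] (μ₁ 7 ≡ suc q × x ≤ q × q < N × β (suc q) ≡ σ × Misses β σ x q))
      found with nextOccurrence β σ N x≤N
      ... | inj₁ (misses , e) = inj₁ (trans outer (free σ σ<k (suc i) (s≤s (≤-reflexive e))) , misses)
      ... | inj₂ (q , x≤q , q<N , hit , misses , e) = inj₂ (q
            , trans outer (trans (cong (λ i → μ₀ (cell (8 + k + σ) i)) (sym e))
                (pos σ σ<k (suc q) (s≤s z≤n) q<N hit))
            , x≤q , q<N , hit , misses)
      finish : Chosen μ₁ x chooseCode 19 → Chosen μ x advanceB 45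
      finish (μ′ , x′ , r , g , same , rest) = μ′ , x′
        , branch-false {P = jumpCode} (nf-5 {μ}) (test-5 core c?)
            (assigning {lit 7} {lookup} {μ} (word (lit<S 7<16)) nf-lookup (lit<S 7<16) then r)
        , g , (λ a p q → trans (same a p q) (get-other μ q)) , rest

-- Passing to the characters and labels of longer strings

occurrences-cong : ∀ {α α′ M} c → AgreeUpTo M α α′ → ∀ r → r ≤ M → occurrences α c r ≡ occurrences α′ c r
occurrences-cong c same zero    r≤M = refl
occurrences-cong c same (suc r) r≤M
  rewrite same (suc r) (s≤s z≤n) r≤M | occurrences-cong c same r (<⇒≤ r≤M) = refl

Index-cong : ∀ {k μ M α α′} → AgreeUpTo M α α′ → Index k μ M α → Index k μ M α′
Index-cong {k} {μ} {M} {α} {α′} same index = record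
  { cnt  = λ c c<k r r≤M → trans (cnt c c<k r r≤M) (occ≡ c r r≤M)
  ; pos  = λ c c<k q 1≤q q≤M α′q≡c → trans (cong (λ i → μ (cell (8 + k + c) i)) (sym (occ≡ c q q≤M)))
             (pos c c<k q 1≤q q≤M (trans (same q 1≤q q≤M) α′q≡c))
  ; free = λ c c<k i lt → free c c<k i (subst (_< i) (sym (occ≡ c M ≤-refl)) lt) }
  where
  open Layout k
  open Index index
  occ≡ : ∀ c r → r ≤ M → occurrences α c r ≡ occurrences α′ c r
  occ≡ c = occurrences-cong c same

module _ (k : ℕ) where
  open Layout k

  Next-cong : ∀ {f t t′ N x p} → AgreeUpTo N t t′ → Next f t N x p → Next f t′ N x p
  Next-cong same (inj₁ (e , zs)) = inj₁ (e , λ z x<z z≤N →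
    trans (sym (same z (≤-<-trans z≤n x<z) (s≤s⁻¹ z≤N))) (zs z x<z z≤N))
  Next-cong same (inj₂ (y , x<y , y≤N , ty≢0 , zs , e)) = inj₂ (y , x<y , y≤N
    , (λ t′y≡0 → ty≢0 (trans (same y (≤-<-trans z≤n x<y) y≤N) t′y≡0))
    , (λ z x<z z<y → trans (sym (same z (≤-<-trans z≤n x<z) (≤-trans (<⇒≤ z<y) y≤N))) (zs z x<z z<y)) , e)

  Live-cong : ∀ {t t′ N x} → AgreeUpTo N t t′ → x ≤ N → Live t x → Live t′ x
  Live-cong same x≤N (inj₁ e) = inj₁ e
  Live-cong {x = zero} same x≤N (inj₂ tx≢0) = inj₁ refl
  Live-cong {x = suc x} same x≤N (inj₂ tx≢0) = inj₂ λ e → tx≢0 (trans (same (suc x) (s≤s z≤n) x≤N) e)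

  AgreeUpTo-sym : ∀ {N t t′} → AgreeUpTo N t t′ → AgreeUpTo N t′ t
  AgreeUpTo-sym same z p q = sym (same z p q)

  Half-relabel : ∀ {f μ N t t′ β β′} → AgreeUpTo N t t′ → AgreeUpTo N β β′ → Half f μ N t β → Half f μ N t′ β′
  Half-relabel t≗ β≗ half = record
    { len = len
    ; val = λ z p q → trans (val z p q) (t≗ z p q)
    ; idx = idx
    ; chr = λ z p q → trans (chr z p q) (β≗ z p q)
    ; lnk = λ z z≤N live → Next-cong t≗ (lnk z z≤N (Live-cong (AgreeUpTo-sym t≗) z≤N live))
    ; tail = let s , s≤N , live , zs , e = tail in s , s≤N , Live-cong t≗ s≤N live
           , (λ z s<z z≤N → trans (sym (t≗ z (≤-<-trans z≤n s<z) (s≤s⁻¹ z≤N))) (zs z s<z z≤N)) , e }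
    where open Half half

-- Appending a record

module GrowingCode (k : ℕ) where

  open Code k
  open IndexCode k

  -- The old tail is saved in cell 7 before cell `10 + g` is redirected to the new record. A record
  -- with label 0 is filled in, since its character is compared in later sweeps, but it is not
  -- linked.
  hookCode nodeCode : ℕ → Program
  hookCode g = cond (eq (var 5) (lit 0)) skip
    (lit (10 + g) ≔ field′ (2 + g) (var 2) ⨾ mem (lit 7) ≔ field′ g (var 2))
  nodeCode g =
      lit 2 ≔ add (lit 1) (var (9 + g))
    ⨾ lit 7 ≔ var (10 + g)
    ⨾ lit (9 + g) ≔ var 2
    ⨾ field′ g (var 2) ≔ var 5
    ⨾ field′ (1 + g) (var 2) ≔ var 2
    ⨾ field′ (3 + g) (var 2) ≔ var 0
    ⨾ field′ (2 + g) (var 2) ≔ lit 0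
    ⨾ hookCode g

  copyCode : ℕ → Program
  copyCode zero    = skip
  copyCode (suc c) = field′ (8 + c) (var 2) ≔ mem (field′ (8 + c) (sub (var 2) (lit 1))) ⨾ copyCode c

  recordCode indexCode : Program
  recordCode =
      lit 7 ≔ add (lit 1) (mem (charField 8 (var 2)))
    ⨾ charField 8 (var 2) ≔ var 7
    ⨾ charField (8 + k) (var 7) ≔ var 2
  indexCode = copyCode k ⨾ recordCode

module Growing (k S W N̂ : ℕ) (sizes : Sizes k S W N̂) where

  open Layout k
  open Code k
  open IndexCode k
  open GrowingCode k
  open Sizes sizes
  open Machine k S W N̂ sizes

  module _ {g : ℕ} (g≤4 : g ≤ 4) {μ : Memory} {t β : ℕ → ℕ} (good : Good S μ) where

    private
      M L : ℕ
      M = μ (9 + g)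
      L = suc M

    -- `t` and `β` are the functions of the longer string, to which the old half has been relabelled
    -- beforehand. The time is 49 for seven assignments plus 21 for `hookCode`.
    appendNode : Half g μ M t β → L ≤ N̂ → μ 5 ≡ t L → μ 0 ≡ β L → ∃[ μ′ ]
      ( Reach (nodeCode g) 70 μ μ′ × Good S μ′ × Half g μ′ L t β
      × μ′ 2 ≡ L × (∀ a → a ≢ 2 → a ≢ 7 → ¬ InHalf g a → μ′ a ≡ μ a))
    appendNode half L≤N̂ e₅ e₀ = proj₁ hooked , r (proj₁ (proj₂ hooked)) , proj₂ (proj₂ hooked)
      where
      open Half half
      <stride : ∀ {j} → j < 4 → j + g < stride
      <stride j<4 = ≤-trans (+-mono-≤ j<4 g≤4) (m≤m+n 8 (k + k))
      low : ∀ {v} → v < 12 → v + g < 16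
      low v< = ≤-<-trans (+-monoʳ-≤ _ g≤4) (+-monoˡ-< 4 v<)
      j₀ : 0 < 4
      j₀ = evident
      j₁ : 1 < 4
      j₁ = evident
      j₂ : 2 < 4
      j₂ = evident
      j₃ : 3 < 4
      j₃ = evident
      lit₂ = lit<S {2} evident
      lit₇ = lit<S {7} evident
      lit₉ = lit<S (low {9} evident)
      lit₁₀ = lit<S (low {10} evident)
      L<S : L < S
      L<S = index<S L≤N̂
      at-L : ∀ {j} → j < 4 → cell (j + g) L < S
      at-L {j} j<4 = cell< (j + g) L (<stride j<4) L≤N̂

      m₁ m₂ m₃ m₄ m₅ m₆ m₇ : Memory
      m₁ = μ [ 2 ↦ L ]
      m₂ = m₁ [ 7 ↦ μ (10 + g) ]
      m₃ = m₂ [ 9 + g ↦ L ]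
      m₄ = m₃ [ cell g L ↦ μ 5 ]
      m₅ = m₄ [ cell (1 + g) L ↦ L ]
      m₆ = m₅ [ cell (3 + g) L ↦ μ 0 ]
      m₇ = m₆ [ cell (2 + g) L ↦ 0 ]

      g₁ : Good S m₁
      g₁ = Good-↦ {μ = μ} good lit₂ L<S
      g₂ : Good S m₂
      g₂ = Good-↦ {μ = m₁} g₁ lit₇ (proj₂ good (10 + g))
      g₃ : Good S m₃
      g₃ = Good-↦ {μ = m₂} g₂ lit₉ L<S
      g₄ : Good S m₄
      g₄ = Good-↦ {μ = m₃} g₃ (at-L j₀) (proj₂ good 5)
      g₅ : Good S m₅
      g₅ = Good-↦ {μ = m₄} g₄ (at-L j₁) L<S
      g₆ : Good S m₆
      g₆ = Good-↦ {μ = m₅} g₅ (at-L j₃) (proj₂ good 0)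
      g₇ : Good S m₇
      g₇ = Good-↦ {μ = m₆} g₆ (at-L j₂) (lit<S evident)

      nf-at : ∀ m {j} → m 2 ≡ L → j < 4 → NoFault S W (field′ (j + g) (var 2)) m
      nf-at m e j<4 = nf-field {e = var 2} {m} (nf-var evident) (<stride j<4) (subst (_≤ N̂) (sym e) L≤N̂)

      r : ∀ {P c μ′} → Reach P c m₇ μ′ → Reach
        (lit 2 ≔ add (lit 1) (var (9 + g)) ⨾ lit 7 ≔ var (10 + g) ⨾ lit (9 + g) ≔ var 2
        ⨾ field′ g (var 2) ≔ var 5 ⨾ field′ (1 + g) (var 2) ≔ var 2 ⨾ field′ (3 + g) (var 2) ≔ var 0
        ⨾ field′ (2 + g) (var 2) ≔ lit 0 ⨾ P) (49 + c) μ μ′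
      r next =
          assigning {lit 2} {add (lit 1) (var (9 + g))} {μ} (word lit₂)
            (word (lit<S evident) , nf-var (low {9} evident) , word L<S) lit₂
        then assigning {lit 7} {var (10 + g)} {m₁} (word lit₇) (nf-var (low {10} evident)) lit₇
        then assigning {lit (9 + g)} {var 2} {m₂} (word lit₉) (nf-var evident) lit₉
        then assigning {field′ g (var 2)} {var 5} {m₃} (nf-at m₃ refl j₀) (nf-var evident) (at-L j₀)
        then assigning {field′ (1 + g) (var 2)} {var 2} {m₄} (nf-at m₄ refl j₁) (nf-var evident) (at-L j₁)
        then assigning {field′ (3 + g) (var 2)} {var 0} {m₅} (nf-at m₅ refl j₃) (nf-var evident) (at-L j₃)
        then assigning {field′ (2 + g) (var 2)} {lit 0} {m₆} (nf-at m₆ refl j₂) 0<W (at-L j₂)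
        then next

      differ : ∀ {i j z z′} → i < 4 → j < 4 → i ≢ j ⊎ z ≢ z′ → cell (i + g) z ≢ cell (j + g) z′
      differ {i} {j} {z} {z′} i<4 j<4 d e
        with p , q ← cell-injective {z = z} {z′} (<stride i<4) (<stride j<4) e with d
      ... | inj₁ i≢j = i≢j (+-cancelʳ-≡ g i j p)
      ... | inj₂ z≢  = z≢ q

      cell≢low : ∀ h z {v} → v < 12 → cell h z ≢ v + g
      cell≢low h z v< e = <⇒≱ (low v<) (subst (16 ≤_) e (m≤m+n 16 _))

      same₇ : ∀ a → a ≢ 2 → a ≢ 7 → a ≢ 9 + g → (∀ {j} → j < 4 → a ≢ cell (j + g) L) → m₇ a ≡ μ a
      same₇ a a≢2 a≢7 a≢9 a≢ = trans (get-other m₆ (a≢ j₂)) (trans (get-other m₅ (a≢ j₃))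
        (trans (get-other m₄ (a≢ j₁)) (trans (get-other m₃ (a≢ j₀))
        (trans (get-other m₂ a≢9) (trans (get-other m₁ a≢7) (get-other μ a≢2))))))

      old₇ : ∀ {j z} → j < 4 → z ≤ M → m₇ (cell (j + g) z) ≡ μ (cell (j + g) z)
      old₇ {j} {z} j<4 z≤M = same₇ (cell (j + g) z) (λ ()) (λ ()) (cell≢low (j + g) z evident)
        λ i<4 → differ j<4 i<4 (inj₂ (<⇒≢ (s≤s z≤M)))

      val₇ : m₇ (cell g L) ≡ t L
      val₇ = trans (get-other m₆ (differ {0} {2} {L} {L} j₀ j₂ (inj₁ λ ())))
        (trans (get-other m₅ (differ {0} {3} {L} {L} j₀ j₃ (inj₁ λ ())))
        (trans (get-other m₄ (differ {0} {1} {L} {L} j₀ j₁ (inj₁ λ ())))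
        (trans (get-same m₃ (cell g L) (μ 5)) e₅)))

      idx₇ : m₇ (cell (1 + g) L) ≡ L
      idx₇ = trans (get-other m₆ (differ {1} {2} {L} {L} j₁ j₂ (inj₁ λ ())))
        (trans (get-other m₅ (differ {1} {3} {L} {L} j₁ j₃ (inj₁ λ ())))
               (get-same m₄ (cell (1 + g) L) L))

      chr₇ : m₇ (cell (3 + g) L) ≡ β L
      chr₇ = trans (get-other m₆ (differ {3} {2} {L} {L} j₃ j₂ (inj₁ λ ())))
        (trans (get-same m₅ (cell (3 + g) L) (μ 0)) e₀)

      lnk₇ : m₇ (cell (2 + g) L) ≡ 0
      lnk₇ = get-same m₆ (cell (2 + g) L) 0

      low₇ : ∀ {v} → v < 12 → 7 < v → v ≢ 9 → m₇ (v + g) ≡ μ (v + g)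
      low₇ {v} v< 7<v v≢9 = same₇ (v + g) (λ e → <⇒≢ (≤-trans evident (m≤n⇒m≤n+o g 7<v)) (sym e))
        (λ e → <⇒≢ (m≤n⇒m≤n+o g 7<v) (sym e)) (λ e → v≢9 (+-cancelʳ-≡ g v 9 e))
        λ {j} _ e → cell≢low (j + g) L v< (sym e)

      len₇ : m₇ (9 + g) ≡ L
      len₇ = trans (get-other m₆ (λ e → cell≢low (2 + g) L {9} evident (sym e)))
        (trans (get-other m₅ (λ e → cell≢low (3 + g) L {9} evident (sym e)))
        (trans (get-other m₄ (λ e → cell≢low (1 + g) L {9} evident (sym e)))
        (trans (get-other m₃ (λ e → cell≢low g L {9} evident (sym e)))
               (get-same m₂ (9 + g) L))))

      upTo : ∀ {m h : ℕ → ℕ} → (∀ z → 1 ≤ z → z ≤ M → m z ≡ h z) → m L ≡ h L → ∀ z → 1 ≤ z → z ≤ L → m z ≡ h z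
      upTo below at-top z 1≤z z≤L with m≤n⇒m<n∨m≡n z≤L
      ... | inj₁ z<L  = below z 1≤z (s≤s⁻¹ z<L)
      ... | inj₂ refl = at-top

      val′ : ∀ z → 1 ≤ z → z ≤ L → m₇ (cell g z) ≡ t z
      val′ = upTo {λ z → m₇ (cell g z)} {t} (λ z p q → trans (old₇ j₀ q) (val z p q)) val₇
      idx′ : ∀ z → 1 ≤ z → z ≤ L → m₇ (cell (1 + g) z) ≡ z
      idx′ = upTo {λ z → m₇ (cell (1 + g) z)} {λ z → z} (λ z p q → trans (old₇ j₁ q) (idx z p q)) idx₇
      chr′ : ∀ z → 1 ≤ z → z ≤ L → m₇ (cell (3 + g) z) ≡ β z
      chr′ = upTo {λ z → m₇ (cell (3 + g) z)} {β} (λ z p q → trans (old₇ j₃ q) (chr z p q)) chr₇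

      same-outside : ∀ a → a ≢ 2 → a ≢ 7 → ¬ InHalf g a → m₇ a ≡ μ a
      same-outside a a≢2 a≢7 ¬in = same₇ a a≢2 a≢7 (λ e → ¬in (inj₁ e))
        λ {j} j<4 e → ¬in (inj₂ (inj₂ (j , L , j<4 , e)))

      Hooked : Set
      Hooked = ∃[ μ′ ] (Reach (hookCode g) 21 m₇ μ′ × Good S μ′ × Half g μ′ L t β
        × μ′ 2 ≡ L × (∀ a → a ≢ 2 → a ≢ 7 → ¬ InHalf g a → μ′ a ≡ μ a))

      nf₅ : ∀ {m} → NoFaultᵗ S W (eq (var 5) (lit 0)) m
      nf₅ = nf-var evident , 0<W

      unhooked : t L ≡ 0 → Hooked
      unhooked tL≡0 = m₇ , weaken evident (branch-true (nf₅ {m₇}) (cong (_≡ᵇ 0) (trans e₅ tL≡0)) skipping)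
        , g₇
        , record { len = len₇ ; val = val′ ; idx = idx′ ; chr = chr′ ; lnk = lnk′
                 ; tail = let s , s≤M , live , zs , e = tail in
                     s , m≤n⇒m≤1+n s≤M , live , extend zs , trans (low₇ evident evident λ ()) e }
        , refl , same-outside
        where
        extend : ∀ {x} → Zeros t x (suc M) → Zeros t x (suc L)
        extend zs z x<z z≤L with m≤n⇒m<n∨m≡n (s≤s⁻¹ z≤L)
        ... | inj₁ z<L  = zs z x<z z<L
        ... | inj₂ refl = tL≡0
        widen : ∀ {x p} → Next g t M x p → Next g t L x p
        widen (inj₁ (e , zs)) = inj₁ (e , extend zs)
        widen (inj₂ (y , x<y , y≤M , rest)) = inj₂ (y , x<y , m≤n⇒m≤1+n y≤M , rest)
        lnk′ : ∀ z → z ≤ L → Live t z → Next g t L z (m₇ (cell (2 + g) z))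
        lnk′ z z≤L live with m≤n⇒m<n∨m≡n z≤L
        ... | inj₁ z<L = subst (Next g t L z) (sym (old₇ j₂ (s≤s⁻¹ z<L))) (widen (lnk z (s≤s⁻¹ z<L) live))
        lnk′ z z≤L (inj₂ tz≢0) | inj₂ refl = contradiction tL≡0 tz≢0

      joined : t L ≢ 0 → Hooked
      joined tL≢0 with tail
      ... | s , s≤M , s-live , zs , e = m₉
        , branch-false (nf₅ {m₇}) (trans (cong (_≡ᵇ 0) e₅) (≢⇒≡ᵇ-false tL≢0))
            (assigning {lit (10 + g)} {field′ (2 + g) (var 2)} {m₇} (word lit₁₀) (nf-at m₇ refl j₂) lit₁₀
             then assigning {var 7} {field′ g (var 2)} {m₈} (nf-var evident) (nf-at m₈ refl j₀)
                 (proj₂ good (10 + g)))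
        , Good-↦ {μ = m₈} (Good-↦ {μ = m₇} g₇ lit₁₀ (at-L j₂)) (proj₂ good (10 + g)) (at-L j₀)
        , record
          { len = trans (same₉ (9 + g) (λ e → cell≢low (2 + g) s evident (sym e)) (<⇒≢ ≤-refl)) len₇
          ; val = λ z p q → trans (field₉ j₀ z (inj₁ λ ())) (val′ z p q)
          ; idx = λ z p q → trans (field₉ j₁ z (inj₁ λ ())) (idx′ z p q)
          ; chr = λ z p q → trans (field₉ j₃ z (inj₁ λ ())) (chr′ z p q)
          ; lnk = lnk′
          ; tail = L , ≤-refl , inj₂ tL≢0 , (λ z L<z z≤L → contradiction L<z (≤⇒≯ (s≤s⁻¹ z≤L)))
                 , trans (get-other m₈ λ e′ → cell≢low (2 + g) s {10} evident (sym (trans e′ e)))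
                     (get-same m₇ (10 + g) (cell (2 + g) L)) }
        , trans (same₉ 2 (λ ()) (λ ())) refl
        , λ a p q ¬in → trans (same₉ a (λ e → ¬in (inj₂ (inj₂ (2 , s , j₂ , e)))) (λ e → ¬in (inj₂ (inj₁ e))))
                          (same-outside a p q ¬in)
        where
        m₈ = m₇ [ 10 + g ↦ cell (2 + g) L ]
        m₉ = m₈ [ μ (10 + g) ↦ cell g L ]
        same₉ : ∀ a → a ≢ cell (2 + g) s → a ≢ 10 + g → m₉ a ≡ m₇ a
        same₉ a p q = trans (get-other m₈ λ e′ → p (trans e′ e)) (get-other m₇ q)
        field₉ : ∀ {j} → j < 4 → ∀ z → j ≢ 2 ⊎ z ≢ s → m₉ (cell (j + g) z) ≡ m₇ (cell (j + g) z)
        field₉ {j} j<4 z d = same₉ (cell (j + g) z) (differ j<4 j₂ d) (cell≢low (j + g) z evident)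
        -- Among live positions only the tail has a null link: one before `s` has `s` ahead of it,
        -- and none comes after `s`. So every other link stays right when the range grows.
        widen : ∀ z {p} → z ≤ M → z ≢ s → Live t z → Next g t M z p → Next g t L z p
        widen z z≤M z≢s live (inj₂ (y , z<y , y≤M , rest)) = inj₂ (y , z<y , m≤n⇒m≤1+n y≤M , rest)
        widen z z≤M z≢s live (inj₁ (_ , zs′)) with <-cmp z s
        ... | tri≈ _ z≡s _ = contradiction z≡s z≢s
        widen z z≤M z≢s (inj₁ refl) (inj₁ (_ , zs′)) | tri> _ _ ()
        widen z z≤M z≢s (inj₂ tz≢0) (inj₁ (e , zs′)) | tri> _ _ s<z =
          contradiction (zs z s<z (s≤s z≤M)) tz≢0
        widen z z≤M z≢s live (inj₁ (_ , zs′)) | tri< z<tl _ _ =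
          contradiction (zs′ s z<tl (s≤s s≤M)) (nonzero s-live z<tl)
          where
          nonzero : ∀ {z} → Live t s → z < s → t s ≢ 0
          nonzero (inj₂ ts≢0) _ = ts≢0
          nonzero (inj₁ refl) ()
        lnk′ : ∀ z → z ≤ L → Live t z → Next g t L z (m₉ (cell (2 + g) z))
        lnk′ z z≤L live with m≤n⇒m<n∨m≡n z≤L | z ≟ s
        ... | inj₁ z<L | no z≢s = subst (Next g t L z)
            (sym (trans (field₉ j₂ z (inj₂ z≢s)) (old₇ j₂ (s≤s⁻¹ z<L))))
                (widen z (s≤s⁻¹ z<L) z≢s live (lnk z (s≤s⁻¹ z<L) live))
        ... | inj₁ z<L | yes refl = inj₂ (L , s≤s s≤M , ≤-refl , tL≢0 , zs
                , trans (cong (λ a → (m₈ [ a ↦ cell g L ]) (cell (2 + g) s)) e)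
                    (get-same m₈ (cell (2 + g) s) (cell g L)))
        ... | inj₂ refl | _ = inj₁ (trans (field₉ j₂ L (inj₂ (≢-sym (<⇒≢ (s≤s s≤M))))) lnk₇
                , λ z L<z z≤L → contradiction L<z (≤⇒≯ (s≤s⁻¹ z≤L)))

      hooked : Hooked
      hooked with t L ≟ 0
      ... | yes e = unhooked e
      ... | no ne = joined ne

-- Extending the table of occurrences

module Indexing (k S W N̂ : ℕ) (sizes : Sizes k S W N̂) where

  open Layout k
  open Code k
  open IndexCode k
  open GrowingCode k
  open Sizes sizes
  open Machine k S W N̂ sizes

  -- The counts of all `k` characters move on to the new position at 16 time units each;
  -- `recordCode` then corrects the one of the new character.
  copy : ∀ c → c ≤ k → ∀ {μ M} → Good S μ → μ 2 ≡ suc M → suc M ≤ N̂ → ∃[ μ′ ]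
    ( Reach (copyCode c) (c * 16 + 1) μ μ′ × Good S μ′
    × (∀ d → d < c → μ′ (cell (8 + d) (suc M)) ≡ μ (cell (8 + d) M))
    × (∀ a → (∀ d → d < c → a ≢ cell (8 + d) (suc M)) → μ′ a ≡ μ a))
  copy zero c≤k {μ} good e₂ M<N̂ = μ , skipping , good , (λ d ()) , λ _ _ → refl
  copy (suc c) c<k {μ} {M} good e₂ M<N̂ =
    let μ′ , r , g , copied , same = copy c (<⇒≤ c<k) {μ₁} good₁ e₂ M<N̂ in
    μ′ , (assigning {target} {source} {μ} nf-target nf-source target<S then r) , g
       , extend μ′ copied same
       , λ a a≢ → trans (same a λ d d<c → a≢ d (m≤n⇒m≤1+n d<c))
           (get-other μ λ e → a≢ c ≤-refl (trans e target≡))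
    where
    target = field′ (8 + c) (var 2)
    source = mem (field′ (8 + c) (sub (var 2) (lit 1)))
    c₈ = 8+<stride c<k
    target≡ : ⟦ target ⟧ μ ≡ cell (8 + c) (suc M)
    target≡ = cong (cell (8 + c)) e₂
    source≡ : ⟦ source ⟧ μ ≡ μ (cell (8 + c) M)
    source≡ = cong (λ z → μ (cell (8 + c) (z ∸ 1))) e₂
    target<S : ⟦ target ⟧ μ < S
    target<S = subst (_< S) (sym target≡) (cell< (8 + c) (suc M) c₈ M<N̂)
    μ₁ = μ [ ⟦ target ⟧ μ ↦ ⟦ source ⟧ μ ]
    good₁ : Good S μ₁
    good₁ = Good-↦ {μ = μ} good target<S (proj₂ good _)
    nf-target : NoFault S W target μ
    nf-target = nf-field {e = var 2} {μ} (nf-var evident) c₈ (subst (_≤ N̂) (sym e₂) M<N̂)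
    M≤N̂ : μ 2 ∸ 1 ≤ N̂
    M≤N̂ = subst (λ z → z ∸ 1 ≤ N̂) (sym e₂) (<⇒≤ M<N̂)
    nf-source : NoFault S W source μ
    nf-source = nf-field {e = sub (var 2) (lit 1)} {μ} (nf-var evident , word (lit<S evident)) c₈ M≤N̂
              , cell< (8 + c) (μ 2 ∸ 1) c₈ M≤N̂
    apart : ∀ {d} → d < c → cell (8 + c) (suc M) ≢ cell (8 + d) (suc M)
    apart d<c e = <⇒≢ d<c (sym (+-cancelˡ-≡ 8 c _
      (proj₁ (cell-injective {z = suc M} {suc M} c₈ (8+<stride (<-trans d<c c<k)) e))))
    below : ∀ {d} → d ≤ c → cell (8 + d) M ≢ ⟦ target ⟧ μ
    below {d} d≤c e = <⇒≢ ≤-refl (proj₂ (cell-injective {z = M} {suc M} (8+<stride (≤-<-trans d≤c c<k)) c₈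
        (trans e target≡)))
    extend : ∀ μ′ → (∀ d → d < c → μ′ (cell (8 + d) (suc M)) ≡ μ₁ (cell (8 + d) M)) →
      (∀ a → (∀ d → d < c → a ≢ cell (8 + d) (suc M)) → μ′ a ≡ μ₁ a) →
      ∀ d → d < suc c → μ′ (cell (8 + d) (suc M)) ≡ μ (cell (8 + d) M)
    extend μ′ copied same d d<sc with m≤n⇒m<n∨m≡n (s≤s⁻¹ d<sc)
    ... | inj₁ d<c  = trans (copied d d<c) (get-other μ (below (<⇒≤ d<c)))
    ... | inj₂ refl = trans (same (cell (8 + c) (suc M)) λ d d<c → apart d<c)
      (trans (cong (λ a → (μ [ a ↦ ⟦ source ⟧ μ ]) (cell (8 + c) (suc M))) target≡)
        (trans (get-same μ (cell (8 + c) (suc M)) (⟦ source ⟧ μ)) source≡))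

  updateIndex : ∀ {μ M α σ} → Good S μ → μ 2 ≡ suc M → suc M ≤ N̂ → μ 0 ≡ σ → σ < k → α (suc M) ≡ σ →
    Index k μ M α → ∃[ μ′ ]
    ( Reach indexCode (k * 16 + 1 + 38) μ μ′ × Good S μ′ × Index k μ′ (suc M) α
    × (∀ a → a ≢ 7 → (∀ g z → 8 ≤ g → g < stride → a ≢ cell g z) → μ′ a ≡ μ a))
  updateIndex {μ} {M} {α} {σ} good e₂ M<N̂ e₀ σ<k αL index with copy k ≤-refl {μ} good e₂ M<N̂
  ... | μ₁ , r₁ , g₁ , copied , same₁ = μ₄ , (r₁ then r₂)
      , Good-↦ {μ = μ₃} g₃ pos<S (proj₂ g₃ 2)
      , record { cnt = cnt′ ; pos = pos′ ; free = free′ }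
      , λ a a≢7 a≢ → trans (get-other μ₃ λ e → a≢ (8 + k + σ) i (m≤m+n 8 _) c₈ₖ (trans e pos≡))
          (trans (get-other μ₂ λ e → a≢ (8 + σ) L (m≤m+n 8 _) c₈ (trans e cnt≡))
          (trans (get-other μ₁ a≢7) (same₁ a λ d d<k → a≢ (8 + d) L (m≤m+n 8 _) (8+<stride d<k))))
      where
      open Index index
      L = suc M
      i = suc (occurrences α σ M)
      c₈ = 8+<stride σ<k
      c₈ₖ = 8+k+<stride σ<k
      e₂′ : μ₁ 2 ≡ L
      e₂′ = trans (same₁ 2 λ _ _ ()) e₂
      e₀′ : μ₁ 0 ≡ σ
      e₀′ = trans (same₁ 0 λ _ _ ()) e₀
      counter : Expr
      counter = charField 8 (var 2)
      n≡ : μ₁ (⟦ counter ⟧ μ₁) ≡ occurrences α σ M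
      n≡ = trans (cong₂ (λ c z → μ₁ (cell (8 + c) z)) e₀′ e₂′) (trans (copied σ σ<k) (cnt σ σ<k M ≤-refl))
      μ₂ = μ₁ [ 7 ↦ suc (μ₁ (⟦ counter ⟧ μ₁)) ]
      μ₃ = μ₂ [ cell (8 + μ₁ 0) (μ₁ 2) ↦ μ₂ 7 ]
      μ₄ = μ₃ [ cell (8 + k + μ₁ 0) (μ₂ 7) ↦ μ₁ 2 ]
      cnt≡ : cell (8 + μ₁ 0) (μ₁ 2) ≡ cell (8 + σ) L
      cnt≡ = cong₂ (λ c z → cell (8 + c) z) e₀′ e₂′
      pos≡ : cell (8 + k + μ₁ 0) (μ₂ 7) ≡ cell (8 + k + σ) i
      pos≡ = cong₂ (λ c z → cell (8 + k + c) z) e₀′ (cong suc n≡)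
      i≤N̂ : i ≤ N̂
      i≤N̂ = ≤-trans (s≤s (occurrences≤ α σ M)) M<N̂
      lit₇ = lit<S {7} evident
      n<S : suc (μ₁ (⟦ counter ⟧ μ₁)) < S
      n<S = subst (λ n → suc n < S) (sym n≡) (index<S i≤N̂)
      cnt<S : cell (8 + μ₁ 0) (μ₁ 2) < S
      cnt<S = subst (_< S) (sym cnt≡) (cell< (8 + σ) L c₈ M<N̂)
      pos<S : cell (8 + k + μ₁ 0) (μ₂ 7) < S
      pos<S = subst (_< S) (sym pos≡) (cell< (8 + k + σ) i c₈ₖ i≤N̂)
      g₂ : Good S μ₂
      g₂ = Good-↦ {μ = μ₁} g₁ lit₇ n<S
      g₃ : Good S μ₃
      g₃ = Good-↦ {μ = μ₂} g₂ cnt<S n<S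
      nf-char : ∀ g e z m → m 0 ≡ σ → NoFault S W e m → ⟦ e ⟧ m ≡ z → g + σ < stride → z ≤ N̂ →
        NoFault S W (charField g e) m
      nf-char g e z m e₀ nf refl g< z≤ rewrite e₀ =
          (word (field<S (≤-<-trans (m≤m+n g σ) g<)) , nf-var (s≤s z≤n) , word (field<S g<))
        , (nf , word stride<S , word (≤-<-trans (m≤n+m _ (16 + (g + σ))) (cell< (g + σ) z g< z≤)))
        , word (cell< (g + σ) z g< z≤)
      r₂ : Reach recordCode 38 μ₁ μ₄
      r₂ = assigning {lit 7} {add (lit 1) (mem counter)} {μ₁} (word lit₇)
             (word (lit<S evident)
             , (nf-char 8 (var 2) L μ₁ e₀′ (nf-var evident) e₂′ c₈ M<N̂ , cnt<S) , word n<S) lit₇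
           then assigning {counter} {var 7} {μ₂} (nf-char 8 (var 2) L μ₂ e₀′ (nf-var evident) e₂′ c₈ M<N̂)
             (nf-var evident) cnt<S
           then assigning {charField (8 + k) (var 7)} {var 2} {μ₃}
             (nf-char (8 + k) (var 7) i μ₃ e₀′ (nf-var evident) (cong suc n≡) c₈ₖ i≤N̂)
             (nf-var evident) pos<S

      countField≢ : ∀ {c z} → c < k → cell (8 + c) z ≢ cell (8 + k + σ) i
      countField≢ {c} {z} c<k e with proj₁ (cell-injective {z = z} {i} (8+<stride c<k) c₈ₖ e)
      ... | e′ = <⇒≢ (≤-trans c<k (m≤m+n k σ)) (+-cancelˡ-≡ 8 c (k + σ) e′)

      posField≢ : ∀ {c d z z′} → c < k → d < k → cell (8 + k + c) z ≢ cell (8 + d) z′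
      posField≢ {c} {d} {z} {z′} c<k d<k e with proj₁
          (cell-injective {z = z} {z′} (8+k+<stride c<k) (8+<stride d<k) e)
      ... | e′ = <⇒≢ (≤-trans d<k (m≤m+n k c)) (sym (+-cancelˡ-≡ 8 (k + c) d e′))

      cnt₃ : ∀ {c z} → c < k → c ≢ σ ⊎ z ≢ L → μ₄ (cell (8 + c) z) ≡ μ₁ (cell (8 + c) z)
      cnt₃ {c} {z} c<k d = trans (get-other μ₃ λ e → countField≢ {c} {z} c<k (trans e pos≡))
          (get-other μ₂ λ e → apart d (trans e cnt≡))
        where
        apart : c ≢ σ ⊎ z ≢ L → cell (8 + c) z ≢ cell (8 + σ) L
        apart d e with d | cell-injective {z = z} {L} (8+<stride c<k) c₈ e
        ... | inj₁ c≢σ | p , _ = c≢σ (+-cancelˡ-≡ 8 c σ p)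
        ... | inj₂ z≢L | _ , q = z≢L q

      pos₄ : ∀ {c z} → c < k → c ≢ σ ⊎ z ≢ i → μ₄ (cell (8 + k + c) z) ≡ μ (cell (8 + k + c) z)
      pos₄ {c} {z} c<k d = trans (get-other μ₃ λ e → apart d (trans e pos≡))
        (trans (get-other μ₂ λ e → posField≢ {c} {σ} {z} {L} c<k σ<k (trans e cnt≡))
               (same₁ (cell (8 + k + c) z) λ d d<k → posField≢ {c} {d} {z} {L} c<k d<k))
        where
        apart : c ≢ σ ⊎ z ≢ i → cell (8 + k + c) z ≢ cell (8 + k + σ) i
        apart d e with d | cell-injective {z = z} {i} (8+k+<stride c<k) c₈ₖ e
        ... | inj₁ c≢σ | p , _ = c≢σ (+-cancelˡ-≡ (8 + k) c σ p)
        ... | inj₂ z≢i | _ , q = z≢i q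

      occ-L : ∀ c → c ≢ σ → occurrences α c L ≡ occurrences α c M
      occ-L c c≢σ = occurrences-miss α M λ e → c≢σ (trans (sym e) αL)

      occ-σ : occurrences α σ L ≡ i
      occ-σ = occurrences-hit α M αL

      cnt′ : ∀ c → c < k → ∀ r → r ≤ L → μ₄ (cell (8 + c) r) ≡ occurrences α c r
      cnt′ c c<k r r≤L with m≤n⇒m<n∨m≡n r≤L | c ≟ σ
      ... | inj₁ r<L  | _ = trans (cnt₃ c<k (inj₂ (<⇒≢ r<L)))
            (trans (same₁ (cell (8 + c) r) λ d d<k e → <⇒≢ r<L
                (proj₂ (cell-injective {z = r} {L} (8+<stride c<k) (8+<stride d<k) e)))
                   (cnt c c<k r (s≤s⁻¹ r<L)))
      ... | inj₂ refl | no c≢σ = trans (cnt₃ {c} {L} c<k (inj₁ c≢σ))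
          (trans (copied c c<k) (trans (cnt c c<k M ≤-refl) (sym (occ-L c c≢σ))))
      ... | inj₂ refl | yes refl = trans (get-other μ₃ λ e → countField≢ {c} {L} c<k (trans e pos≡))
            (trans (cong (λ a → (μ₂ [ a ↦ μ₂ 7 ]) (cell (8 + c) L)) cnt≡)
            (trans (get-same μ₂ (cell (8 + c) L) (μ₂ 7)) (trans (cong suc n≡) (sym occ-σ))))

      pos′ : ∀ c → c < k → ∀ q → 1 ≤ q → q ≤ L → α q ≡ c → μ₄ (cell (8 + k + c) (occurrences α c q)) ≡ q
      pos′ c c<k q 1≤q q≤L αq with m≤n⇒m<n∨m≡n q≤L
      ... | inj₁ q<L  = trans (pos₄ {c} {occurrences α c q} c<k (different (c ≟ σ)))
          (pos c c<k q 1≤q (s≤s⁻¹ q<L) αq)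
        where
        different : Dec (c ≡ σ) → c ≢ σ ⊎ occurrences α c q ≢ i
        different (no c≢σ)   = inj₁ c≢σ
        -- An earlier occurrence of the new character has a number below `i`, so its entry is not
        -- the one just written.
        different (yes refl) = inj₂ (<⇒≢ (s≤s (occurrences-mono α c (s≤s⁻¹ q<L))))
      ... | inj₂ refl with refl ← trans (sym αq) αL =
        trans (cong (λ n → μ₄ (cell (8 + k + c) n)) occ-σ)
          (trans (cong (λ a → (μ₃ [ a ↦ μ₁ 2 ]) (cell (8 + k + c) i)) pos≡)
            (trans (get-same μ₃ (cell (8 + k + c) i) (μ₁ 2)) e₂′))

      free′ : ∀ c → c < k → ∀ j → occurrences α c L < j → μ₄ (cell (8 + k + c) j) ≡ 0
      free′ c c<k j n<j with c ≟ σ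
      ... | no c≢σ   = trans (pos₄ {c} {j} c<k (inj₁ c≢σ)) (free c c<k j (subst (_< j) (occ-L c c≢σ) n<j))
      ... | yes refl = trans (pos₄ {c} {j} c<k (inj₂ (≢-sym (<⇒≢ i<j))))
          (free c c<k j (<-trans (n<1+n (occurrences α c M)) i<j))
        where
        i<j : i < j
        i<j = subst (_< j) occ-σ n<j

-- Correctness of the two updates

swaps-sym : ∀ x y c r → swaps x y c r ≡ swaps y x c r
swaps-sym x y c r = cong (_∨ (c <ᵇ r)) (≡ᵇ-sym x y)

cell-across : ∀ {x x′ y y′ c c′ r r′} → x ≡ x′ → y ≡ y′ → c ≡ c′ → r ≡ r′ →
  (if swaps x y c r then c else r) ≡ (if swaps x′ y′ c′ r′ then c′ else r′)
cell-across refl refl refl refl = refl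

cell-down : ∀ {x x′ y y′ c c′ r r′} → x ≡ x′ → y ≡ y′ → c ≡ c′ → r ≡ r′ →
  (if swaps x y c r then r else c) ≡ (if swaps x′ y′ c′ r′ then r′ else c′)
cell-down refl refl refl refl = refl

module Disjoint (k : ℕ) where
  open Layout k

  IndexCell : ℕ → Set
  IndexCell a = ∃[ g ] ∃[ z ] (8 ≤ g × g < stride × a ≡ cell g z)

  inHalf>7 : ∀ {f a} → InHalf f a → 7 < a
  inHalf>7 (inj₁ refl)                         = m≤m+n 8 _
  inHalf>7 (inj₂ (inj₁ refl))                  = m≤m+n 8 _
  inHalf>7 (inj₂ (inj₂ (_ , _ , _ , refl)))    = m≤m+n 8 _

  halves-disjoint : ∀ {a} → InHalf 0 a → ¬ InHalf 4 a
  halves-disjoint (inj₁ refl) (inj₁ ())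
  halves-disjoint (inj₁ refl) (inj₂ (inj₁ ()))
  halves-disjoint (inj₁ refl) (inj₂ (inj₂ (_ , _ , _ , ())))
  halves-disjoint (inj₂ (inj₁ refl)) (inj₁ ())
  halves-disjoint (inj₂ (inj₁ refl)) (inj₂ (inj₁ ()))
  halves-disjoint (inj₂ (inj₁ refl)) (inj₂ (inj₂ (_ , _ , _ , ())))
  halves-disjoint (inj₂ (inj₂ (_ , _ , _ , refl))) (inj₁ ())
  halves-disjoint (inj₂ (inj₂ (_ , _ , _ , refl))) (inj₂ (inj₁ ()))
  halves-disjoint (inj₂ (inj₂ (g , z , g<4 , refl))) (inj₂ (inj₂ (g′ , z′ , g′<4 , e))) =
    <⇒≱ g<4 (subst (4 ≤_) (trans (sym g≡) (+-identityʳ g)) (m≤n+m 4 g′))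
    where
    g≡ : g + 0 ≡ g′ + 4
    g≡ = proj₁ (cell-injective {z = z} {z′}
      (≤-trans (subst (_< 4) (sym (+-identityʳ g)) g<4) (m≤m+n 4 (4 + (k + k))))
      (≤-trans (+-monoˡ-≤ 4 g′<4) (m≤m+n 8 (k + k))) e)

  index-outside : ∀ {f a} → f ≤ 4 → IndexCell a → ¬ InHalf f a
  index-outside f≤4 (g , z , 8≤g , g< , refl) (inj₁ e) =
    <⇒≱ (≤-<-trans (+-monoʳ-≤ 9 f≤4) evident) (subst (16 ≤_) e (m≤m+n 16 _))
  index-outside f≤4 (g , z , 8≤g , g< , refl) (inj₂ (inj₁ e)) =
    <⇒≱ (≤-<-trans (+-monoʳ-≤ 10 f≤4) evident) (subst (16 ≤_) e (m≤m+n 16 _))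
  index-outside {f} f≤4 (g , z , 8≤g , g< , refl) (inj₂ (inj₂ (j , z′ , j<4 , e))) =
    <⇒≱ (+-mono-≤ j<4 f≤4) (subst (8 ≤_) (proj₁ (cell-injective {z = z} {z′} g<
      (≤-trans (+-mono-≤ j<4 f≤4) (m≤m+n 8 (k + k))) e)) 8≤g)

  index>7 : ∀ {a} → IndexCell a → 7 < a
  index>7 (_ , _ , _ , _ , refl) = m≤m+n 8 _

  Index-frame : ∀ {μ μ′ M α} → Index k μ M α → (∀ a → IndexCell a → μ′ a ≡ μ a) → Index k μ′ M α
  Index-frame {α = α} index same = record
    { cnt  = λ c c<k r r≤M → trans (same _ (8 + c , r , m≤m+n 8 c , 8+<stride c<k , refl)) (cnt c c<k r r≤M)
    ; pos  = λ c c<k q 1≤q q≤M e → trans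
        (same _ (8 + k + c , occurrences α c q , m≤m+n 8 (k + c) , 8+k+<stride c<k , refl))
               (pos c c<k q 1≤q q≤M e)
    ; free = λ c c<k i i> → trans (same _ (8 + k + c , i , m≤m+n 8 (k + c) , 8+k+<stride c<k , refl))
        (free c c<k i i>) }
    where
    open Index index
    open IndexCode k

-- Phrased for character functions and an arbitrary `S`, so that the old representation can be
-- viewed within the larger memory of the longer string before the update runs.
record Rep (k S : ℕ) (μ : Memory) (m n : ℕ) (α β : ℕ → ℕ) : Set where
  open Layout k
  field
    good    : Good S μ
    columns : Half 0 μ n (λ z → down α β z m) β
    rows    : Half 4 μ m (across α β n) α
    -- Only `A` is searched for occurrences; in a new row the next active column follows from the
    -- labels alone.
    index   : Index k μ m α

belowTest aboveTest : Test
belowTest = lt (var 6) (var 5)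
aboveTest = lt (var 5) (var 6)

module Appending (k : ℕ) where
  open Layout k
  open Code k
  open IndexCode k
  open GrowingCode k
  open Disjoint k

  -- A sweep over one half leaves in cell 5 the label of the new record of the other half, where
  -- `nodeCode` expects it; `nodeCode` in turn leaves the new position in cell 2 for `indexCode`.
  appendACode appendBCode : Program
  appendACode = sweepCode 0 belowTest advanceA (lit 0) ⨾ nodeCode 4 ⨾ indexCode
  appendBCode = sweepCode 4 aboveTest advanceB (add (lit 1) (var 9)) ⨾ nodeCode 0

  -- `x` is the number of pivots before the update. An iteration takes 92 = 81 + 11 or 126 = 81 + 45
  -- time units, where 11 and 45 bound the advance.
  costA costB : ℕ → ℕ
  costA x = 22 + (11 + (5 + (2 * x + 1) * 92 + 8)) + (70 + (k * 16 + 1 + 38))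
  costB x = 22 + (45 + (5 + (2 * x + 1) * 126 + 8)) + 70

  module _ {S W N̂ : ℕ} (sizes : Sizes k S W N̂) {μ : Memory} {m n : ℕ} {α β : ℕ → ℕ} (rep : Rep k S μ m n α β)
    (σ : ℕ) (σ<k : σ < k) where

    open Sizes sizes
    open Machine k S W N̂ sizes
    open Rep rep

    private
      μ₀ : Memory
      μ₀ = μ [ 0 ↦ σ ]

      good₀ : Good S μ₀
      good₀ = Good-↦ {μ = μ} good (lit<S evident)
        (<-trans (≤-trans σ<k (≤-trans (m≤m+n k k) (m≤n+m (k + k) 8))) stride<S)

      same₀ : ∀ {a} → 7 < a → μ₀ a ≡ μ a
      same₀ 7<a = get-other μ λ { refl → contradiction 7<a λ () }

      columns₀ : Half 0 μ₀ n (λ z → down α β z m) β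
      columns₀ = Half-cong columns λ a a∈ → same₀ (inHalf>7 a∈)
      rows₀ : Half 4 μ₀ m (across α β n) α
      rows₀ = Half-cong rows λ a a∈ → same₀ (inHalf>7 a∈)
      index₀ : Index k μ₀ m α
      index₀ = Index-frame index λ a a∈ → same₀ (index>7 a∈)

      7<⇒≢2 : ∀ {a} → 7 < a → a ≢ 2
      7<⇒≢2 7<a refl = contradiction 7<a (≤⇒≯ evident)
      7<⇒≢7 : ∀ {a} → 7 < a → a ≢ 7
      7<⇒≢7 7<a refl = contradiction 7<a (<-irrefl refl)

    module _ {α′ : ℕ → ℕ} (α≗ : AgreeUpTo m α α′) (α′-last : α′ (suc m) ≡ σ) (n<N̂ : n < N̂)
        (m<N̂ : m < N̂) where

      private
        task : Task S W N̂
        task = record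
          { f = 0 ; N = n ; σ = σ ; w₀ = 0 ; t = λ z → down α β z m ; β = β ; f≤4 = z≤n ; N<N̂ = n<N̂
          ; cmp = belowTest ; cmpF = _<ᵇ_ ; cmp-value = λ _ → refl ; cmp-cost = ≤-refl
          ; cmp-nf = λ _ → nf-var evident , nf-var evident ; μ₀ = μ₀ }

        open Sweeping k S W N̂ sizes task hiding (f<stride)
        open Looping k S W N̂ sizes task
        open Sweep advanceA 11 (Advancing.advancesA k S W N̂ sizes task λ _ _ → refl)
        module G = Growing k S W N̂ sizes

        -- The old bottom labels do not see the new character, so `down-cong` identifies them with
        -- those for `α′`; from there on the new row is the same recursion.
        carry-across : ∀ z → z ≤ n → carry z ≡ across α′ β z (suc m)
        new-down     : ∀ z → 1 ≤ z → z ≤ n → new z ≡ down α′ β z (suc m)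
        carry-across zero    _ = refl
        carry-across (suc z) z<n = cell-across (refl {x = β (suc z)}) (sym α′-last)
          (down-cong α≗ (λ j _ _ → refl {x = β j}) (suc z) m z<n ≤-refl) (carry-across z (<⇒≤ z<n))
        new-down (suc z) _ z<n = cell-down (refl {x = β (suc z)}) (sym α′-last)
          (down-cong α≗ (λ j _ _ → refl {x = β j}) (suc z) m z<n ≤-refl) (carry-across z (<⇒≤ z<n))

        untouched : ∀ {a} → 7 < a → ¬ InHalf 0 a → ¬ Touched a
        untouched 7<a ¬in (scratch _ a≤7) = <⇒≱ 7<a a≤7
        untouched 7<a ¬in (value z e) = ¬in (inj₂ (inj₂ (0 , z , s≤s z≤n , e)))
        untouched 7<a ¬in (link z e) = ¬in (inj₂ (inj₂ (2 , z , s≤s (s≤s (s≤s z≤n)) , e)))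

        rows-kept : ∀ {μ₁} → Swept μ₁ → ∀ a → InHalf 4 a → μ₁ a ≡ μ₀ a
        rows-kept (_ , _ , _ , frame₁) a a∈ = frame₁ a (untouched (inHalf>7 a∈) λ a∈′ → halves-disjoint a∈′ a∈)
          λ e → halves-disjoint (inj₂ (inj₁ e)) a∈

        input-kept : ∀ {μ₁} → Swept μ₁ → μ₁ 0 ≡ σ
        input-kept (_ , _ , _ , frame₁) = frame₁ 0 (λ { (scratch () _) }) λ ()

        length-kept : ∀ {μ₁} → Swept μ₁ → μ₁ 13 ≡ m
        length-kept swept = trans (rows-kept swept 13 (inj₁ refl)) (Half.len rows₀)

        Extended : Memory → Memory → Set
        Extended μ₁ μ₂ = Good S μ₂ × Half 4 μ₂ (suc (μ₁ 13)) (across α′ β n) α′ × μ₂ 2 ≡ suc (μ₁ 13)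
          × (∀ a → a ≢ 2 → a ≢ 7 → ¬ InHalf 4 a → μ₂ a ≡ μ₁ a)

        extend : ∀ {μ₁} → Swept μ₁ → ∃[ μ₂ ] (Reach (nodeCode 4) 70 μ₁ μ₂ × Extended μ₁ μ₂)
        extend {μ₁} swept@(g₁ , _ , e₅ , _) = G.appendNode {4} ≤-refl {μ₁} {across α′ β n} {α′} g₁
          (subst (λ m → Half 4 μ₁ m (across α′ β n) α′) (sym len≡)
            (Half-relabel k (λ z _ p → across-cong α≗ (λ j _ _ → refl {x = β j}) n z ≤-refl p) α≗
              (Half-cong rows₀ (rows-kept swept))))
          (subst (_< N̂) (sym len≡) m<N̂)
          (trans e₅ (trans (carry-across n ≤-refl) (cong (λ m → across α′ β n (suc m)) (sym len≡))))
          (trans (input-kept swept) (trans (sym α′-last) (cong (λ m → α′ (suc m)) (sym len≡))))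
          where len≡ = length-kept swept

        Indexed : Memory → Memory → Set
        Indexed μ₂ μ₃ = Good S μ₃ × Index k μ₃ (suc m) α′
          × (∀ a → a ≢ 7 → (∀ g z → 8 ≤ g → g < stride → a ≢ cell g z) → μ₃ a ≡ μ₂ a)

        reindex : ∀ {μ₁ μ₂} → Swept μ₁ → Extended μ₁ μ₂ →
          ∃[ μ₃ ] (Reach indexCode (k * 16 + 1 + 38) μ₂ μ₃ × Indexed μ₂ μ₃)
        reindex {μ₁} {μ₂} swept@(_ , _ , _ , frame₁) (g₂ , _ , e₂ , frame₂) =
          Indexing.updateIndex k S W N̂ sizes {μ₂} {m} {α′} {σ} g₂
              (trans e₂ (cong suc (length-kept swept))) m<N̂
            (trans (frame₂ 0 (λ ()) (λ ()) (λ a∈ → contradiction (inHalf>7 a∈) λ ())) (input-kept swept))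
            σ<k α′-last
            (Index-cong α≗ (Index-frame index₀ λ a a∈ →
              trans (frame₂ a (7<⇒≢2 (index>7 a∈)) (7<⇒≢7 (index>7 a∈)) (index-outside ≤-refl a∈))
                    (frame₁ a (untouched (index>7 a∈) (index-outside z≤n a∈)) λ e → index-outside z≤n a∈
                        (inj₂ (inj₁ e)))))

        assemble : ∀ {μ₁ μ₂ μ₃} → Swept μ₁ → Extended μ₁ μ₂ → Indexed μ₂ μ₃ → Rep k S μ₃ (suc m) n α′ β
        assemble {μ₁} {μ₂} {μ₃} swept@(_ , columns₁ , _) (_ , rows₂ , _ , frame₂) (g₃ , index₃ , frame₃) =
            record
          { good = g₃
          ; columns = Half-cong (Half-relabel k new-down (λ _ _ _ → refl) columns₁) λ a a∈ →
              trans (kept a (inHalf>7 a∈) (λ c → index-outside z≤n c a∈))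
                    (frame₂ a (7<⇒≢2 (inHalf>7 a∈)) (7<⇒≢7 (inHalf>7 a∈)) (halves-disjoint a∈))
          ; rows = Half-cong (subst (λ m → Half 4 μ₂ (suc m) (across α′ β n) α′)
              (length-kept swept) rows₂) λ a a∈ →
              kept a (inHalf>7 a∈) (λ c → index-outside ≤-refl c a∈)
          ; index = index₃ }
          where
          kept : ∀ a → 7 < a → ¬ IndexCell a → μ₃ a ≡ μ₂ a
          kept a 7<a ¬c = frame₃ a (7<⇒≢7 7<a) λ g z 8≤g g< e → ¬c (g , z , 8≤g , g< , e)

      appendA-correct : ∃[ μ′ ]
        ( Reach appendACode (costA (countAbove (λ z → down α β z m) 0 n)) μ₀ μ′
        × Rep k S μ′ (suc m) n α′ β )
      appendA-correct =
        let μ₁ , r₁ , swept    = sweep columns₀ good₀ refl (lit 0) 0<W refl (s≤s z≤n) (lit<S evident)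
            μ₂ , r₂ , extended = extend swept
            μ₃ , r₃ , indexed  = reindex swept extended
        in μ₃ , (r₁ then r₂ then r₃) , assemble swept extended indexed

    module _ {β′ : ℕ → ℕ} (β≗ : AgreeUpTo n β β′) (β′-last : β′ (suc n) ≡ σ) (n<N̂ : n < N̂)
        (m<N̂ : m < N̂) where

      private
        task : Task S W N̂
        task = record
          { f = 4 ; N = m ; σ = σ ; w₀ = suc n ; t = across α β n ; β = α ; f≤4 = ≤-refl ; N<N̂ = m<N̂
          ; cmp = aboveTest ; cmpF = λ c w → w <ᵇ c ; cmp-value = λ _ → refl ; cmp-cost = ≤-refl
          ; cmp-nf = λ _ → nf-var evident , nf-var evident ; μ₀ = μ₀ }

        open Sweeping k S W N̂ sizes task hiding (f<stride)
        open Looping k S W N̂ sizes task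
        open Sweep advanceB 45 (Advancing.advancesB k S W N̂ sizes task index₀ σ<k λ _ _ → refl)
        module G = Growing k S W N̂ sizes

        carry-down : ∀ z → z ≤ m → carry z ≡ down α β′ (suc n) z
        new-across : ∀ z → 1 ≤ z → z ≤ m → new z ≡ across α β′ (suc n) z
        carry-down zero    _ = refl
        carry-down (suc z) z<m = trans
          -- The program compares the stored character of `A` with the new one of `B`, in the
          -- opposite order to the grid.
          (cong (λ b → if b then across α β n (suc z) else carry z)
              (swaps-sym (α (suc z)) σ (carry z) (across α β n (suc z))))
          (cell-down (sym β′-last) (refl {x = α (suc z)}) (carry-down z (<⇒≤ z<m))
            (across-cong (λ j _ _ → refl {x = α j}) β≗ n (suc z) ≤-refl z<m))
        new-across (suc z) _ z<m = trans
          (cong (λ b → if b then carry z else across α β n (suc z))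
              (swaps-sym (α (suc z)) σ (carry z) (across α β n (suc z))))
          (cell-across (sym β′-last) (refl {x = α (suc z)}) (carry-down z (<⇒≤ z<m))
            (across-cong (λ j _ _ → refl {x = α j}) β≗ n (suc z) ≤-refl z<m))

        untouched : ∀ {a} → 7 < a → ¬ InHalf 4 a → ¬ Touched a
        untouched 7<a ¬in (scratch _ a≤7) = <⇒≱ 7<a a≤7
        untouched 7<a ¬in (value z e) = ¬in (inj₂ (inj₂ (0 , z , s≤s z≤n , e)))
        untouched 7<a ¬in (link z e) = ¬in (inj₂ (inj₂ (2 , z , s≤s (s≤s (s≤s z≤n)) , e)))

        sn<S : suc (μ₀ 9) < S
        sn<S = subst (λ n → suc n < S) (sym (Half.len columns₀)) (index<S n<N̂)

        columns-kept : ∀ {μ₁} → Swept μ₁ → ∀ a → InHalf 0 a → μ₁ a ≡ μ₀ a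
        columns-kept (_ , _ , _ , frame₁) a a∈ = frame₁ a (untouched (inHalf>7 a∈) (halves-disjoint a∈))
          λ e → halves-disjoint a∈ (inj₂ (inj₁ e))

        length-kept : ∀ {μ₁} → Swept μ₁ → μ₁ 9 ≡ n
        length-kept swept = trans (columns-kept swept 9 (inj₁ refl)) (Half.len columns₀)

        Extended : Memory → Memory → Set
        Extended μ₁ μ₂ = Good S μ₂ × Half 0 μ₂ (suc (μ₁ 9)) (λ z → down α β′ z m) β′ × μ₂ 2 ≡ suc (μ₁ 9)
          × (∀ a → a ≢ 2 → a ≢ 7 → ¬ InHalf 0 a → μ₂ a ≡ μ₁ a)

        extend : ∀ {μ₁} → Swept μ₁ → ∃[ μ₂ ] (Reach (nodeCode 0) 70 μ₁ μ₂ × Extended μ₁ μ₂)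
        extend {μ₁} swept@(g₁ , _ , e₅ , frame₁) = G.appendNode {0} z≤n {μ₁} {λ z → down α β′ z m} {β′} g₁
          (subst (λ n → Half 0 μ₁ n (λ z → down α β′ z m) β′) (sym len≡)
            (Half-relabel k (λ z _ p → down-cong (λ j _ _ → refl {x = α j}) β≗ z m p ≤-refl) β≗
              (Half-cong columns₀ (columns-kept swept))))
          (subst (_< N̂) (sym len≡) n<N̂)
          (trans e₅ (trans (carry-down m ≤-refl) (cong (λ n → down α β′ (suc n) m) (sym len≡))))
          (trans (frame₁ 0 (λ { (scratch () _) }) λ ())
              (trans (sym β′-last) (cong (λ n → β′ (suc n)) (sym len≡))))
          where len≡ = length-kept swept

        assemble : ∀ {μ₁ μ₂} → Swept μ₁ → Extended μ₁ μ₂ → Rep k S μ₂ m (suc n) α β′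
        assemble {μ₁} {μ₂} swept@(_ , rows₁ , _ , frame₁) (g₂ , columns₂ , _ , frame₂) = record
          { good = g₂
          ; columns = subst (λ n → Half 0 μ₂ (suc n) (λ z → down α β′ z m) β′) (length-kept swept) columns₂
          ; rows = Half-cong (Half-relabel k new-across (λ _ _ _ → refl) rows₁) λ a a∈ →
              frame₂ a (7<⇒≢2 (inHalf>7 a∈)) (7<⇒≢7 (inHalf>7 a∈)) (λ a∈′ → halves-disjoint a∈′ a∈)
          ; index = Index-frame index₀ λ a a∈ →
              trans (frame₂ a (7<⇒≢2 (index>7 a∈)) (7<⇒≢7 (index>7 a∈)) (index-outside z≤n a∈))
                    (frame₁ a (untouched (index>7 a∈) (index-outside ≤-refl a∈)) λ e →
                        index-outside ≤-refl a∈ (inj₂ (inj₁ e))) }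

      appendB-correct : ∃[ μ′ ]
        ( Reach appendBCode (costB (countAbove (across α β n) 0 m)) μ₀ μ′
        × Rep k S μ′ m (suc n) α β′ )
      appendB-correct =
        let μ₁ , r₁ , swept    = sweep rows₀ good₀ refl (add (lit 1) (var 9))
              (word (lit<S evident) , nf-var evident , word sn<S) (cong suc (Half.len columns₀)) ≤-refl
              (index<S n<N̂)
            μ₂ , r₂ , extended = extend swept
        in μ₂ , (r₁ then r₂) , assemble swept extended

-- Size bounds and the data structure

n<2^n : ∀ n → n < 2 ^ n
n<2^n zero    = s≤s z≤n
n<2^n (suc n) = ≤-trans (+-mono-≤ (m^n>0 2 n) (n<2^n n)) (+-monoʳ-≤ (2 ^ n) (m≤m+n (2 ^ n) 0))

-- Multiplies `s < 2 ^ s ≤ (N + 2) ^ s` by `N + 1 < N + 2`. It makes all addresses fit into a word.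
linear<power : ∀ s N → s * suc N < suc (suc N) ^ suc s
linear<power s N = subst (s * suc N <_) (*-comm (suc (suc N) ^ s) (suc (suc N)))
  (*-mono-< (<-≤-trans (n<2^n s) (^-monoˡ-≤ s (s≤s (s≤s z≤n)))) ≤-refl)

-- The two sides differ by `q + (a + c + b + e + r) * x`; adding this turns the claim into an
-- identity of semirings.
affine-bound : ∀ a c b q e r x →
  (a + (c + (b + (2 * x + 1) * q + e))) + r ≤ (a + c + b + e + r + 2 * q) * (1 + x)
affine-bound a c b q e r x = ≤-trans
  (m≤m+n ((a + (c + (b + (2 * x + 1) * q + e))) + r) (q + (a + c + b + e + r) * x))
  (≤-reflexive (solve 7 (λ a c b q e r x →
     ((a :+ (c :+ (b :+ (con 2 :* x :+ con 1) :* q :+ e))) :+ r) :+ (q :+ (a :+ c :+ b :+ e :+ r) :* x)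
     := (a :+ c :+ b :+ e :+ r :+ con 2 :* q) :* (con 1 :+ x)) refl a c b q e r x))
  where open +-*-Solver

module _ (k : ℕ) where
  open Layout k
  open Appending k

  -- Abstract, for otherwise wordBound gets unfolded to a large power.
  abstract
    spaceFactor : ℕ
    spaceFactor = 16 + (stride + stride)

    spaceFactor≡ : spaceFactor ≡ 16 + (stride + stride)
    spaceFactor≡ = refl

  wordExponent timeA timeB : ℕ
  wordExponent = suc spaceFactor
  timeA        = 22 + 11 + 5 + 8 + (70 + (k * 16 + 1 + 38)) + 2 * 92
  timeB        = 22 + 45 + 5 + 8 + 70 + 2 * 126

  costA≤ : ∀ x → costA x ≤ timeA * (1 + x)
  costA≤ = affine-bound 22 11 5 92 8 (70 + (k * 16 + 1 + 38))

  costB≤ : ∀ x → costB x ≤ timeB * (1 + x)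
  costB≤ = affine-bound 22 45 5 126 8 70

  sizes : ∀ (A B : String k) →
    Sizes k (space spaceFactor A B) (wordBound wordExponent A B) (1 + length A + length B)
  sizes A B = record
    { S<W   = linear<power spaceFactor (length A + length B)
    -- One stride per unit of `N̂` pays for the records; the field offset and the working cells fit
    -- into one further 16 + stride, which is absorbed because `N̂` is at least 1. This gives the 16
    -- and the two strides in `spaceFactor`.
    ; cell< = λ g z g< z≤ → begin-strict
        16 + g + z * stride                      <⟨ +-monoˡ-< (z * stride) (+-monoʳ-< 16 g<) ⟩
        16 + stride + z * stride                 ≤⟨ +-monoʳ-≤ (16 + stride) (*-monoˡ-≤ stride z≤) ⟩
        16 + stride + N̂ * stride                 ≤⟨ +-monoˡ-≤ (N̂ * stride) (m≤n*m (16 + stride) N̂) ⟩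
        N̂ * (16 + stride) + N̂ * stride           ≡⟨ *-distribˡ-+ N̂ (16 + stride) stride ⟨
        N̂ * (16 + stride + stride)               ≡⟨ cong (N̂ *_)
            (trans (+-assoc 16 stride stride) (sym spaceFactor≡)) ⟩
        N̂ * spaceFactor                          ≡⟨ *-comm N̂ spaceFactor ⟩
        spaceFactor * N̂                          ∎
    ; 1≤N̂   = s≤s z≤n }
    where
    open ≤-Reasoning
    N̂ = 1 + length A + length B

  Represented : Memory → String k → String k → Set
  Represented μ A B = Rep k (space spaceFactor A B) μ (length A) (length B) (at A) (at B)

  structure : DataStructure k
  structure = record
    { Represents = Represented
    ; head𝒦 = cell 2 0 ; head𝒥 = cell 6 0
    ; appendA = appendACode ; appendB = appendBCode }

  Good-mono : ∀ {S S′ μ} → S ≤ S′ → Good S μ → Good S′ μ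
  Good-mono S≤S′ (blank , bound) = (λ x S′≤x → blank x (≤-trans S≤S′ S′≤x)) , λ x → <-≤-trans (bound x) S≤S′

  represents-appendA : ∀ μ (A B : String k) σ → Represented μ A B →
    ∃[ t ] ∃[ μ′ ]
      ( Run (space spaceFactor (A ∷ʳ σ) B) (wordBound wordExponent (A ∷ʳ σ) B) appendACode (input μ σ) t μ′
      × t ≤ timeA * (1 + Δ A B)
      × Represented μ′ (A ∷ʳ σ) B )
  represents-appendA μ A B σ rep = finish result
    where
    n = length B
    m = length A
    S = space spaceFactor (A ∷ʳ σ) B
    longer : 1 + m + n ≤ 1 + length (A ∷ʳ σ) + n
    longer = +-monoˡ-≤ n (s≤s (≤-trans (n≤1+n m) (≤-reflexive (sym (length-∷ʳ A σ)))))
    widened : Rep k S μ m n (at A) (at B)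
    widened = record { good = Good-mono (*-monoʳ-≤ spaceFactor longer) (Rep.good rep)
                     ; columns = Rep.columns rep ; rows = Rep.rows rep ; index = Rep.index rep }
    result = appendA-correct (sizes (A ∷ʳ σ) B) widened (toℕ σ) (Fin.toℕ<n σ) (at-∷ʳ A σ) (at-last A σ)
      (s≤s (m≤n+m n _)) (subst (λ m′ → m < 1 + m′ + n) (sym (length-∷ʳ A σ))
          (s≤s (≤-trans (n≤1+n m) (m≤m+n (suc m) n))))
    finish :
      ∃[ μ′ ] ( Machine.Reach k S _ _ (sizes (A ∷ʳ σ) B) appendACode
          (costA (countAbove (bottoms A B) 0 n)) (input μ σ) μ′
              × Rep k S μ′ (suc m) n (at (A ∷ʳ σ)) (at B) ) →
      ∃[ t ] ∃[ μ′ ]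
        ( Run S (wordBound wordExponent (A ∷ʳ σ) B) appendACode (input μ σ) t μ′
        × t ≤ timeA * (1 + Δ A B)
        × Represented μ′ (A ∷ʳ σ) B )
    finish (μ′ , (t , run , t≤) , rep′) = t , μ′ , run
      , ≤-trans (subst (λ x → t ≤ costA x) (count-bottoms A B) t≤) (costA≤ (Δ A B))
      , subst (λ m′ → Rep k S μ′ m′ n (at (A ∷ʳ σ)) (at B)) (sym (length-∷ʳ A σ)) rep′

  represents-appendB : ∀ μ (A B : String k) σ → Represented μ A B →
    ∃[ t ] ∃[ μ′ ]
      ( Run (space spaceFactor A (B ∷ʳ σ)) (wordBound wordExponent A (B ∷ʳ σ)) appendBCode (input μ σ) t μ′
      × t ≤ timeB * (1 + LCS A B)
      × Represented μ′ A (B ∷ʳ σ) )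
  represents-appendB μ A B σ rep = finish result
    where
    n = length B
    m = length A
    S = space spaceFactor A (B ∷ʳ σ)
    longer : 1 + m + n ≤ 1 + m + length (B ∷ʳ σ)
    longer = +-monoʳ-≤ (1 + m) (≤-trans (n≤1+n n) (≤-reflexive (sym (length-∷ʳ B σ))))
    widened : Rep k S μ m n (at A) (at B)
    widened = record { good = Good-mono (*-monoʳ-≤ spaceFactor longer) (Rep.good rep)
                     ; columns = Rep.columns rep ; rows = Rep.rows rep ; index = Rep.index rep }
    result = appendB-correct (sizes A (B ∷ʳ σ)) widened (toℕ σ) (Fin.toℕ<n σ) (at-∷ʳ B σ) (at-last B σ)
      (<-≤-trans (s≤s (m≤n+m n m)) longer) (s≤s (m≤m+n m _))
    finish :
      ∃[ μ′ ] ( Machine.Reach k S _ _ (sizes A (B ∷ʳ σ)) appendBCode (costB (countAbove (rights A B) 0 m))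
          (input μ σ) μ′
              × Rep k S μ′ m (suc n) (at A) (at (B ∷ʳ σ)) ) →
      ∃[ t ] ∃[ μ′ ]
        ( Run S (wordBound wordExponent A (B ∷ʳ σ)) appendBCode (input μ σ) t μ′
        × t ≤ timeB * (1 + LCS A B)
        × Represented μ′ A (B ∷ʳ σ) )
    finish (μ′ , (t , run , t≤) , rep′) = t , μ′ , run
      , ≤-trans (subst (λ x → t ≤ costB x) (count-rights A B) t≤) (costB≤ (LCS A B))
      , subst (λ n′ → Rep k S μ′ m n′ (at A) (at (B ∷ʳ σ))) (sym (length-∷ʳ B σ)) rep′

  -- Blank apart from the two tail cells 10 and 14: even an empty list has a last link field, namely
  -- the head pointer in record 0.
  empty : Represented (((λ _ → 0) [ 10 ↦ cell 2 0 ]) [ 14 ↦ cell 6 0 ]) [] []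
  empty = record
    { good = Good-↦ {μ = (λ _ → 0) [ 10 ↦ cell 2 0 ]}
               (Good-↦ {μ = λ _ → 0} ((λ _ _ → refl) , λ _ → lit<S evident) (lit<S evident)
                   (cell< 2 0 (≤-trans evident (m≤m+n 8 _)) z≤n))
               (lit<S evident) (cell< 6 0 (≤-trans evident (m≤m+n 8 _)) z≤n)
    ; columns = emptyHalf 0 refl refl λ _ → refl
    ; rows = emptyHalf 4 refl refl λ _ → refl
    ; index = record { cnt = λ { c _ zero _ → refl } ; pos = λ c _ q 1≤q q≤0 → contradiction q≤0 (<⇒≱ 1≤q)
                     ; free = λ _ _ _ _ → refl } }
    where
    open Sizes (sizes [] [])
    open Machine k _ _ _ (sizes [] [])
    emptyHalf : ∀ f {μ t β} → μ (9 + f) ≡ 0 → μ (10 + f) ≡ cell (2 + f) 0 →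
        (∀ z → μ (cell (2 + f) z) ≡ 0) → Half f μ 0 t β
    emptyHalf f e e′ blank = record
      { len = e
      ; val = λ z 1≤z z≤0 → contradiction z≤0 (<⇒≱ 1≤z)
      ; idx = λ z 1≤z z≤0 → contradiction z≤0 (<⇒≱ 1≤z)
      ; chr = λ z 1≤z z≤0 → contradiction z≤0 (<⇒≱ 1≤z)
      ; lnk = λ z _ _ → inj₁ (blank z , λ y z<y y<1 → contradiction (s≤s⁻¹ y<1) (<⇒≱ (≤-<-trans z≤n z<y)))
      ; tail = 0 , z≤n , inj₁ refl , (λ y 0<y y<1 → contradiction (s≤s⁻¹ y<1) (<⇒≱ 0<y)) , e′ }

  -- The memory is the one that the updates themselves produce from the empty strings. The
  -- accumulator `P` holds the part appended so far, since characters arrive at the end.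
  represented : ∀ (A B : String k) → ∃[ μ ] Represented μ A B
  represented A B = extendA A [] (extendB B [] (_ , empty))
    where
    extendB : ∀ (B P : String k) → ∃[ μ ] Represented μ [] P → ∃[ μ ] Represented μ [] (P ++ B)
    extendB []      P (μ , rep) = μ , subst (Represented μ []) (sym (++-identityʳ P)) rep
    extendB (σ ∷ B) P (μ , rep) = let _ , μ′ , _ , _ , rep′ = represents-appendB μ [] P σ rep in
      subst (λ Q → ∃[ μ ] Represented μ [] Q) (∷ʳ-++ P σ B) (extendB B (P ∷ʳ σ) (μ′ , rep′))
    extendA : ∀ (A P : String k) → ∃[ μ ] Represented μ P B → ∃[ μ ] Represented μ (P ++ A) B
    extendA []      P (μ , rep) = μ , subst (λ Q → Represented μ Q B) (sym (++-identityʳ P)) rep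
    extendA (σ ∷ A) P (μ , rep) = let _ , μ′ , _ , _ , rep′ = represents-appendA μ P B σ rep in
      subst (λ Q → ∃[ μ ] Represented μ Q B) (∷ʳ-++ P σ A) (extendA A (P ∷ʳ σ) (μ′ , rep′))

  Half-encodes : ∀ {f μ N n t β} {D : Matrix} → Half f μ N t β → (∀ p → Labelled N t p ⇔ IsPivotal n N D p) →
    Encodes μ (cell (2 + f) 0) n N D
  Half-encodes half pivotal = let ps , stored , unique , iff = Half-list half in
    ps , stored , unique , λ p → mk⇔
      (λ p∈ → Equivalence.to (pivotal p) (Equivalence.to (iff p) p∈))
      (λ piv → Equivalence.from (iff p) (Equivalence.from (pivotal p) piv))

  encodes : ∀ μ (A B : String k) → Represented μ A B →
    Fits (space spaceFactor A B) (wordBound wordExponent A B) μ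
    × Encodes μ (cell 2 0) (length B) (length B) (𝒦 A B)
    × Encodes μ (cell 6 0) (length B) (length A) (𝒥 A B)
  encodes μ A B rep =
      (proj₁ good , λ x → <-trans (proj₂ good x) (Sizes.S<W (sizes A B)))
    , Half-encodes {D = 𝒦 A B} columns (pivotal-𝒦 A B)
    , Half-encodes {D = 𝒥 A B} rows (pivotal-𝒥 A B)
    where open Rep rep

theorem5p3 : (k : ℕ) → Σ (DataStructure k) λ D → let open DataStructure D in
    ∃[ s ] ∃[ w ] ∃[ a ] ∃[ b ]
    ( (∀ (A B : String k) → ∃[ μ ] Represents μ A B)
    × (∀ μ (A B : String k) → Represents μ A B →
    Fits (space s A B) (wordBound w A B) μ
    × Encodes μ head𝒦 (length B) (length B) (𝒦 A B)
    × Encodes μ head𝒥 (length B) (length A) (𝒥 A B))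
    × (∀ μ (A B : String k) (σ : Fin k) → Represents μ A B →
    ∃[ t ] ∃[ μ′ ]
    ( Run (space s (A ∷ʳ σ) B) (wordBound w (A ∷ʳ σ) B) appendA (input μ σ) t μ′
    × t ≤ a * (1 + Δ A B)
    × Represents μ′ (A ∷ʳ σ) B))
    × (∀ μ (A B : String k) (σ : Fin k) → Represents μ A B →
    ∃[ t ] ∃[ μ′ ]
    ( Run (space s A (B ∷ʳ σ)) (wordBound w A (B ∷ʳ σ)) appendB (input μ σ) t μ′
    × t ≤ b * (1 + LCS A B)
    × Represents μ′ A (B ∷ʳ σ))))
theorem5p3 k = structure k , spaceFactor k , wordExponent k , timeA k , timeB k
  , represented k , encodes k , represents-appendA k , represents-appendB k
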